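{- For every $\alpha>0$ there exists $n_0\in\mathbb{N}$ such that for all integers $n\geq n_0$ the following holds. If $H=([n],E)$ is a $3$-uniform hypergraph with $d(i,j)\geq \min\left(i,j,\frac{n}{2}\right)+\alpha n$ for all $ij\in[n]^{(2)}$, then $H$ contains a tight Hamiltonian cycle.
   Context: A $3$-uniform hypergraph (3-graph) $H=(V,E)$ has $E\subseteq V^{(3)}$ (3-element subsets). The vertices are the integers $1,\dots,n$, so $\min(i,j,n/2)$ refers to the integer values of the vertices. The pair degree is $d(i,j)=|\{x\in V: \{i,j,x\}\in E\}|$. A tight cycle of length $\ell\geq 4$ is a hypergraph on distinct vertices $x_1,\dots,x_\ell$ whose edges are $\{x_i,x_{i+1},x_{i+2}\}$ for all $i$ (indices modulo $\ell$); it is Hamiltonian if it contains all vertices of $H$. -}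

module Defs where

open import Data.Nat using (ℕ; zero; suc; _≤_)
open import Data.Nat.DivMod using (_mod_)
open import Data.Bool using (Bool; true; false)
open import Data.Fin using (Fin; toℕ)
open import Data.Fin.Permutation using (Permutation′; _⟨$⟩ʳ_)
open import Data.List using (List; length; filterᵇ; allFin)
open import Data.Integer using (+_)
open import Data.Rational using (ℚ; _/_; _⊓_; _+_; _*_)
open import Data.Product using (Σ; _×_)
open import Data.Empty using (⊥)
open import Relation.Binary.PropositionalEquality using (_≡_)

-- A 3-uniform hypergraph on the vertex set Fin n (vertex i : Fin n stands
-- for the integer toℕ i + 1 ∈ [n]).  The edge set E ⊆ V^(3) is encoded by
-- its (decidable) indicator on ordered triples, required to be invariant
-- under permutations and to vanish on triples with a repeated vertex.
record 3Graph (n : ℕ) : Set where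
  field
    edge    : Fin n → Fin n → Fin n → Bool
    sym₁₂   : ∀ x y z → edge x y z ≡ edge y x z
    sym₂₃   : ∀ x y z → edge x y z ≡ edge x z y
    nonloop : ∀ x y → edge x x y ≡ false
open 3Graph public

pairDeg : ∀ {n} → 3Graph n → Fin n → Fin n → ℕ
pairDeg {n} H i j = length (filterᵇ (λ x → edge H i j x) (allFin n))

ℕ→ℚ : ℕ → ℚ
ℕ→ℚ k = + k / 1

val : ∀ {n} → Fin n → ℚ
val i = ℕ→ℚ (suc (toℕ i))

TightHamCycle : ∀ {n} → 3Graph n → Set
TightHamCycle {zero}  H = ⊥
TightHamCycle {suc m} H =
  4 ≤ suc m ×
  Σ (Permutation′ (suc m)) λ σ →
    ∀ (k : Fin (suc m)) →
      edge H (σ ⟨$⟩ʳ (toℕ k mod suc m))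
             (σ ⟨$⟩ʳ (suc (toℕ k) mod suc m))
             (σ ⟨$⟩ʳ (suc (suc (toℕ k)) mod suc m)) ≡ true

-- The proof is an absorption argument in which every probabilistic choice is replaced by multiplicative
-- weights.  Call a pair high if both vertices lie in the upper half.  From any pair a tight path climbs to a
-- high pair, because the next vertex can be chosen at least σ higher, and two high pairs are joined through
-- the links of high vertices; so any two pairs are connected by a path of bounded length, even after few
-- vertices have been removed.
--
-- Absorption: a vertex v of the upper half can be inserted into a positive proportion of all 5-vertex tight
-- paths, and a vertex v of the lower half can replace the middle of a positive proportion of them, the
-- middle being σ higher than v.  Multiplicative weights pick disjoint 5-vertex paths ("gadgets") serving every
-- vertex linearly often; connect them into one path.  Leftover vertices rise at every replacement, so all of
-- them are absorbed after boundedly many steps each.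
--
-- Covering: keep extending the path by M further vertices while the set W of unused vertices keeps satisfying
-- Pósa's condition relative to its size.  For this the density in W of each neighbourhood N(x,y) and of each
-- upper segment must not drop.  By multiplicative weights it is enough to find, for any weights w on W, a
-- tight path of M vertices whose average weight is at most about the average of w.  If u(j) is the j-th
-- smallest weight, some j ≤ |W|/2 has u(j) + u(|W|-j) at most about twice the average.  Vertices of weight
-- ≤ u(j) and height ≥ j - σ have in pairs many common edges with the |W|-j lightest vertices, and a tight
-- path alternating light, light, heavy has average weight (2u(j) + u(|W|-j))/3 ≤ (u(j) + u(|W|-j))/2.
module Submission where

open import Defs
open import Data.Nat using (ℕ)

-- The obstacle is a vertex v of the lower half. A pair through v may have degree little more than
-- `ρ v`, so the neighbourhoods of two such pairs can be disjoint, and inserting v into a path,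
-- which uses several pairs through v at once, can fail. A replacement is found by double counting
-- alone, without intersecting neighbourhoods; it works because the surplus in the degrees exceeds
-- the number of positions just above v. The weights method turns a statement about all
-- neighbourhoods at once into one about a single weighted average, at the price of an error term
-- containing the logarithm of their number. A small multiple of n is affordable in place of that
-- logarithm. The constants avoid a circle in this way: the length of a connection depends on the
-- share of vertices left uncovered but not on M, so M is fixed afterwards and makes the connecting
-- vertices, whose weight is not controlled, negligible. All quantities are natural numbers; a
-- density is rounded down to a level, and a round of the covering may lose a bounded number of
-- levels on average.

module Prelude where
  open import Data.Bool public using (Bool; true; false; _∧_; _∨_; not; if_then_else_)
  open import Data.Nat public
  open import Data.Nat.Properties public
  open import Data.Nat.Tactic.RingSolver public
  open import Data.List public using (List; []; _∷_; _++_; length; cartesianProduct)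
  open import Data.List.Properties public using (length-++; ++-assoc)
  open import Data.List.Membership.Propositional public using (_∈_)
  open import Data.Product public using (∃; _×_; _,_; proj₁; proj₂)
  open import Data.Sum public using (_⊎_; inj₁; inj₂)
  open import Function public using (_∘_; id)
  open import Relation.Nullary public using (does; yes; no; contradiction; ¬_)
  open import Relation.Binary.PropositionalEquality public

-- Linear inequalities from explicit certificates.

module Certificates where
  open Prelude

  infixl 6 _⊕_
  infixr 7 _⊗_

  _⊕_ : ∀ {a b c d} → a ≤ b → c ≤ d → a + c ≤ b + d
  _⊕_ = +-mono-≤

  _⊗_ : ∀ k {a b} → a ≤ b → k * a ≤ k * b
  _⊗_ = *-monoʳ-≤

  -- L ≤ R follows from l ≤ r when R − L = (r − l) + t.
  cert : ∀ {l r L R} t → l ≤ r → L + r + t ≡ R + l → L ≤ R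
  cert {l} {r} {L} {R} t l≤r e = +-cancelʳ-≤ r L R
    (≤-trans (m≤m+n (L + r) t) (≤-trans (≤-reflexive e) (+-monoʳ-≤ R l≤r)))

  -- Integrality gains the remainder k after division by suc k.
  certₘ : ∀ k {l r L R} t → l ≤ r → suc k * L + r + t ≡ suc k * R + k + l → L ≤ R
  certₘ k {L = L} {R} t l≤r e = s≤s⁻¹ (*-cancelˡ-< (suc k) L (suc R) (begin-strict
    suc k * L      ≤⟨ cert t l≤r e ⟩
    suc k * R + k  <⟨ +-monoʳ-< (suc k * R) (n<1+n k) ⟩
    suc k * R + suc k ≡⟨ +-comm (suc k * R) (suc k) ⟩
    suc k + suc k * R ≡⟨ *-suc (suc k) R ⟨
    suc k * suc R  ∎))
    where open ≤-Reasoning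

-- Finite sums, cardinalities of decidable sets, and removal of lists of vertices.

module Counting where
  open Prelude
  open Certificates
  open import Data.Bool using (T)
  open import Data.Fin using (Fin; zero; suc)
  import Data.Fin as Fin
  open import Data.List.Membership.Propositional.Properties using (∈-allFin)
  open import Data.List using (map; allFin; tabulate)
  open import Data.List.Properties using (length-tabulate)
  open import Data.List.Relation.Unary.Any using (here; there)

  private variable
    A B : Set

  ∑ : List A → (A → ℕ) → ℕ
  ∑ []       f = 0
  ∑ (x ∷ xs) f = f x + ∑ xs f

  ∑-mono : ∀ (xs : List A) {f g} → (∀ x → f x ≤ g x) → ∑ xs f ≤ ∑ xs g
  ∑-mono []       h = z≤n
  ∑-mono (x ∷ xs) h = h x ⊕ ∑-mono xs h

  ∑-cong : ∀ (xs : List A) {f g} → (∀ x → f x ≡ g x) → ∑ xs f ≡ ∑ xs g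
  ∑-cong []       h = refl
  ∑-cong (x ∷ xs) h = cong₂ _+_ (h x) (∑-cong xs h)

  interchange : ∀ a b c d → (a + b) + (c + d) ≡ (a + c) + (b + d)
  interchange = solve-∀

  ∑-+ : ∀ (xs : List A) f g → ∑ xs (λ x → f x + g x) ≡ ∑ xs f + ∑ xs g
  ∑-+ []       f g = refl
  ∑-+ (x ∷ xs) f g = trans (cong (f x + g x +_) (∑-+ xs f g)) (interchange (f x) (g x) (∑ xs f) (∑ xs g))

  ∑-* : ∀ (xs : List A) c f → ∑ xs (λ x → c * f x) ≡ c * ∑ xs f
  ∑-* []       c f = sym (*-zeroʳ c)
  ∑-* (x ∷ xs) c f = trans (cong (c * f x +_) (∑-* xs c f)) (sym (*-distribˡ-+ c (f x) (∑ xs f)))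

  ∑-const : ∀ (xs : List A) c → ∑ xs (λ _ → c) ≡ length xs * c
  ∑-const []       c = refl
  ∑-const (x ∷ xs) c = cong (c +_) (∑-const xs c)

  ∑-swap : ∀ (xs : List A) (ys : List B) (f : A → B → ℕ) →
           ∑ xs (λ x → ∑ ys (f x)) ≡ ∑ ys (λ y → ∑ xs (λ x → f x y))
  ∑-swap []       ys f = sym (trans (∑-const ys 0) (*-zeroʳ (length ys)))
  ∑-swap (x ∷ xs) ys f = trans (cong (∑ ys (f x) +_) (∑-swap xs ys f))
                               (sym (∑-+ ys (f x) (λ y → ∑ xs (λ x → f x y))))

  ∑-< : ∀ (xs : List A) {f g} → ∑ xs f < ∑ xs g → ∃ λ x → f x < g x
  ∑-< (x ∷ xs) {f} {g} h with f x <? g x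
  ... | yes p = x , p
  ... | no  p = ∑-< xs (+-cancelˡ-< (g x) _ _ (≤-<-trans (+-monoˡ-≤ _ (≮⇒≥ p)) h))

  ∑-∈ : ∀ {xs : List A} {x} f → x ∈ xs → f x ≤ ∑ xs f
  ∑-∈ {xs = _ ∷ xs} f (here refl) = m≤m+n _ _
  ∑-∈ {xs = y ∷ xs} f (there i)   = ≤-trans (∑-∈ f i) (m≤n+m _ (f y))

  ∑-++ : ∀ (xs ys : List A) f → ∑ (xs ++ ys) f ≡ ∑ xs f + ∑ ys f
  ∑-++ []       ys f = refl
  ∑-++ (x ∷ xs) ys f = trans (cong (f x +_) (∑-++ xs ys f)) (sym (+-assoc (f x) _ _))

  ∑-map : ∀ (g : B → A) xs f → ∑ (map g xs) f ≡ ∑ xs (f ∘ g)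
  ∑-map g []       f = refl
  ∑-map g (x ∷ xs) f = cong (f (g x) +_) (∑-map g xs f)

  ∑-cartesianProduct : ∀ (xs : List A) (ys : List B) f →
    ∑ (cartesianProduct xs ys) f ≡ ∑ xs (λ x → ∑ ys (λ y → f (x , y)))
  ∑-cartesianProduct []       ys f = refl
  ∑-cartesianProduct (x ∷ xs) ys f =
    trans (∑-++ (map (x ,_) ys) _ f)
          (cong₂ _+_ (∑-map (x ,_) ys f) (∑-cartesianProduct xs ys f))

  bit : Bool → ℕ
  bit true  = 1
  bit false = 0

  bit≤1 : ∀ b → bit b ≤ 1
  bit≤1 true  = ≤-refl
  bit≤1 false = z≤n

  bit-true : ∀ {b} → 0 < bit b → b ≡ true
  bit-true {true} _ = refl

  ∧-elim : ∀ {a b} → a ∧ b ≡ true → a ≡ true × b ≡ true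
  ∧-elim {true} {true} _ = refl , refl

  ∧-intro : ∀ {a b} → a ≡ true → b ≡ true → a ∧ b ≡ true
  ∧-intro refl refl = refl

  not-elim : ∀ {b} → not b ≡ true → b ≡ false
  not-elim {false} _ = refl

  <ᵇ-true : ∀ {m n} → (m <ᵇ n) ≡ true → m < n
  <ᵇ-true {m} {n} e = <ᵇ⇒< m n (subst (λ b → T b) (sym e) _)

  <ᵇ-false : ∀ {m n} → (m <ᵇ n) ≡ false → n ≤ m
  <ᵇ-false {m} {n} e = ≮⇒≥ λ p → subst T e (<⇒<ᵇ p)

  ≮ᵇ⇒≥ : ∀ {m n} → not (m <ᵇ n) ≡ true → n ≤ m
  ≮ᵇ⇒≥ e = <ᵇ-false (not-elim e)

  <ᵇ-intro : ∀ {m n} → m < n → (m <ᵇ n) ≡ true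
  <ᵇ-intro {m} {n} p with m <ᵇ n in e
  ... | true  = refl
  ... | false = contradiction p (≤⇒≯ (<ᵇ-false e))

  ≮ᵇ-intro : ∀ {m n} → n ≤ m → not (m <ᵇ n) ≡ true
  ≮ᵇ-intro {m} {n} p with m <ᵇ n in e
  ... | true  = contradiction p (<⇒≱ (<ᵇ-true e))
  ... | false = refl

  bit-mono : ∀ {a b} → (a ≡ true → b ≡ true) → bit a ≤ bit b
  bit-mono {true}  h rewrite h refl = ≤-refl
  bit-mono {false} h = z≤n

  bit-∧ : ∀ w a b → bit (w ∧ a) + bit (w ∧ b) ≤ bit (w ∧ (a ∧ b)) + bit w
  bit-∧ true  true  true  = ≤-refl
  bit-∧ true  true  false = ≤-refl
  bit-∧ true  false true  = ≤-refl
  bit-∧ true  false false = z≤n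
  bit-∧ false _     _     = z≤n

  bit-split : ∀ w a q → bit (w ∧ a) ≤ bit (w ∧ (a ∧ not q)) + bit (w ∧ q)
  bit-split true  true  true  = ≤-refl
  bit-split true  true  false = ≤-refl
  bit-split true  false q     = z≤n
  bit-split false a     q     = z≤n

  module _ {n : ℕ} where

    opaque
      V : List (Fin n)
      V = allFin n

      length-V : length V ≡ n
      length-V = length-tabulate id

      ∈-V : ∀ v → v ∈ V
      ∈-V = ∈-allFin

    # : (Fin n → Bool) → ℕ
    # p = ∑ V (bit ∘ p)

    infixl 7 _∩_
    _∩_ : (p q : Fin n → Bool) → Fin n → Bool
    (p ∩ q) x = p x ∧ q x

    #-mono : ∀ {p q} → (∀ x → p x ≡ true → q x ≡ true) → # p ≤ # q
    #-mono h = ∑-mono V (λ x → bit-mono (h x))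

    #-∃ : ∀ {p} → 0 < # p → ∃ λ x → p x ≡ true
    #-∃ {p} h with ∑-< V (subst (_< # p) (sym (trans (∑-const V 0) (*-zeroʳ (length V)))) h)
    ... | x , e = x , bit-true e

    #-common : ∀ w a b → # (w ∩ a) + # (w ∩ b) ≤ # (w ∩ (a ∩ b)) + # w
    #-common w a b = begin
      # (w ∩ a) + # (w ∩ b)                       ≡⟨ ∑-+ V _ _ ⟨
      ∑ V (λ x → bit (w x ∧ a x) + bit (w x ∧ b x)) ≤⟨ ∑-mono V (λ x → bit-∧ (w x) (a x) (b x)) ⟩
      ∑ V (λ x → bit (w x ∧ (a x ∧ b x)) + bit (w x)) ≡⟨ ∑-+ V _ _ ⟩
      # (w ∩ (a ∩ b)) + # w                       ∎
      where open ≤-Reasoning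

    #-split : ∀ w a q → # (w ∩ a) ≤ # (w ∩ (a ∩ (not ∘ q))) + # (w ∩ q)
    #-split w a q = begin
      # (w ∩ a)                                   ≤⟨ ∑-mono V (λ x → bit-split (w x) (a x) (q x)) ⟩
      ∑ V (λ x → bit (w x ∧ (a x ∧ not (q x))) + bit (w x ∧ q x)) ≡⟨ ∑-+ V _ _ ⟩
      # (w ∩ (a ∩ (not ∘ q))) + # (w ∩ q)         ∎
      where open ≤-Reasoning

  ∑-tabulate : ∀ {n} (g : Fin n → A) f → ∑ (tabulate g) f ≡ ∑ (allFin n) (f ∘ g)
  ∑-tabulate {n = n} g f = go n g id (f ∘ g) (λ _ → refl)
    where
    go : ∀ {B C : Set} k {f′ : B → ℕ} (g : Fin k → B) (h : Fin k → C) (f : C → ℕ) →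
         (∀ i → f′ (g i) ≡ f (h i)) → ∑ (tabulate g) f′ ≡ ∑ (tabulate h) f
    go zero    g h f e = refl
    go (suc k) g h f e = cong₂ _+_ (e zero) (go k (g ∘ suc) (h ∘ suc) f (e ∘ suc))

  module _ {n : ℕ} where

    δ : Fin n → Fin n → ℕ
    δ x y = bit (does (x Fin.≟ y))

    δ-refl : ∀ x → δ x x ≡ 1
    δ-refl x with x Fin.≟ x
    ... | yes _ = refl
    ... | no ≢  = contradiction refl ≢

    δ-0 : ∀ {x y} → x ≢ y → δ x y ≡ 0
    δ-0 {x} {y} ≢ with x Fin.≟ y
    ... | yes e = contradiction e ≢
    ... | no _  = refl

    occ : Fin n → List (Fin n) → ℕ
    occ v l = ∑ l (δ v)

    -- Since a bit is at most 1, the single equation makes `l` free of repetitions, contained in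
    -- `W`, and complementary to `W′` there. Lists enter only through `occ`, so their order never
    -- matters.
    record Split (W : Fin n → Bool) (l : List (Fin n)) (W′ : Fin n → Bool) : Set where
      constructor split
      field at : ∀ v → occ v l + bit (W′ v) ≡ bit (W v)
    open Split public

  opaque
    unfolding V

    ∑-δ : ∀ {n} (x : Fin n) → ∑ V (λ v → δ v x) ≡ 1
    ∑-δ {suc n} zero    = cong suc (trans (∑-tabulate {n = n} suc (λ v → δ v zero))
                                        (trans (∑-const (V {n}) 0) (*-zeroʳ (length (V {n})))))
    ∑-δ {suc n} (suc x) = trans (∑-tabulate {n = n} suc (λ v → δ v (suc x))) (∑-δ x)

  module _ {n : ℕ} where

    private variable
      W W′ W″ : Fin n → Bool
      l l′    : List (Fin n)
      v x     : Fin n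

    ∑-occ : ∀ (l : List (Fin n)) → ∑ V (λ v → occ v l) ≡ length l
    ∑-occ l = begin
      ∑ V (λ v → ∑ l (δ v))           ≡⟨ ∑-swap V l δ ⟩
      ∑ l (λ x → ∑ V (λ v → δ v x))   ≡⟨ ∑-cong l ∑-δ ⟩
      ∑ l (λ _ → 1)                   ≡⟨ ∑-const l 1 ⟩
      length l * 1                    ≡⟨ *-identityʳ _ ⟩
      length l                        ∎
      where open ≡-Reasoning

    infixl 7 _─_
    _─_ : (Fin n → Bool) → Fin n → Fin n → Bool
    (W ─ x) v = W v ∧ not (does (v Fin.≟ x))

    remove : W x ≡ true → Split W (x ∷ []) (W ─ x)
    remove {W} {x} Wx .at v with v Fin.≟ x
    ... | yes refl rewrite Wx = refl
    ... | no _     with W v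
    ...   | true  = refl
    ...   | false = refl

    ─-intro : ∀ {W : Fin n → Bool} {x y} → W x ≡ true → x ≢ y → (W ─ y) x ≡ true
    ─-intro {x = x} {y} Wx ≢ with x Fin.≟ y
    ... | yes e = contradiction e ≢
    ... | no _  = ∧-intro Wx refl

    ─-elim : ∀ {W : Fin n → Bool} {x y} → (W ─ y) x ≡ true → W x ≡ true × x ≢ y
    ─-elim {W} {x} {y} e with x Fin.≟ y
    ... | yes _ = contradiction (proj₂ (∧-elim {W x} e)) λ ()
    ... | no ≢  = proj₁ (∧-elim e) , ≢

    #-─ : ∀ (p : Fin n → Bool) x → # p ≤ suc (# (p ─ x))
    #-─ p x = begin
      # p                                       ≤⟨ ∑-mono V bound ⟩
      ∑ V (λ v → δ v x + bit ((p ─ x) v))       ≡⟨ ∑-+ V _ _ ⟩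
      ∑ V (λ v → δ v x) + # (p ─ x)             ≡⟨ cong (_+ # (p ─ x)) (∑-δ x) ⟩
      suc (# (p ─ x))                           ∎
      where
      open ≤-Reasoning
      bound : ∀ v → bit (p v) ≤ δ v x + bit ((p ─ x) v)
      bound v with v Fin.≟ x
      ... | yes _ = ≤-trans (bit≤1 (p v)) (m≤m+n 1 _)
      ... | no _  = bit-mono λ e → ∧-intro e refl

    Split-⊆ : Split W l W′ → W′ v ≡ true → W v ≡ true
    Split-⊆ {l = l} {v = v} s e = bit-true (subst (0 <_) (s .at v) (≤-trans (subst (λ b → 0 < bit b) (sym e) ≤-refl) (m≤n+m _ (occ v l))))

    Split-++ : Split W l W′ → Split W′ l′ W″ → Split W (l ++ l′) W″
    Split-++ {l = l} {l′ = l′} s s′ .at v =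
      trans (cong (_+ _) (∑-++ l l′ (δ v))) (trans (+-assoc (occ v l) _ _) (trans (cong (occ v l +_) (s′ .at v)) (s .at v)))

    occ-++-comm : ∀ (l l′ : List (Fin n)) v → occ v (l ++ l′) ≡ occ v (l′ ++ l)
    occ-++-comm l l′ v = trans (∑-++ l l′ (δ v)) (trans (+-comm (occ v l) _) (sym (∑-++ l′ l (δ v))))

    Split-resp : (∀ v → occ v l′ ≡ occ v l) → Split W l W′ → Split W l′ W′
    Split-resp e s .at v = trans (cong (_+ _) (e v)) (s .at v)

    Split-++ʳ : Split W l W′ → Split W′ l′ W″ → Split W (l′ ++ l) W″
    Split-++ʳ {l = l} {l′ = l′} s s′ = Split-resp {l′ = l′ ++ l} {l ++ l′} (occ-++-comm l′ l) (Split-++ s s′)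

    Split-#∩ : Split W l W′ → ∀ p → # (W ∩ p) ≤ # (W′ ∩ p) + length l
    Split-#∩ {W} {l} {W′} s p = begin
      # (W ∩ p)                                     ≤⟨ ∑-mono V bound ⟩
      ∑ V (λ v → bit (W′ v ∧ p v) + occ v l)        ≡⟨ ∑-+ V _ _ ⟩
      # (W′ ∩ p) + ∑ V (λ v → occ v l)              ≡⟨ cong (# (W′ ∩ p) +_) (∑-occ l) ⟩
      # (W′ ∩ p) + length l                         ∎
      where
      open ≤-Reasoning
      bound : ∀ v → bit (W v ∧ p v) ≤ bit (W′ v ∧ p v) + occ v l
      bound v with p v | W v | W′ v | s .at v
      ... | false | false | _     | _ = z≤n
      ... | false | true  | _     | _ = z≤n
      ... | true  | false | _     | _ = z≤n
      ... | true  | true  | true  | _ = s≤s z≤n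
      ... | true  | true  | false | e = ≤-reflexive (trans (sym e) (+-identityʳ _))

    Split-# : Split W l W′ → length l + # W′ ≡ # W
    Split-# {W} {l} {W′} s = begin
      length l + # W′                       ≡⟨ cong (_+ # W′) (∑-occ l) ⟨
      ∑ V (λ v → occ v l) + # W′            ≡⟨ ∑-+ V _ _ ⟨
      ∑ V (λ v → occ v l + bit (W′ v))      ≡⟨ ∑-cong V (s .at) ⟩
      # W                                   ∎
      where open ≡-Reasoning

    Split-#⊆ : Split W l W′ → ∀ p → # (W′ ∩ p) ≤ # (W ∩ p)
    Split-#⊆ s p = #-mono λ x e → let a , b = ∧-elim e in ∧-intro (Split-⊆ s a) b

    Split-[] : Split W [] W
    Split-[] .at v = refl

-- Counting triples and discarding those with few completions.

module Triples where
  open Prelude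
  open Counting
  open import Data.Fin using (Fin)

  bit-light : ∀ t a b → bit t ≤ bit (t ∧ (not a ∧ not b)) + bit (t ∧ a) + bit (t ∧ b)
  bit-light true  true  true  = s≤s z≤n
  bit-light true  true  false = s≤s z≤n
  bit-light true  false true  = s≤s z≤n
  bit-light true  false false = s≤s z≤n
  bit-light false a     b     = z≤n

  module _ {n : ℕ} where

    private variable
      p q : Fin n → Bool

    ∑³ : (Fin n → Fin n → Fin n → ℕ) → ℕ
    ∑³ f = ∑ V λ x → ∑ V λ y → ∑ V λ z → f x y z

    #³ : (Fin n → Fin n → Fin n → Bool) → ℕ
    #³ t = ∑³ λ x y z → bit (t x y z)

    ∑³-mono : ∀ {f g} → (∀ x y z → f x y z ≤ g x y z) → ∑³ f ≤ ∑³ g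
    ∑³-mono h = ∑-mono V λ x → ∑-mono V λ y → ∑-mono V (h x y)

    ∑³-+ : ∀ f g → ∑³ (λ x y z → f x y z + g x y z) ≡ ∑³ f + ∑³ g
    ∑³-+ f g = trans (∑-cong V λ x → trans (∑-cong V λ y → ∑-+ V _ _) (∑-+ V _ _)) (∑-+ V _ _)

    ∑³-rotate : ∀ f → ∑³ f ≡ ∑³ (λ y z x → f x y z)
    ∑³-rotate f = trans (∑-swap V V _) (∑-cong V λ y → ∑-swap V V _)

    ∑³-∃ : ∀ {f} → 0 < ∑³ f → ∃ λ x → ∃ λ y → ∃ λ z → 0 < f x y z
    ∑³-∃ h =
      let x , hx = positive h ; y , hy = positive hx ; z , hz = positive hy in x , y , z , hz
      where
      positive : ∀ {f : Fin n → ℕ} → 0 < ∑ V f → ∃ λ x → 0 < f x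
      positive h = ∑-< V (≤-<-trans (≤-reflexive (trans (∑-const V 0) (*-zeroʳ (length (V {n}))))) h)

    ∑³-*ʳ : ∀ f c → ∑³ (λ x y z → f x y z * c) ≡ ∑³ f * c
    ∑³-*ʳ f c = trans (∑-cong V λ x → trans (∑-cong V λ y → ∑-*ʳ (f x y)) (∑-*ʳ (λ y → ∑ V (f x y)))) (∑-*ʳ (λ x → ∑ V (λ y → ∑ V (f x y))))
      where
      ∑-*ʳ : ∀ g → ∑ V (λ x → g x * c) ≡ ∑ V g * c
      ∑-*ʳ g = trans (∑-cong V λ x → *-comm (g x) c) (trans (∑-* V c g) (*-comm c _))

    ∑-bit* : ∀ (p : Fin n → Bool) c → ∑ V (λ x → bit (p x) * c) ≡ # p * c
    ∑-bit* p c = trans (∑-cong V λ x → *-comm (bit (p x)) c) (trans (∑-* V c _) (*-comm c _))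

    ∑-if : ∀ (p : Fin n → Bool) {c f} → (∀ x → p x ≡ true → c ≤ f x) → # p * c ≤ ∑ V f
    ∑-if p {c} {f} h = subst (_≤ ∑ V f) (∑-bit* p c) (∑-mono V pointwise)
      where
      pointwise : ∀ x → bit (p x) * c ≤ f x
      pointwise x with p x | h x
      ... | true  | k = subst (_≤ f x) (sym (+-identityʳ c)) (k refl)
      ... | false | _ = z≤n

    ∑-at-least : ∀ (p : Fin n → Bool) {k c f} → k ≤ # p → (∀ {x} → p x ≡ true → c ≤ f x) → k * c ≤ ∑ V f
    ∑-at-least p {c = c} k≤ h = ≤-trans (*-monoˡ-≤ c k≤) (∑-if p λ x → h)

    #-none : ∀ {f : Fin n → Bool} {c} → (∀ x → f x ≡ true → 0 ≡ 1) → # f ≤ c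
    #-none {f} {c} h = ≤-trans (∑-mono V (λ x → none x)) (≤-trans (≤-reflexive (trans (∑-const V 0) (*-zeroʳ (length V)))) z≤n)
      where
      none : ∀ x → bit (f x) ≤ 0
      none x with f x | h x
      ... | true  | k = contradiction (k refl) λ ()
      ... | false | _ = z≤n

    -- Each cell (y , z) meeting fewer than K of the triples contributes fewer than K.
    light : ∀ K (t : Fin n → Fin n → Fin n → Bool) →
            (∀ {x y z} → t x y z ≡ true → p y ≡ true × q z ≡ true) →
            ∑³ (λ x y z → bit (t x y z ∧ (# (λ x′ → t x′ y z) <ᵇ K))) ≤ # p * (# q * K)
    light {p} {q} K t supp = begin
      ∑³ (λ x y z → bit (t x y z ∧ (# (λ x′ → t x′ y z) <ᵇ K)))
        ≡⟨ ∑³-rotate (λ x y z → bit (t x y z ∧ (# (λ x′ → t x′ y z) <ᵇ K))) ⟩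
      ∑³ (λ y z x → bit (t x y z ∧ (# (λ x′ → t x′ y z) <ᵇ K)))
        ≤⟨ ∑-mono V (λ y → ∑-mono V (λ z → cell y z)) ⟩
      ∑ V (λ y → ∑ V (λ z → bit (p y) * (bit (q z) * K)))
        ≡⟨ ∑-cong V (λ y → trans (∑-* V (bit (p y)) _) (cong (bit (p y) *_) (∑-bit* q K))) ⟩
      ∑ V (λ y → bit (p y) * (# q * K))
        ≡⟨ ∑-bit* p (# q * K) ⟩
      # p * (# q * K) ∎
      where
      open ≤-Reasoning
      cell : ∀ y z → ∑ V (λ x → bit (t x y z ∧ (# (λ x′ → t x′ y z) <ᵇ K))) ≤ bit (p y) * (bit (q z) * K)
      cell y z with p y in py | q z in qz | # (λ x′ → t x′ y z) <ᵇ K in e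
      ... | true  | true  | true  = begin
        # (λ x → t x y z ∧ true)     ≤⟨ #-mono (λ x h → proj₁ (∧-elim h)) ⟩
        # (λ x → t x y z)            ≤⟨ <⇒≤ (<ᵇ-true e) ⟩
        K                            ≡⟨ trans (*-identityˡ _) (*-identityˡ K) ⟨
        1 * (1 * K)                  ∎
      ... | true  | true  | false = #-none λ x h → contradiction (proj₂ (∧-elim {t x y z} h)) λ ()
      ... | true  | false | b     = #-none λ x h → contradiction (trans (sym (proj₂ (supp {x} (proj₁ (∧-elim h))))) qz) λ ()
      ... | false | _     | b     = #-none λ x h → contradiction (trans (sym (proj₁ (supp {x} (proj₁ (∧-elim h))))) py) λ ()

    -- A discarded triple has fewer than `K` choices for its first or for its second coordinate, and
    -- `light` bounds both kinds. In a surviving triple each of these two coordinates can be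
    -- exchanged even when fewer than `K` vertices are forbidden.
    ∑³-heavy : ∀ K {p q r : Fin n → Bool} (t : Fin n → Fin n → Fin n → Bool) →
      (∀ {x y z} → t x y z ≡ true → p x ≡ true × q y ≡ true × r z ≡ true) →
      #³ t ≤ ∑³ (λ x y z → bit (t x y z ∧ (not (# (λ x′ → t x′ y z) <ᵇ K) ∧ not (# (λ y′ → t x y′ z) <ᵇ K))))
             + # q * (# r * K) + # r * (# p * K)
    ∑³-heavy K {p} {q} {r} t supp = begin
      #³ t
        ≤⟨ ∑³-mono (λ x y z → bit-light (t x y z) (A y z) (B z x)) ⟩
      ∑³ (λ x y z → heavy x y z + lightA x y z + lightB x y z)
        ≡⟨ ∑³-+ (λ x y z → heavy x y z + lightA x y z) lightB ⟩
      ∑³ (λ x y z → heavy x y z + lightA x y z) + ∑³ lightB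
        ≡⟨ cong (_+ ∑³ lightB) (∑³-+ heavy lightA) ⟩
      ∑³ heavy + ∑³ lightA + ∑³ lightB
        ≤⟨ +-mono-≤ (+-monoʳ-≤ (∑³ heavy) (light {q} {r} K t (λ h → proj₂ (supp h)))) lightB≤ ⟩
      ∑³ heavy + # q * (# r * K) + # r * (# p * K) ∎
      where
      open ≤-Reasoning
      A B : Fin n → Fin n → Bool
      A y z = # (λ x′ → t x′ y z) <ᵇ K
      B z x = # (λ y′ → t x y′ z) <ᵇ K
      heavy lightA lightB : Fin n → Fin n → Fin n → ℕ
      heavy x y z = bit (t x y z ∧ (not (A y z) ∧ not (B z x)))
      lightA x y z = bit (t x y z ∧ A y z)
      lightB x y z = bit (t x y z ∧ B z x)
      lightB≤ : ∑³ lightB ≤ # r * (# p * K)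
      lightB≤ = ≤-trans (≤-reflexive (∑³-rotate lightB))
        (light {r} {p} K (λ y z x → t x y z) (λ h → let a , _ , c = supp h in c , a))

-- Tight paths, Pósa's condition, and climbing to the upper half.

module Paths {n : ℕ} (H : 3Graph n) where
  open Prelude
  open Certificates
  open Counting
  open import Data.Fin using (Fin)

  private variable
    a b c d e f x y z : Fin n
    W W′ : Fin n → Bool
    ρ : Fin n → ℕ
    l l′ : List (Fin n)
    h s : ℕ

  E : Fin n → Fin n → Fin n → Set
  E x y z = edge H x y z ≡ true

  N : Fin n → Fin n → Fin n → Bool
  N = edge H

  E-swap₁ : E x y z → E y x z
  E-swap₁ {x} {y} {z} e = trans (sym (sym₁₂ H x y z)) e

  E-swap₂ : E x y z → E x z y
  E-swap₂ {x} {y} {z} e = trans (sym (sym₂₃ H x y z)) e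

  E-rotate : E x y z → E y z x
  E-rotate e = E-swap₂ (E-swap₁ e)

  E-reverse : E x y z → E z y x
  E-reverse e = E-swap₁ (E-rotate e)

  E-≢₁₂ : E x y z → x ≢ y
  E-≢₁₂ {x} {z = z} e refl = contradiction (trans (sym e) (nonloop H x z)) λ ()

  E-≢₂₃ : E x y z → y ≢ z
  E-≢₂₃ e = E-≢₁₂ (E-rotate e)

  E-≢₁₃ : E x y z → x ≢ z
  E-≢₁₃ e = E-≢₁₂ (E-swap₂ e)

  -- Path a b l c d: the sequence l ++ c ∷ d ∷ [] starts with a , b and any three consecutive
  -- entries form an edge.  In particular Path a b l a b is a closed tight walk through l.
  data Path : Fin n → Fin n → List (Fin n) → Fin n → Fin n → Set where
    []  : Path a b [] a b
    _∷_ : E a b c → Path b c l d e → Path a b (a ∷ l) d e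

  infixr 5 _⋈_
  _⋈_ : Path a b l c d → Path c d l′ e f → Path a b (l ++ l′) e f
  []      ⋈ q = q
  (e ∷ p) ⋈ q = e ∷ (p ⋈ q)

  -- The list of a path omits its final pair, and reversal changes which pair is final. Hence only
  -- the lists completed by that pair have equal counts.
  Path-reverse : Path a b l c d → ∃ λ l′ → Path d c l′ b a ×
                 (∀ v → occ v (b ∷ a ∷ l′) ≡ occ v (d ∷ c ∷ l))
  Path-reverse {b = b} [] = [] , [] , λ v → refl
  Path-reverse {a = a} {b = b} {c = d} {d = e} (_∷_ {c = c} {l = l} abc p) with Path-reverse p
  ... | l′ , q , o = l′ ++ c ∷ [] , q ⋈ (E-reverse abc ∷ []) , λ v → begin
      δ v b + (δ v a + occ v (l′ ++ c ∷ []))        ≡⟨ cong (λ t → δ v b + (δ v a + t)) (∑-++ l′ (c ∷ []) (δ v)) ⟩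
      δ v b + (δ v a + (occ v l′ + (δ v c + 0)))    ≡⟨ move₁ (δ v b) (δ v a) (occ v l′) (δ v c) ⟩
      δ v a + (δ v c + (δ v b + occ v l′))          ≡⟨ cong (δ v a +_) (o v) ⟩
      δ v a + (δ v e + (δ v d + occ v l))           ≡⟨ move₂ (δ v a) (δ v e) (δ v d) (occ v l) ⟩
      δ v e + (δ v d + (δ v a + occ v l))           ∎
    where
    open ≡-Reasoning
    move₁ : ∀ p q r s → p + (q + (r + (s + 0))) ≡ q + (s + (p + r))
    move₁ = solve-∀
    move₂ : ∀ p q r s → p + (q + (r + s)) ≡ q + (r + (p + s))
    move₂ = solve-∀

  atLeast : (Fin n → ℕ) → ℕ → Fin n → Bool
  atLeast ρ c = not ∘ λ z → ρ z <ᵇ c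

  -- Pósa's condition for the degrees into W, where ρ is the position of a vertex and h is half the size of W.
  record Posa (h s : ℕ) (W : Fin n → Bool) (ρ : Fin n → ℕ) : Set where
    field
      low  : ∀ c → # (W ∩ (λ x → ρ x <ᵇ c)) ≤ c
      size : # W ≤ suc (h + h)
      deg  : ∀ {x y} → x ≢ y → ∀ c → c ≤ ρ x → c ≤ ρ y → c ≤ h → c + s ≤ # (W ∩ N x y)
  open Posa public

  Posa-split : Split W l W′ → ∀ k → length l ≤ k → Posa h (k + s) W ρ → Posa h s W′ ρ
  Posa-split s k _ P .low c = ≤-trans (Split-#⊆ s _) (P .low c)
  Posa-split {W = W} {W′ = W′} s k _ P .size = ≤-trans (≤-trans (m≤n+m (# W′) _) (≤-reflexive (Split-# s))) (P .size)
  Posa-split {W = W} {W′ = W′} {s = s} sp k l≤k P .deg {x} {y} x≢y c cx cy ch =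
    arith c s (P .deg x≢y c cx cy ch) (Split-#∩ sp (N x y)) l≤k
    where
    arith : ∀ c {k} s {d d' l} → c + (k + s) ≤ d → d ≤ d' + l → l ≤ k → c + s ≤ d'
    arith c {k} s {d} {d'} {l} h0 h1 h2 =
      cert 0 (h0 ⊕ h1 ⊕ h2) (solve (c ∷ k ∷ s ∷ d ∷ d' ∷ l ∷ []))

  Posa-weaken : ∀ k → Posa h (k + s) W ρ → Posa h s W ρ
  Posa-weaken k P .low = P .low
  Posa-weaken k P .size = P .size
  Posa-weaken {s = s} k P .deg x≢y c cx cy ch = ≤-trans (+-monoʳ-≤ c (m≤n+m s k)) (P .deg x≢y c cx cy ch)

  module _ (P : Posa h s W ρ) where

    -- At most `c + k` vertices of `W` lie below position `c + k`, while `N x y` meets `W` in at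
    -- least `c + s`. The ends `x` and `y` need not belong to `W`, so a path whose vertices are
    -- already removed can be continued.
    deg-high : x ≢ y → ∀ c k → c ≤ ρ x → c ≤ ρ y → c ≤ h → s ≤ # (W ∩ (N x y ∩ atLeast ρ (c + k))) + k
    deg-high {x} {y} x≢y c k cx cy ch =
      arith (P .deg x≢y c cx cy ch) (#-split W (N x y) (λ z → ρ z <ᵇ c + k)) (P .low (c + k))
      where
      arith : ∀ {c s d d' l k} → c + s ≤ d → d ≤ d' + l → l ≤ c + k → s ≤ d' + k
      arith {c} {s} {d} {d'} {l} {k} h0 h1 h2 =
        cert 0 (h0 ⊕ h1 ⊕ h2) (solve (c ∷ s ∷ d ∷ d' ∷ l ∷ k ∷ []))

    deg-top : x ≢ y → h ≤ ρ x → h ≤ ρ y → s ≤ # (W ∩ (N x y ∩ atLeast ρ h))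
    deg-top {x} {y} x≢y hx hy =
      arith (P .deg x≢y h hx hy ≤-refl) (#-split W (N x y) (λ z → ρ z <ᵇ h)) (P .low h)
      where
      arith : ∀ {c s d d' l} → c + s ≤ d → d ≤ d' + l → l ≤ c → s ≤ d'
      arith {c} {s} {d} {d'} {l} h0 h1 h2 =
        cert 0 (h0 ⊕ h1 ⊕ h2) (solve (c ∷ s ∷ d ∷ d' ∷ l ∷ []))

    -- Two sets of at least `h + s` elements inside a set of at most `2 h + 1`; the `suc` is the
    -- price of an odd size.
    common-top : a ≢ b → h ≤ ρ a → h ≤ ρ b → c ≢ d → h ≤ ρ c → h ≤ ρ d →
                 s + s ≤ suc (# (W ∩ (N a b ∩ N c d)))
    common-top {a} {b} {c} {d} a≢b ha hb c≢d hc hd =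
      arith h s (P .deg a≢b h ha hb ≤-refl) (P .deg c≢d h hc hd ≤-refl) (#-common W (N a b) (N c d)) (P .size)
      where
      arith : ∀ h s {a b i w} → h + s ≤ a → h + s ≤ b → a + b ≤ i + w → w ≤ suc (h + h) → s + s ≤ suc i
      arith h s {a} {b} {i} {w} h0 h1 h2 h3 =
        cert 0 (h0 ⊕ h1 ⊕ h2 ⊕ h3) (solve (h ∷ s ∷ a ∷ b ∷ i ∷ w ∷ []))

  private
    pos : ∀ {k s d} → suc (k + s) ≤ d + s → 0 < d
    pos {k} {s} {d} h0 =
      cert k h0 (solve (k ∷ s ∷ d ∷ []))

  -- The path is written from the high pair towards `x y`, so climbing prepends vertices. For the
  -- initial pair `a b` of a connection one climbs from `b a` and reverses.
  record Climb (k h : ℕ) (W : Fin n → Bool) (ρ : Fin n → ℕ) (x y : Fin n) : Set where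
    constructor climbed
    field
      {u v}    : Fin n
      {new}    : List (Fin n)
      {rest}   : Fin n → Bool
      path     : Path u v new x y
      distinct : u ≢ v
      removed  : Split W new rest
      count    : length new ≡ k + k
      top₁     : h ≤ ρ u
      top₂     : h ≤ ρ v

  pick-high : ∀ (W : Fin n → Bool) {a b ρ c} → 0 < # (W ∩ (N a b ∩ atLeast ρ c)) →
              ∃ λ x → W x ≡ true × E a b x × c ≤ ρ x
  pick-high W {a} {b} h =
    let x , e = #-∃ h ; Wx , e′ = ∧-elim {W x} e ; abx , cx = ∧-elim {N a b x} e′ in x , Wx , abx , ≮ᵇ⇒≥ cx

  -- A round adds two vertices, after which both members of the front pair lie at least `σ` above
  -- the old bound `u`. The new bound is cut off at `h`, because the degree condition speaks only of
  -- values up to `h`; hence the minimum in `reach`.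
  climb : ∀ k σ u → Posa h (k + k + σ) W ρ → x ≢ y → u ≤ ρ x → u ≤ ρ y → u ≤ h → h ≤ u + k * σ →
          Climb k h W ρ x y
  climb zero σ u P x≢y ux uy uh hu = climbed [] x≢y Split-[] refl (≤-trans h≤u ux) (≤-trans h≤u uy)
    where h≤u = subst (_ ≤_) (+-identityʳ u) hu
  climb {h} {W} {ρ} {x} {y} (suc k) σ u P x≢y ux uy uh hu =
    first (pick-high W (pos {k + suc k} (deg-high P x≢y u σ ux uy uh)))
    where
    reach : h ≤ (u + σ) ⊓ h + k * σ
    reach with ≤-total (u + σ) h
    ... | inj₁ le = subst (λ q → h ≤ q + k * σ) (sym (m≤n⇒m⊓n≡m le)) (subst (h ≤_) (sym (+-assoc u σ (k * σ))) hu)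
    ... | inj₂ ge = subst (λ q → h ≤ q + k * σ) (sym (m≥n⇒m⊓n≡n ge)) (m≤m+n h _)
    double : ∀ k → k + k + 2 ≡ suc k + suc k
    double = solve-∀
    first : (∃ λ z → W z ≡ true × E x y z × u + σ ≤ ρ z) → Climb (suc k) h W ρ x y
    first (z , Wz , xyz , hz) =
      second (pick-high (W ─ z) (pos {k + k} (deg-high P₁ (≢-sym (E-≢₁₃ xyz)) u σ (≤-trans (m≤m+n u σ) hz) ux uh)))
      where
      P₁ : Posa h (suc (k + k) + σ) (W ─ z) ρ
      P₁ = subst (λ t → Posa h (t + σ) (W ─ z) ρ) (+-suc k k) (Posa-split {s = k + suc k + σ} (remove Wz) 1 ≤-refl P)
      second : (∃ λ t → (W ─ z) t ≡ true × E z x t × u + σ ≤ ρ t) → Climb (suc k) h W ρ x y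
      second (t , Wt , zxt , ht) = extend (climb {ρ = ρ} {x = t} {z} k σ ((u + σ) ⊓ h)
        (Posa-split (remove {x = t} Wt) 1 ≤-refl P₁) (≢-sym (E-≢₁₃ zxt))
        (≤-trans (m⊓n≤m _ h) ht) (≤-trans (m⊓n≤m _ h) hz) (m⊓n≤n _ h) reach)
        where
        extend : Climb k h (W ─ z ─ t) ρ t z → Climb (suc k) h W ρ x y
        extend (climbed {new = l} p d r c t₁ t₂) = climbed (p ⋈ (E-rotate (E-rotate zxt) ∷ (E-rotate (E-rotate xyz) ∷ []))) d
          (Split-++ʳ {l = t ∷ z ∷ []} (Split-++ʳ {l = z ∷ []} (remove Wz) (remove Wt)) r)
          (trans (length-++ l) (trans (cong (_+ 2) c) (double k))) t₁ t₂

-- Connecting two arbitrary pairs by a path of bounded length.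

module Connecting {n : ℕ} (H : 3Graph n) where
  open Prelude
  open Certificates
  open Counting
  open Triples
  open Paths H
  open import Data.Fin using (Fin)

  private variable
    a b c d x y z : Fin n
    W W′ : Fin n → Bool
    ρ : Fin n → ℕ
    h s : ℕ

  tri : (A B C : Fin n → Bool) → Fin n → Fin n → Fin n → Bool
  tri A B C x y z = A x ∧ (B y ∧ (C z ∧ edge H x y z))

  tri-elim : ∀ {A B C : Fin n → Bool} → tri A B C x y z ≡ true →
             A x ≡ true × B y ≡ true × C z ≡ true × E x y z
  tri-elim {x} {y} {z} {A} {B} {C} e =
    let a , e₁ = ∧-elim {A x} e ; b , e₂ = ∧-elim {B y} e₁ ; c , e₃ = ∧-elim {C z} e₂ in a , b , c , e₃

  tri-intro : ∀ {A B C : Fin n → Bool} → A x ≡ true → B y ≡ true → C z ≡ true → E x y z → tri A B C x y z ≡ true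
  tri-intro a b c e = ∧-intro a (∧-intro b (∧-intro c e))

  -- One element of `B` is given up to keep `y` different from `x`, hence `suc k`.
  #³-tri : ∀ {A B C : Fin n → Bool} {k p s} → (∀ {x y} → A x ≡ true → B y ≡ true → x ≢ y → s ≤ # (C ∩ N x y)) →
           p ≤ # A → suc k ≤ # B → p * (k * s) ≤ #³ (tri A B C)
  #³-tri {A} {B} {C} {k} {p} {s} deg p≤ k≤ =
    ≤-trans (*-monoˡ-≤ (k * s) p≤) (∑-if A λ x Ax →
      ≤-trans (*-monoˡ-≤ s (s≤s⁻¹ (≤-trans k≤ (#-─ B x)))) (∑-if (B ─ x) λ y By →
        let b , y≢x = ─-elim {W = B} By in
        ≤-trans (deg Ax b (≢-sym y≢x)) (#-mono λ z e → let c , xyz = ∧-elim {C z} e in tri-intro {A = A} {B} {C} Ax b c xyz)))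

  topNbr : (W : Fin n → Bool) (ρ : Fin n → ℕ) (h : ℕ) (a b : Fin n) → Fin n → Bool
  topNbr W ρ h a b = W ∩ (N a b ∩ atLeast ρ h)

  topNbr-elim : ∀ W ρ h a b → topNbr W ρ h a b x ≡ true → W x ≡ true × E a b x × h ≤ ρ x
  topNbr-elim {x = x} W ρ h a b e =
    let Wx , e′ = ∧-elim {W x} e ; abx , cx = ∧-elim {N a b x} e′ in Wx , abx , ≮ᵇ⇒≥ cx

  remove₃ : W x ≡ true → W y ≡ true → W z ≡ true → x ≢ y → x ≢ z → y ≢ z → Split W (x ∷ y ∷ z ∷ []) (W ─ x ─ y ─ z)
  remove₃ {W} {x} {y} {z} Wx Wy Wz x≢y x≢z y≢z =
    Split-++ {l = x ∷ []} (remove Wx) (Split-++ {l = y ∷ []} (remove (─-intro {W = W} Wy (≢-sym x≢y)))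
      (remove (─-intro {W = W ─ x} (─-intro {W = W} Wz (≢-sym x≢z)) (≢-sym y≢z))))

  module _ (P : Posa h s W ρ) (0<s : 0 < s) where

    -- By pigeonhole two vertices v₁ , v₂ of V₁ have a common path x u u′ y in their links.
    link : ∀ K (V₁ : Fin n → Bool) → # W * # W < K * (s * s) → h ≤ ρ x → h ≤ ρ y →
      (∀ {v} → W v ∧ V₁ v ≡ true → E b x v × E y c v × h ≤ ρ v) → K ≤ # (W ∩ V₁) →
      ∃ λ l → ∃ λ W′ → Path b x (b ∷ x ∷ l) y c × Split W l W′ × length l ≡ 4
    link {x = x} {y} {b} {c} K V₁ small hx hy good many = result
      where
      g : Fin n → Fin n → Fin n → Bool
      g v u u′ = W u ∧ (W u′ ∧ (edge H v x u ∧ (edge H v u u′ ∧ edge H v y u′)))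

      t : Fin n → Fin n → Fin n → Bool
      t v u u′ = (W ∩ V₁) v ∧ g v u u′

      half : ∀ {s d} → 0 < s → s + s ≤ suc d → s ≤ d
      half {s} {d} h0 h1 =
        cert 0 (h0 ⊕ h1) (solve (s ∷ d ∷ []))

      record Common (v u u′ : Fin n) : Set where
        constructor common
        field
          Wv   : W v ≡ true
          Vv   : V₁ v ≡ true
          Wu   : W u ≡ true
          Wu′  : W u′ ≡ true
          vxu  : E v x u
          vuu′ : E v u u′
          vyu′ : E v y u′
      open Common

      t-elim : ∀ {v u u′} → t v u u′ ≡ true → Common v u u′
      t-elim {v} {u} {u′} e =
        let e₁ , e₂ = ∧-elim {(W ∩ V₁) v} e ; a , b = ∧-elim {W v} e₁ ; c , e₃ = ∧-elim {W u} e₂ ; d , e₄ = ∧-elim {W u′} e₃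
            p , e₅ = ∧-elim {edge H v x u} e₄ ; q , r = ∧-elim {edge H v u u′} e₅ in common a b c d p q r

      t-intro : ∀ {v u u′} → Common v u u′ → t v u u′ ≡ true
      t-intro k = ∧-intro (∧-intro (k .Wv) (k .Vv)) (∧-intro (k .Wu) (∧-intro (k .Wu′) (∧-intro (k .vxu) (∧-intro (k .vuu′) (k .vyu′)))))

      good′ : ∀ {v u u′} → Common v u u′ → E b x v × E y c v × h ≤ ρ v
      good′ k = good (∧-intro (k .Wv) (k .Vv))

      second : ∀ {v u} → W v ≡ true → V₁ v ≡ true → (W u ≡ true × E v x u × h ≤ ρ u) → s ≤ ∑ V (λ u′ → bit (t v u u′))
      second {v} {u} Wv Vv (Wu , vxu , hu) =
        let bxv , ycv , hv = good (∧-intro Wv Vv) in ≤-trans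
        (half 0<s (common-top P (E-≢₁₃ vxu) hv hu (≢-sym (E-≢₁₃ ycv)) hv hy))
        (#-mono λ u′ e → let Wu′ , f = ∧-elim {W u′} e ; vuu′ , vyu′ = ∧-elim {edge H v u u′} f in
          t-intro (common Wv Vv Wu Wu′ vxu vuu′ vyu′))

      first : ∀ {v} → (W ∩ V₁) v ≡ true → s * s ≤ ∑ V (λ u → ∑ V (λ u′ → bit (t v u u′)))
      first {v} e =
        let Wv , Vv = ∧-elim {W v} e ; bxv , _ , hv = good e in
        ≤-trans (*-monoˡ-≤ s (deg-top P (≢-sym (E-≢₂₃ bxv)) hv hx)) (∑-if _ λ u Wu → second Wv Vv (topNbr-elim W ρ h v x Wu))

      total : ∑ V (λ u → ∑ V (λ u′ → bit (W u) * bit (W u′))) < ∑ V (λ u → ∑ V (λ u′ → # (λ v → t v u u′)))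
      total = begin-strict
        ∑ V (λ u → ∑ V (λ u′ → bit (W u) * bit (W u′)))   ≡⟨ ∑-cong V (λ u → ∑-* V (bit (W u)) _) ⟩
        ∑ V (λ u → bit (W u) * # W)                       ≡⟨ ∑-bit* W (# W) ⟩
        # W * # W                                         <⟨ small ⟩
        K * (s * s)                                       ≤⟨ *-monoˡ-≤ (s * s) many ⟩
        # (W ∩ V₁) * (s * s)                              ≤⟨ ∑-if (W ∩ V₁) (λ v → first) ⟩
        #³ t                                              ≡⟨ ∑³-rotate (λ v u u′ → bit (t v u u′)) ⟩
        ∑ V (λ u → ∑ V (λ u′ → # (λ v → t v u u′)))       ∎
        where open ≤-Reasoning

      Result : Set
      Result = ∃ λ l → ∃ λ W′ → Path b x (b ∷ x ∷ l) y c × Split W l W′ × length l ≡ 4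

      joined : ∀ {u u′ v₁ v₂} → Common v₁ u u′ → Common v₂ u u′ → v₂ ≢ v₁ → Result
      joined {u} {u′} {v₁} {v₂} k₁ k₂ v₂≢v₁ =
        -- The path is `b x v₁ u u′ v₂ y c`. The link of `v₁` supplies `x v₁ u` and `v₁ u u′`, that
        -- of `v₂` supplies `u u′ v₂` and `u′ v₂ y`; this is why one link path has to serve two
        -- vertices.
        v₁ ∷ u ∷ u′ ∷ v₂ ∷ [] , _ ,
        proj₁ (good′ k₁) ∷ E-swap₁ (k₁ .vxu) ∷ k₁ .vuu′ ∷ E-rotate (k₂ .vuu′) ∷ E-rotate (E-rotate (k₂ .vyu′)) ∷
          E-rotate (E-rotate (proj₁ (proj₂ (good′ k₂)))) ∷ [] ,
        Split-++ {l = v₁ ∷ u ∷ u′ ∷ []}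
          (remove₃ (k₁ .Wv) (k₁ .Wu) (k₁ .Wu′) (E-≢₁₃ (k₁ .vxu)) (E-≢₁₃ (k₁ .vuu′)) (E-≢₂₃ (k₁ .vuu′))) (remove Wv₂) , refl
        where
        Wv₂ : (W ─ v₁ ─ u ─ u′) v₂ ≡ true
        Wv₂ = ─-intro {W = W ─ v₁ ─ u} (─-intro {W = W ─ v₁} (─-intro {W = W} (k₂ .Wv) v₂≢v₁) (E-≢₁₃ (k₂ .vxu))) (E-≢₁₃ (k₂ .vuu′))

      two : ∀ {u u′} → bit (W u) * bit (W u′) < # (λ v → t v u u′) → Result
      two {u} {u′} many′ = choose (#-∃ {p = λ v → t v u u′} (≤-<-trans z≤n many′))
        where
        choose : (∃ λ v → t v u u′ ≡ true) → Result
        choose (v₁ , e₁) = finish (#-∃ {p = (λ v → t v u u′) ─ v₁} (s≤s⁻¹ (≤-trans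
          (subst (_< # (λ v → t v u u′)) (cong₂ (λ α β → bit α * bit β) (k₁ .Wu) (k₁ .Wu′)) many′) (#-─ _ v₁))))
          where
          k₁ : Common v₁ u u′
          k₁ = t-elim e₁
          finish : (∃ λ v → ((λ v → t v u u′) ─ v₁) v ≡ true) → Result
          finish (v₂ , e₂) = let t₂ , v₂≢v₁ = ─-elim {W = λ v → t v u u′} e₂ in joined k₁ (t-elim t₂) v₂≢v₁

      result : Result
      result = let u , hu = ∑-< V total ; u′ , huu′ = ∑-< V hu in two {u} {u′} huu′

  -- Here `l` lists the new vertices in the order of their removal, while `L` is the list of the
  -- path itself, which contains `a` and `b` but not the final pair.
  Connection : ℕ → (W : Fin n → Bool) → (a b c d : Fin n) → Set
  Connection k W a b c d = ∃ λ l → ∃ λ L → ∃ λ W′ →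
    Path a b L c d × (∀ v → occ v L ≡ occ v (a ∷ b ∷ l)) × Split W l W′ × length l ≡ k

  Path-glue : ∀ {v v′ u : Fin n} {l₁ l₂} → E a b x → E v v′ u → E y c d →
    Path b x (b ∷ x ∷ l₁) v′ u → Path u v (u ∷ v ∷ l₂) y c →
    Path a b (a ∷ b ∷ x ∷ l₁ ++ v′ ∷ u ∷ v ∷ l₂ ++ y ∷ []) c d
  Path-glue abx vv′u ycd p₁ p₂ = abx ∷ (p₁ ⋈ (E-rotate vv′u ∷ (p₂ ⋈ (ycd ∷ []))))

  module _ (K : ℕ) (0<s : 0 < s) {m} (small : m * m < K * (s * s))
           (large : m * (m * (7 + K)) + m * (m * (7 + K)) < s * (s * s)) where

    private
      split-heavy : ∀ {t r a b c d k} → c + d < k → t ≤ r + a + b → a ≤ c → b ≤ d → k ≤ t → 0 < r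
      split-heavy {t} {r} {a} {b} {c} {d} {k} h0 h1 h2 h3 h4 =
        cert 0 (h0 ⊕ h1 ⊕ h2 ⊕ h3 ⊕ h4) (solve (t ∷ r ∷ a ∷ b ∷ c ∷ d ∷ k ∷ []))

      small′ : ∀ j → # W ≤ m → # W * # W < K * ((j + s) * (j + s))
      small′ j le = ≤-<-trans (*-mono-≤ le le) (<-≤-trans small (*-monoʳ-≤ K (*-mono-≤ (m≤n+m s j) (m≤n+m s j))))

      Split-size : ∀ {l} → Split W l W′ → # W ≤ m → # W′ ≤ m
      Split-size s le = ≤-trans (≤-trans (m≤n+m _ _) (≤-reflexive (Split-# s))) le

      room : ∀ {l} {q : Fin n → Bool} → Split W l W′ → 7 + K ≤ # q → length l ≤ 7 →
             (∀ {w} → q w ≡ true → W w ≡ true) → K ≤ # (W′ ∩ q)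
      room {W = W} {W′ = W′} {l = l} {q} sp k le sub =
        arith (≤-trans k (#-mono λ w e → ∧-intro (sub e) e)) (Split-#∩ sp q) le
        where
        arith : ∀ {K a b l} → 7 + K ≤ a → a ≤ b + l → l ≤ 7 → K ≤ b
        arith {K} {a} {b} {l} h0 h1 h2 =
          cert 0 (h0 ⊕ h1 ⊕ h2) (solve (K ∷ a ∷ b ∷ l ∷ []))

    module _ (P : Posa h (7 + s) W ρ) (size : # W ≤ m) {a b c d x y : Fin n}
             (abx : E a b x) (cdy : E c d y) (hb : h ≤ ρ b) (hc : h ≤ ρ c) (hx : h ≤ ρ x) (hy : h ≤ ρ y) where

      private
        A B C : Fin n → Bool
        A = topNbr W ρ h b x
        B = topNbr W ρ h y c
        C = W ∩ atLeast ρ h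
        t : Fin n → Fin n → Fin n → Bool
        t = tri A B C
        heavy : Fin n → Fin n → Fin n → Bool
        heavy v v′ u = t v v′ u ∧ (not (# (λ w → t w v′ u) <ᵇ 7 + K) ∧ not (# (λ w → t v w u) <ᵇ 7 + K))

        #≤ : ∀ q → # (W ∩ q) ≤ m
        #≤ q = ≤-trans (#-mono λ z e → proj₁ (∧-elim {W z} e)) size

        third : ∀ {v v′} → A v ≡ true → B v′ ≡ true → v ≢ v′ → 7 + s ≤ # (C ∩ N v v′)
        third {v} {v′} Av Bv′ v≢v′ =
          let _ , _ , hv = topNbr-elim W ρ h b x Av ; _ , _ , hv′ = topNbr-elim W ρ h y c Bv′ in
          ≤-trans (deg-top P v≢v′ hv hv′) (#-mono λ z e →
            let w , e′ = ∧-elim {W z} e ; g , k = ∧-elim {N v v′ z} e′ in ∧-intro (∧-intro w k) g)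

        many : (7 + s) * ((6 + s) * (7 + s)) ≤ #³ t
        many = #³-tri {A = A} {B} {C} third (deg-top P (E-≢₂₃ abx) hb hx) (deg-top P (≢-sym (E-≢₁₃ cdy)) hy hc)

        heavy-pos : 0 < #³ heavy
        heavy-pos = split-heavy
          (<-≤-trans large (*-mono-≤ (m≤n+m s 7) (*-mono-≤ (m≤n+m s 6) (m≤n+m s 7))))
          (∑³-heavy (7 + K) {A} {B} {C} t λ e → let p , q , r , _ = tri-elim {A = A} {B} {C} e in p , q , r)
          (*-mono-≤ (#≤ _) (*-monoˡ-≤ (7 + K) (#≤ _)))
          (*-mono-≤ (#≤ _) (*-monoˡ-≤ (7 + K) (#≤ _)))
          many

        heavy-room : ∀ {l} {q : Fin n → Bool} → Split W l W′ → not (# q <ᵇ 7 + K) ≡ true → length l ≤ 7 →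
                     (∀ {w} → q w ≡ true → W w ≡ true) → K ≤ # (W′ ∩ q)
        heavy-room sp k = room sp (≮ᵇ⇒≥ k)

      Middle : Set
      Middle = ∃ λ l → ∃ λ r → ∃ λ W′ → Path a b (a ∷ b ∷ x ∷ l ++ y ∷ []) c d ×
               (∀ z → occ z l ≡ occ z r) × Split W r W′ × length r ≡ 11

      private
        -- The edge `v v′ u` splits the task in two: one `link` joins `b x` to `v′ u` through the
        -- alternatives to `v`, the other joins `u v` to `y c` through the alternatives to `v′`. The
        -- threshold `7 + K` leaves `K` alternatives after `v`, `v′`, `u` and the four vertices of
        -- the first link are gone.
        linked : ∀ {v v′ u} → A v ≡ true → B v′ ≡ true → C u ≡ true → E v v′ u →
                 not (# (λ w → t w v′ u) <ᵇ 7 + K) ≡ true → not (# (λ w → t v w u) <ᵇ 7 + K) ≡ true → Middle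
        linked {v} {v′} {u} Av Bv′ Cu vv′u d₁ d₂ = second (link (Posa-split {s = 4 + s} r₃ 3 ≤-refl P) (s≤s z≤n) K q₁
            (small′ 4 (Split-size r₃ size)) hx hv′ (λ {w} e → good₁ w (proj₂ (∧-elim {W₃ w} e)))
            (heavy-room r₃ d₁ (m≤n+m 3 4) (λ {w} e → proj₁ (A-elim (proj₁ (tri-elim {A = A} {B} {C} e))))))
          where
          W₃ q₁ q₂ : Fin n → Bool
          W₃ = W ─ v ─ v′ ─ u
          q₁ w = t w v′ u
          q₂ w = t v w u
          A-elim : ∀ {w} → A w ≡ true → W w ≡ true × E b x w × h ≤ ρ w
          A-elim = topNbr-elim W ρ h b x
          B-elim : ∀ {w} → B w ≡ true → W w ≡ true × E y c w × h ≤ ρ w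
          B-elim = topNbr-elim W ρ h y c
          hv : h ≤ ρ v
          hv = proj₂ (proj₂ (A-elim Av))
          hv′ : h ≤ ρ v′
          hv′ = proj₂ (proj₂ (B-elim Bv′))
          r₃ : Split W (v ∷ v′ ∷ u ∷ []) W₃
          r₃ = remove₃ {W = W} (proj₁ (A-elim Av)) (proj₁ (B-elim Bv′)) (proj₁ (∧-elim {W u} Cu))
                       (E-≢₁₂ vv′u) (E-≢₁₃ vv′u) (E-≢₂₃ vv′u)
          good₁ : ∀ w → q₁ w ≡ true → E b x w × E v′ u w × h ≤ ρ w
          good₁ w e = let Aw , _ , _ , k = tri-elim {A = A} {B} {C} e ; _ , bxw , hw = A-elim Aw in bxw , E-rotate k , hw
          good₂ : ∀ w → q₂ w ≡ true → E u v w × E y c w × h ≤ ρ w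
          good₂ w e = let _ , Bw , _ , k = tri-elim {A = A} {B} {C} e ; _ , ycw , hw = B-elim Bw in
                      E-rotate (E-rotate k) , ycw , hw
          third′ : ∀ {l₁ W₄} → Path b x (b ∷ x ∷ l₁) v′ u → Split W (v ∷ v′ ∷ u ∷ l₁) W₄ → length l₁ ≡ 4 →
                   (∃ λ l₂ → ∃ λ W₅ → Path u v (u ∷ v ∷ l₂) y c × Split W₄ l₂ W₅ × length l₂ ≡ 4) → Middle
          third′ {l₁} p₁ r₄ n₁ (l₂ , W₅ , p₂ , r₅ , n₂) =
            l₁ ++ v′ ∷ u ∷ v ∷ l₂ , (v ∷ v′ ∷ u ∷ l₁) ++ l₂ , W₅ ,
            subst (λ l → Path a b (a ∷ b ∷ x ∷ l) c d) (sym (++-assoc l₁ _ _)) (Path-glue abx vv′u (E-rotate (E-rotate cdy)) p₁ p₂) ,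
            (λ z → begin
              occ z (l₁ ++ v′ ∷ u ∷ v ∷ l₂)                             ≡⟨ ∑-++ l₁ _ (δ z) ⟩
              occ z l₁ + (δ z v′ + (δ z u + (δ z v + occ z l₂)))        ≡⟨ shuffle (occ z l₁) (δ z v′) (δ z u) (δ z v) (occ z l₂) ⟩
              δ z v + (δ z v′ + (δ z u + occ z l₁)) + occ z l₂          ≡⟨ ∑-++ (v ∷ v′ ∷ u ∷ l₁) l₂ (δ z) ⟨
              occ z ((v ∷ v′ ∷ u ∷ l₁) ++ l₂)                           ∎) ,
            Split-++ r₄ r₅ ,
            trans (length-++ (v ∷ v′ ∷ u ∷ l₁)) (cong₂ (λ p q → 3 + p + q) n₁ n₂)
            where
            open ≡-Reasoning
            shuffle : ∀ p q r s t → p + (q + (r + (s + t))) ≡ s + (q + (r + p)) + t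
            shuffle = solve-∀
          second : (∃ λ l → ∃ λ W′ → Path b x (b ∷ x ∷ l) v′ u × Split W₃ l W′ × length l ≡ 4) → Middle
          second (l₁ , W₄ , p₁ , r , n₁) = third′ p₁ r₄ n₁
            (link (Posa-split {s = s} r₄ 7 (≤-reflexive len) P) 0<s K q₂ (small′ 0 (Split-size r₄ size)) hv hy
              (λ {w} e → good₂ w (proj₂ (∧-elim {W₄ w} e)))
              (heavy-room r₄ d₂ (≤-reflexive len) (λ {w} e → proj₁ (B-elim (proj₁ (proj₂ (tri-elim {A = A} {B} {C} e)))))))
            where
            r₄ : Split W (v ∷ v′ ∷ u ∷ l₁) W₄
            r₄ = Split-++ r₃ r
            len : 3 + length l₁ ≡ 7
            len = cong (3 +_) n₁

        found : (∃ λ v → ∃ λ v′ → ∃ λ u → 0 < bit (heavy v v′ u)) → Middle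
        found (v , v′ , u , e) =
          let e₁ , e₂ = ∧-elim {t v v′ u} (bit-true e)
              Av , Bv′ , Cu , vv′u = tri-elim {A = A} {B} {C} e₁
              d₁ , d₂ = ∧-elim e₂
          in linked Av Bv′ Cu vv′u d₁ d₂

      middle : Middle
      middle = found (∑³-∃ heavy-pos)

    -- The nine units of slack pay for `x`, `y` and the seven vertices removed before the second
    -- link. The length 13 consists of `x`, `y`, a triple, and two links of four vertices.
    connect-top : Posa h (9 + s) W ρ → # W ≤ m → a ≢ b → h ≤ ρ a → h ≤ ρ b → c ≢ d → h ≤ ρ c → h ≤ ρ d →
                  Connection 13 W a b c d
    connect-top {h} {W} {ρ} {a} {b} {c} {d} P size a≢b ha hb c≢d hc hd =
      at-x (pick-high W (≤-trans (s≤s z≤n) (deg-top P a≢b ha hb)))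
      where
      at-y : ∀ {x} → W x ≡ true → E a b x → h ≤ ρ x → (∃ λ y → (W ─ x) y ≡ true × E c d y × h ≤ ρ y) → Connection 13 W a b c d
      at-y {x} Wx abx hx (y , Wy , cdy , hy) = finish (middle (Posa-split {s = 7 + s} r₂ 2 ≤-refl P) (Split-size r₂ size) abx cdy hb hc hx hy)
        where
        r₂ : Split W (x ∷ y ∷ []) (W ─ x ─ y)
        r₂ = Split-++ {l = x ∷ []} (remove Wx) (remove {W = W ─ x} Wy)
        finish : Middle (Posa-split {s = 7 + s} r₂ 2 ≤-refl P) (Split-size r₂ size) abx cdy hb hc hx hy → Connection 13 W a b c d
        finish (l , r , W′ , p , o , sp , n′) = x ∷ y ∷ r , a ∷ b ∷ x ∷ l ++ y ∷ [] , W′ , p ,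
          (λ z → cong (λ t → δ z a + (δ z b + (δ z x + t)))
            (trans (∑-++ l _ (δ z)) (trans (cong₂ _+_ (o z) (+-identityʳ _)) (+-comm (occ z r) _)))) ,
          Split-++ r₂ sp , cong (2 +_) n′
      at-x : (∃ λ x → W x ≡ true × E a b x × h ≤ ρ x) → Connection 13 W a b c d
      at-x (x , Wx , abx , hx) = at-y Wx abx hx
        (pick-high (W ─ x) (≤-trans (s≤s z≤n) (deg-top (Posa-split {s = 8 + s} (remove Wx) 1 ≤-refl P) c≢d hc hd)))

    connect : ∀ k → Posa h (k + k + (k + k + (9 + s))) W ρ → # W ≤ m → h ≤ k * s → a ≢ b → c ≢ d →
              Connection (k + k + (k + k + 13)) W a b c d
    connect {h} {W} {ρ} {a} {b} {c} {d} k P size reach a≢b c≢d =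
      from-cd (climb k s 0 (weaken P) c≢d z≤n z≤n z≤n reach)
      where
      weaken : ∀ {W} → Posa h (k + k + (k + k + (9 + s))) W ρ → Posa h (k + k + s) W ρ
      weaken {W} P = Posa-weaken (k + k + 9) (subst (λ t → Posa h t W ρ) (swap (k + k) s) P)
        where
        swap : ∀ p s → p + (p + (9 + s)) ≡ p + 9 + (p + s)
        swap = solve-∀
      weaken′ : ∀ {W} → Posa h (k + k + (9 + s)) W ρ → Posa h (k + k + s) W ρ
      weaken′ {W} P = Posa-weaken 9 (subst (λ t → Posa h t W ρ) (swap (k + k) s) P)
        where
        swap : ∀ p s → p + (9 + s) ≡ 9 + (p + s)
        swap = solve-∀
      from-cd : Climb k h W ρ c d → Connection (k + k + (k + k + 13)) W a b c d
      from-cd (climbed {u₂} {v₂} {new₂} {W₂} p₂ d₂ r₂ n₂ top₂ top₂′) =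
        from-ba (climb k s 0 (weaken′ P₂) (≢-sym a≢b) z≤n z≤n z≤n reach)
        where
        P₂ : Posa h (k + k + (9 + s)) W₂ ρ
        P₂ = Posa-split r₂ (k + k) (≤-reflexive n₂) P
        from-ba : Climb k h W₂ ρ b a → Connection (k + k + (k + k + 13)) W a b c d
        from-ba (climbed {u₁} {v₁} {new₁} {W₁} p₁ d₁ r₁ n₁ top₁ top₁′) =
          join (Path-reverse p₁) (connect-top (Posa-split r₁ (k + k) (≤-reflexive n₁) P₂) (Split-size r₁ (Split-size r₂ size))
                                              (≢-sym d₁) top₁′ top₁ d₂ top₂ top₂′)
          where
          join : (∃ λ l′ → Path a b l′ v₁ u₁ × (∀ v → occ v (v₁ ∷ u₁ ∷ l′) ≡ occ v (a ∷ b ∷ new₁))) →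
                 Connection 13 W₁ v₁ u₁ u₂ v₂ → Connection (k + k + (k + k + 13)) W a b c d
          join (l′ , q , o) (l , L , W₀ , p , o′ , r , n₀) =
            new₂ ++ new₁ ++ l , l′ ++ L ++ new₂ , W₀ , q ⋈ (p ⋈ p₂) , occurrences ,
            Split-++ r₂ (Split-++ r₁ r) ,
            trans (length-++ new₂) (cong₂ _+_ n₂ (trans (length-++ new₁) (cong₂ _+_ n₁ n₀)))
            where
            open ≡-Reasoning
            occurrences : ∀ v → occ v (l′ ++ L ++ new₂) ≡ occ v (a ∷ b ∷ new₂ ++ new₁ ++ l)
            occurrences v = begin
              occ v (l′ ++ L ++ new₂)                          ≡⟨ trans (∑-++ l′ _ (δ v)) (cong (occ v l′ +_) (∑-++ L _ (δ v))) ⟩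
              occ v l′ + (occ v L + occ v new₂)                ≡⟨ cong (λ t → occ v l′ + (t + occ v new₂)) (o′ v) ⟩
              occ v l′ + (δ v v₁ + (δ v u₁ + occ v l) + occ v new₂)
                ≡⟨ e₁ (occ v l′) (δ v v₁) (δ v u₁) (occ v l) (occ v new₂) ⟩
              δ v v₁ + (δ v u₁ + occ v l′) + (occ v new₂ + occ v l) ≡⟨ cong (_+ (occ v new₂ + occ v l)) (o v) ⟩
              δ v a + (δ v b + occ v new₁) + (occ v new₂ + occ v l)
                ≡⟨ e₂ (δ v a) (δ v b) (occ v new₁) (occ v new₂) (occ v l) ⟩
              δ v a + (δ v b + (occ v new₂ + (occ v new₁ + occ v l)))
                ≡⟨ cong (λ t → δ v a + (δ v b + t)) (trans (cong (occ v new₂ +_) (sym (∑-++ new₁ l (δ v)))) (sym (∑-++ new₂ _ (δ v)))) ⟩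
              occ v (a ∷ b ∷ new₂ ++ new₁ ++ l) ∎
              where
              e₁ : ∀ x a b l m → x + (a + (b + l) + m) ≡ a + (b + x) + (m + l)
              e₁ = solve-∀
              e₂ : ∀ a b x m l → a + (b + x) + (m + l) ≡ a + (b + (m + (x + l)))
              e₂ = solve-∀

-- Order statistics of a weight function on a set.

module Quantile where
  open Prelude
  open Certificates
  open Counting
  open import Data.Fin using (Fin)
  open import Data.List using (downFrom)

  ∑< : ℕ → (ℕ → ℕ) → ℕ
  ∑< k = ∑ (downFrom k)

  ∑<-+ : ∀ a b f → ∑< (b + a) f ≡ ∑< a f + ∑< b (λ i → f (i + a))
  ∑<-+ a zero    f = sym (+-identityʳ _)
  ∑<-+ a (suc b) f = trans (cong (f (b + a) +_) (∑<-+ a b f)) (swap (f (b + a)) (∑< a f) _)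
    where
    swap : ∀ p q r → p + (q + r) ≡ q + (p + r)
    swap = solve-∀

  ∑<-sucˡ : ∀ k f → ∑< (suc k) f ≡ ∑< k (f ∘ suc) + f 0
  ∑<-sucˡ zero    f = +-identityʳ _
  ∑<-sucˡ (suc k) f = trans (cong (f (suc k) +_) (∑<-sucˡ k f)) (sym (+-assoc (f (suc k)) _ _))

  ∑<-reverse : ∀ k f → ∑< k f ≡ ∑< k (λ i → f (k ∸ suc i))
  ∑<-reverse zero    f = refl
  ∑<-reverse (suc k) f = begin
    f k + ∑< k f                                      ≡⟨ cong (f k +_) (∑<-reverse k f) ⟩
    f k + ∑< k (λ i → f (k ∸ suc i))                  ≡⟨ +-comm (f k) _ ⟩
    ∑< k (λ i → f (k ∸ suc i)) + f k                  ≡⟨ ∑<-sucˡ k (λ i → f (suc k ∸ suc i)) ⟨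
    ∑< (suc k) (λ i → f (suc k ∸ suc i))              ∎
    where open ≡-Reasoning

  ∑<-min : ∀ k f → ∃ λ i → i < suc k × suc k * f i ≤ ∑< (suc k) f
  ∑<-min zero    f = 0 , ≤-refl , ≤-refl
  ∑<-min (suc k) f with ∑<-min k f
  ... | i , i≤k , le with ≤-total (f i) (f (suc k))
  ... | inj₁ fi≤ = i , m<n⇒m<1+n i≤k , fi≤ ⊕ le
  ... | inj₂ ≤fi = suc k , ≤-refl , +-monoʳ-≤ (f (suc k)) (≤-trans (*-monoʳ-≤ (suc k) ≤fi) le)

  ∑<-gaps : ∀ c k → ∑< k (λ i → bit (c <ᵇ suc i)) ≤ k ∸ c
  ∑<-gaps c zero    = ≤-reflexive (sym (0∸n≡0 c))
  ∑<-gaps c (suc k) with c <ᵇ suc k in e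
  ... | true  = ≤-trans (s≤s (∑<-gaps c k)) (≤-reflexive (sym (+-∸-assoc 1 (s≤s⁻¹ (<ᵇ-true {c} {suc k} e)))))
  ... | false = ≤-trans (∑<-gaps c k) (∸-monoˡ-≤ c (n≤1+n k))

  ∑<-below : ∀ c k → ∑< k (λ i → bit (i <ᵇ c)) ≤ c
  ∑<-below c k = ≤-trans (go k) (m⊓n≤n k c)
    where
    go : ∀ k → ∑< k (λ i → bit (i <ᵇ c)) ≤ k ⊓ c
    go zero = z≤n
    go (suc k) with k <ᵇ c in e
    ... | true  = ≤-trans (s≤s (go k)) (≤-trans (s≤s (m⊓n≤m k c)) (≤-reflexive (sym (m≤n⇒m⊓n≡m (<ᵇ-true e)))))
    ... | false = ≤-trans (go k) (⊓-monoˡ-≤ c (n≤1+n k))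

  halve : ∀ d → ∃ λ k → d ≤ suc (k + k) × k + k ≤ d
  halve zero = 0 , z≤n , z≤n
  halve (suc zero) = 0 , ≤-refl , z≤n
  halve (suc (suc d)) = let k , p , q = halve d in
    suc k , s≤s (s≤s (subst (d ≤_) (sym (+-suc k k)) p)) , s≤s (subst (_≤ suc d) (sym (+-suc k k)) (s≤s q))

  module Quantiles {n : ℕ} (W : Fin n → Bool) (w : Fin n → ℕ) where

    F : ℕ → ℕ
    F θ = # (W ∩ λ x → not (θ <ᵇ w x))

    private
      T : ℕ
      T = ∑ V w

    -- The j-th smallest weight in W: the number of θ with fewer than j weights ≤ θ.
    quantile : ℕ → ℕ
    quantile j = ∑< T (λ θ → bit (F θ <ᵇ j))

    F-mono : ∀ {θ θ′} → θ ≤ θ′ → F θ ≤ F θ′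
    F-mono {θ} {θ′} le = #-mono λ x e → let a , b = ∧-elim {W x} e in ∧-intro a (≮ᵇ-intro {θ′} {w x} (≤-trans (≮ᵇ⇒≥ {θ} {w x} b) le))

    F-top : F T ≡ # W
    F-top = ≤-antisym (#-mono λ x e → proj₁ (∧-elim {W x} e))
      (#-mono λ x e → ∧-intro e (≮ᵇ-intro (∑-∈ w (∈-V x))))

    -- Otherwise monotonicity keeps `F` below `j` at every threshold up to and including
    -- `quantile j`. These are `quantile j + 1` thresholds, one more than `quantile j` counts.
    F-quantile : ∀ {j} → j ≤ # W → j ≤ F (quantile j)
    F-quantile {j} j≤ with j ≤? F (quantile j)
    ... | yes p = p
    ... | no ¬p = contradiction (too-many T (≰⇒> T≰)) (<⇒≱ (n<1+n _))
      where
      Fq<j : F (quantile j) < j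
      Fq<j = ≰⇒> ¬p
      T≰ : ¬ (T ≤ quantile j)
      T≰ le = ¬p (≤-trans (≤-trans j≤ (≤-reflexive (sym F-top))) (F-mono le))
      all : ∀ k → k ≤ suc (quantile j) → k ≤ ∑< k (λ θ → bit (F θ <ᵇ j))
      all zero    _ = z≤n
      all (suc k) h = subst (λ b → suc k ≤ bit b + ∑< k (λ θ → bit (F θ <ᵇ j)))
        (sym (<ᵇ-intro (≤-<-trans (F-mono (s≤s⁻¹ h)) Fq<j))) (s≤s (all k (≤-trans (n≤1+n k) h)))
      too-many : ∀ k → suc (quantile j) ≤ k → suc (quantile j) ≤ ∑< k (λ θ → bit (F θ <ᵇ j))
      too-many k le with k ∸ suc (quantile j) | m∸n+n≡m le
      ... | o | refl = ≤-trans (all (suc (quantile j)) ≤-refl)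
        (≤-trans (m≤m+n _ _) (≤-reflexive (sym (∑<-+ (suc (quantile j)) o _))))

    quantile-mono : ∀ {i j} → i ≤ j → quantile i ≤ quantile j
    quantile-mono {i} {j} le = ∑-mono (downFrom T) λ θ → bit-mono λ e → <ᵇ-intro (<-≤-trans (<ᵇ-true {F θ} e) le)

    -- Both sides are sums over thresholds `θ`: at each of them, the indices `i` with `F θ < i + 1`
    -- number at most `# W ∸ F θ`, and so many members of `W` weigh more than `θ`.
    ∑-quantile : ∑< (# W) (λ i → quantile (suc i)) ≤ ∑ V (λ x → bit (W x) * w x)
    ∑-quantile = begin
      ∑< (# W) (λ i → ∑< T (λ θ → bit (F θ <ᵇ suc i)))   ≡⟨ ∑-swap (downFrom (# W)) (downFrom T) _ ⟩
      ∑< T (λ θ → ∑< (# W) (λ i → bit (F θ <ᵇ suc i)))   ≤⟨ ∑-mono (downFrom T) (λ θ → ≤-trans (∑<-gaps (F θ) (# W)) (above θ)) ⟩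
      ∑< T (λ θ → # (W ∩ λ x → θ <ᵇ w x))                ≡⟨ ∑-swap (downFrom T) V _ ⟩
      ∑ V (λ x → ∑< T (λ θ → bit (W x ∧ (θ <ᵇ w x))))    ≤⟨ ∑-mono V (λ x → pointwise x) ⟩
      ∑ V (λ x → bit (W x) * w x)                        ∎
      where
      open ≤-Reasoning
      above : ∀ θ → # W ∸ F θ ≤ # (W ∩ λ x → θ <ᵇ w x)
      above θ = m≤n+o⇒m∸n≤o (# W) (F θ) (≤-trans (≤-trans (#-mono λ x e → ∧-intro e refl) (#-split W (λ _ → true) (λ x → θ <ᵇ w x)))
        (≤-reflexive refl))
      pointwise : ∀ x → ∑< T (λ θ → bit (W x ∧ (θ <ᵇ w x))) ≤ bit (W x) * w x
      pointwise x with W x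
      ... | true  = ≤-trans (∑<-below (w x) T) (≤-reflexive (sym (+-identityʳ (w x))))
      ... | false = ≤-reflexive (trans (∑-const (downFrom T) 0) (*-zeroʳ (length (downFrom T))))

    -- The indices `i + σ` with `i ≤ k` and the `k + 1` indices after them, read backwards, are
    -- disjoint. So the `k + 1` paired sums total at most the weight of `W`, and the least of them
    -- is at most their average. The shift by `σ` later leaves enough light vertices once those at
    -- low positions are dropped.
    quantile-pair : ∀ k σ → suc k + (suc k + σ) ≤ # W → ∃ λ t → ∃ λ r → t + suc r ≡ suc k ×
      suc k * (quantile (suc (t + σ)) + quantile (suc (r + (suc k + σ)))) ≤ ∑ V (λ x → bit (W x) * w x)
    quantile-pair k σ le = conclude (∑<-min k (λ i → g (i + σ) + g ((suc k ∸ suc i) + (suc k + σ))))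
      where
      g : ℕ → ℕ
      g i = quantile (suc i)
      paired : ∑< (suc k) (λ i → g (i + σ) + g ((suc k ∸ suc i) + (suc k + σ))) ≤ ∑ V (λ x → bit (W x) * w x)
      paired = begin
        ∑< (suc k) (λ i → g (i + σ) + g ((suc k ∸ suc i) + (suc k + σ)))
          ≡⟨ ∑-+ (downFrom (suc k)) (λ i → g (i + σ)) (λ i → g ((suc k ∸ suc i) + (suc k + σ))) ⟩
        ∑< (suc k) (λ i → g (i + σ)) + ∑< (suc k) (λ i → g ((suc k ∸ suc i) + (suc k + σ)))
          ≡⟨ cong (∑< (suc k) (λ i → g (i + σ)) +_) (∑<-reverse (suc k) (λ i → g (i + (suc k + σ)))) ⟨
        ∑< (suc k) (λ i → g (i + σ)) + ∑< (suc k) (λ i → g (i + (suc k + σ)))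
          ≤⟨ +-monoˡ-≤ _ (m≤n+m _ (∑< σ g)) ⟩
        ∑< σ g + ∑< (suc k) (λ i → g (i + σ)) + ∑< (suc k) (λ i → g (i + (suc k + σ)))
          ≡⟨ cong (_+ ∑< (suc k) (λ i → g (i + (suc k + σ)))) (∑<-+ σ (suc k) g) ⟨
        ∑< (suc k + σ) g + ∑< (suc k) (λ i → g (i + (suc k + σ)))
          ≡⟨ ∑<-+ (suc k + σ) (suc k) g ⟨
        ∑< (suc k + (suc k + σ)) g
          ≤⟨ m≤m+n _ _ ⟩
        ∑< (suc k + (suc k + σ)) g + ∑< (# W ∸ (suc k + (suc k + σ))) (λ i → g (i + (suc k + (suc k + σ))))
          ≡⟨ ∑<-+ (suc k + (suc k + σ)) (# W ∸ (suc k + (suc k + σ))) g ⟨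
        ∑< (# W ∸ (suc k + (suc k + σ)) + (suc k + (suc k + σ))) g
          ≡⟨ cong (λ j → ∑< j g) (m∸n+n≡m le) ⟩
        ∑< (# W) g
          ≤⟨ ∑-quantile ⟩
        ∑ V (λ x → bit (W x) * w x) ∎
        where open ≤-Reasoning
      conclude : (∃ λ i → i < suc k × suc k * (g (i + σ) + g ((suc k ∸ suc i) + (suc k + σ))) ≤
                   ∑< (suc k) (λ i → g (i + σ) + g ((suc k ∸ suc i) + (suc k + σ)))) → _
      conclude (t , t≤k , p) = t , k ∸ t , trans (+-suc t _) (cong suc (m+[n∸m]≡n (s≤s⁻¹ t≤k))) , ≤-trans p paired

-- Tight paths of small average weight.

module LightPaths {n : ℕ} (H : 3Graph n) where
  open Prelude
  open Certificates
  open Counting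
  open Triples
  open Quantile
  open Paths H
  open Connecting H
  open import Data.Bool.Properties using (not-involutive)
  open import Data.Fin using (Fin)

  private variable
    a b c d x y z : Fin n
    ρ : Fin n → ℕ
    h s : ℕ

  bit-cover : ∀ t r l → bit (t ∧ l) ≤ bit ((t ∧ r) ∧ l) + bit (t ∧ not r)
  bit-cover true  true  true  = ≤-refl
  bit-cover true  false true  = ≤-refl
  bit-cover true  r     false = z≤n
  bit-cover false r     l     = z≤n

  periodic : ∀ {A : Set} → A → A → ℕ → A
  periodic a b 0 = a
  periodic a b 1 = a
  periodic a b 2 = b
  periodic a b (suc (suc (suc i))) = periodic a b i

  record Sides : Set where
    field
      A B W : Fin n → Bool
      M     : ℕ
      w     : Fin n → ℕ
      α β   : ℕ
      A⊆W   : ∀ {x} → A x ≡ true → W x ≡ true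
      B⊆W   : ∀ {x} → B x ≡ true → W x ≡ true
      wA    : ∀ {x} → A x ≡ true → w x ≤ α
      wB    : ∀ {x} → B x ≡ true → w x ≤ β

  -- Tight paths growing at the front whose entries lie in A , A , B , A , A , B , …
  module Alternating (sides : Sides) where
    open Sides sides

    side : ℕ → Fin n → Bool
    side = periodic A B

    T : ℕ → Fin n → Fin n → Fin n → Bool
    T i = tri (side (2 + i)) (side (1 + i)) (side i)

    -- R k i x y: the path with front x , y can be extended k times with at least M choices in each step.
    R : ℕ → ℕ → Fin n → Fin n → Bool
    R zero    i x y = true
    R (suc k) i x y = not (# (λ z → T i z x y ∧ R k (suc i) z x) <ᵇ M)

    T-rotate : ∀ i {z x y} → T i z x y ≡ true → T (suc i) y z x ≡ true
    T-rotate i {z} {x} {y} e =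
      let p , q , r , zxy = tri-elim {A = side (2 + i)} {side (1 + i)} {side i} e in
      tri-intro {A = side (3 + i)} {side (2 + i)} {side (1 + i)} r p q (E-rotate (E-rotate zxy))

    side⊆W : ∀ i {x} → side i x ≡ true → W x ≡ true
    side⊆W 0 = A⊆W
    side⊆W 1 = A⊆W
    side⊆W 2 = B⊆W
    side⊆W (suc (suc (suc i))) = side⊆W i

    -- If `x y` cannot be extended `suc k` times, then for a triple `z x y` there are two cases.
    -- Either `z x` is a dead end for `k`, which induction counts after rotating the triple, or `z`
    -- is one of the fewer than `M` good continuations of `x y`, which `light` counts.
    dead-ends : ∀ k i → ∑³ (λ z x y → bit (T i z x y ∧ not (R k i x y))) ≤ k * (# W * (# W * M))
    dead-ends zero i = ≤-trans (∑³-mono λ z x y → bit-mono λ e → contradiction (proj₂ (∧-elim {T i z x y} e)) λ ())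
      (≤-reflexive (trans (∑-cong V λ _ → trans (∑-cong V λ _ → zeros) zeros) zeros))
      where
      zeros : ∑ (V {n}) (λ _ → 0) ≡ 0
      zeros = trans (∑-const (V {n}) 0) (*-zeroʳ (length (V {n})))
    dead-ends (suc k) i = begin
      ∑³ (λ z x y → bit (T i z x y ∧ not (not (L x y))))
        ≤⟨ ∑³-mono (λ z x y → subst (λ b → bit (T i z x y ∧ b) ≤ first z x y + second z x y) (sym (not-involutive (L x y)))
             (bit-cover (T i z x y) (R k (suc i) z x) (L x y))) ⟩
      ∑³ (λ z x y → first z x y + second z x y)
        ≡⟨ ∑³-+ first second ⟩
      ∑³ first + ∑³ second
        ≤⟨ +-mono-≤ (light {p = W} {W} M (λ z x y → T i z x y ∧ R k (suc i) z x) (λ {z} {x} {y} e →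
             let _ , q , r , _ = tri-elim {A = side (2 + i)} {side (1 + i)} {side i} (proj₁ (∧-elim {T i z x y} e)) in
             side⊆W (1 + i) q , side⊆W i r)) second≤ ⟩
      # W * (# W * M) + k * (# W * (# W * M)) ∎
      where
      open ≤-Reasoning
      L : Fin n → Fin n → Bool
      L x y = # (λ z → T i z x y ∧ R k (suc i) z x) <ᵇ M
      first second : Fin n → Fin n → Fin n → ℕ
      first z x y = bit ((T i z x y ∧ R k (suc i) z x) ∧ L x y)
      second z x y = bit (T i z x y ∧ not (R k (suc i) z x))
      second≤ : ∑³ second ≤ k * (# W * (# W * M))
      second≤ = begin
        ∑³ second                          ≡⟨ trans (∑³-rotate second) (∑³-rotate (λ x y z → second z x y)) ⟩
        ∑³ (λ y z x → second z x y)
          ≤⟨ ∑³-mono (λ y z x → bit-mono λ e → let p , q = ∧-elim {T i z x y} e in ∧-intro (T-rotate i p) q) ⟩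
        ∑³ (λ y z x → bit (T (suc i) y z x ∧ not (R k (suc i) z x)))
          ≤⟨ dead-ends k (suc i) ⟩
        k * (# W * (# W * M)) ∎

    cap : ℕ → ℕ
    cap = periodic α β

    w≤cap : ∀ i {x} → side i x ≡ true → w x ≤ cap i
    w≤cap 0 = wA
    w≤cap 1 = wA
    w≤cap 2 = wB
    w≤cap (suc (suc (suc i))) = w≤cap i

    caps : ℕ → ℕ → ℕ
    caps zero    i = 0
    caps (suc k) i = cap (2 + i) + caps k (suc i)

    Extension : ℕ → ℕ → (Fin n → Bool) → Fin n → Fin n → Set
    Extension k i W′ x y = ∃ λ u → ∃ λ v → ∃ λ l → ∃ λ W″ → Path u v l x y × u ≢ v ×
      Split W′ l W″ × length l ≡ k × ∑ l w ≤ caps k i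

    extend : ∀ k i {used W′ x y} → Split W used W′ → length used + k ≤ M → x ≢ y → R k i x y ≡ true → Extension k i W′ x y
    extend zero    i {W′ = W′} {x} {y} sp len x≢y r = x , y , [] , W′ , [] , x≢y , Split-[] , refl , z≤n
    extend (suc k) i {used} {W′} {x} {y} sp len x≢y r = step (#-∃ {p = W′ ∩ choice} (pos k (≮ᵇ⇒≥ r) sub (Split-#∩ sp choice) len))
      where
      pos : ∀ {M a b c l} k → M ≤ a → a ≤ b → b ≤ c + l → l + suc k ≤ M → 0 < c
      pos {M} {a} {b} {c} {l} k h0 h1 h2 h3 =
        cert k (h0 ⊕ h1 ⊕ h2 ⊕ h3) (solve (M ∷ a ∷ b ∷ c ∷ l ∷ k ∷ []))
      choice : Fin n → Bool
      choice z = T i z x y ∧ R k (suc i) z x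
      sub : # choice ≤ # (W ∩ choice)
      sub = #-mono λ z e → ∧-intro (side⊆W (2 + i) (proj₁ (tri-elim {A = side (2 + i)} {side (1 + i)} {side i} (proj₁ (∧-elim {T i z x y} e))))) e
      step : (∃ λ z → (W′ ∩ choice) z ≡ true) → Extension (suc k) i W′ x y
      step (z , e) = conclude (∧-elim {W′ z} e)
        where
        conclude : W′ z ≡ true × choice z ≡ true → Extension (suc k) i W′ x y
        conclude (Wz , c) = conclude′ (∧-elim {T i z x y} c)
          where
          conclude′ : T i z x y ≡ true × R k (suc i) z x ≡ true → Extension (suc k) i W′ x y
          conclude′ (t , r′) = prepend (tri-elim {A = side (2 + i)} {side (1 + i)} {side i} t)
            where
            prepend : side (2 + i) z ≡ true × side (1 + i) x ≡ true × side i y ≡ true × E z x y → Extension (suc k) i W′ x y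
            prepend (zs , _ , _ , zxy) =
              let u , v , l , W″ , p , u≢v , sp″ , len′ , weight =
                    extend k (suc i) {used ++ z ∷ []} (Split-++ sp (remove Wz))
                      (≤-trans (≤-reflexive (trans (cong (_+ k) (length-++ used)) (+-assoc (length used) 1 k))) len) (E-≢₁₂ zxy) r′
              in u , v , l ++ z ∷ [] , W″ , p ⋈ (zxy ∷ []) , u≢v ,
                 Split-++ʳ (remove Wz) sp″ , trans (length-++ l) (trans (cong (_+ 1) len′) (+-comm k 1)) ,
                 ≤-trans (≤-reflexive (∑-++ l (z ∷ []) w)) (≤-trans (+-mono-≤ weight (≤-trans (≤-reflexive (+-identityʳ (w z))) (w≤cap (2 + i) zs)))
                   (≤-reflexive (+-comm (caps k (suc i)) _)))

    caps-period : ∀ k i → caps k (3 + i) ≡ caps k i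
    caps-period zero    i = refl
    caps-period (suc k) i = cong (cap (2 + i) +_) (caps-period k (suc i))

    -- The initial pair and the `3 τ + 1` vertices put before it make `τ + 1` complete periods.
    caps-total : ∀ τ → α + α + caps (τ * 3 + 1) 0 ≡ suc τ * (α + α + β)
    caps-total zero    = trans (cong (α + α +_) (+-identityʳ β)) (sym (+-identityʳ _))
    caps-total (suc τ) = trans (cong (λ t → α + α + (β + (α + (α + t)))) (caps-period (τ * 3 + 1) 0))
      (trans (move α β (caps (τ * 3 + 1) 0)) (cong (α + α + β +_) (caps-total τ)))
      where
      move : ∀ α β c → α + α + (β + (α + (α + c))) ≡ α + α + β + (α + α + c)
      move = solve-∀

    Alternation : ℕ → Set
    Alternation k = ∃ λ u → ∃ λ v → ∃ λ l → ∃ λ a → ∃ λ b → ∃ λ W″ → Path u v l a b × u ≢ v × a ≢ b ×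
      Split W (a ∷ b ∷ l) W″ × length l ≡ k × ∑ (a ∷ b ∷ l) w ≤ α + α + caps k 0

    alternation : ∀ k → 2 + k ≤ M → k * (# W * (# W * M)) < #³ (T 0) → Alternation k
    alternation k k≤M many = start (∑³-∃ {f = λ z x y → bit (T 0 z x y ∧ R k 0 x y)} (pos many
      (≤-trans (∑³-mono λ z x y → cover (T 0 z x y) (R k 0 x y)) (≤-reflexive (∑³-+ _ _))) (dead-ends k 0)))
      where
      pos : ∀ {x t g b} → x < t → t ≤ g + b → b ≤ x → 0 < g
      pos {x} {t} {g} {b} h0 h1 h2 =
        cert 0 (h0 ⊕ h1 ⊕ h2) (solve (x ∷ t ∷ g ∷ b ∷ []))
      cover : ∀ t r → bit t ≤ bit (t ∧ r) + bit (t ∧ not r)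
      cover true  true  = ≤-refl
      cover true  false = ≤-refl
      cover false r     = z≤n
      start : (∃ λ z → ∃ λ x → ∃ λ y → 0 < bit (T 0 z x y ∧ R k 0 x y)) → Alternation k
      start (z , x , y , e) = go (∧-elim {T 0 z x y} (bit-true e))
        where
        go : T 0 z x y ≡ true × R k 0 x y ≡ true → Alternation k
        go (t , r) = go′ (tri-elim {A = B} {A} {A} t)
          where
          go′ : B z ≡ true × A x ≡ true × A y ≡ true × E z x y → Alternation k
          go′ (_ , Ax , Ay , zxy) =
            let sp = Split-++ {l = x ∷ []} (remove (A⊆W Ax)) (remove {W = W ─ x} {x = y} (─-intro {W = W} (A⊆W Ay) (≢-sym (E-≢₂₃ zxy))))
                u , v , l , W″ , p , u≢v , sp″ , len , weight = extend k 0 sp k≤M (E-≢₂₃ zxy) r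
            in u , v , l , x , y , W″ , p , u≢v , E-≢₂₃ zxy , Split-++ sp sp″ , len ,
               ≤-trans (+-mono-≤ (wA Ax) (+-mono-≤ (wA Ay) weight)) (≤-reflexive (sym (+-assoc α α _)))

  -- The inequality compares the average weight on the path with that on `W`. Its last term is an
  -- error that comes from `# W` exceeding `2 (k + 1)` by up to `2 σ + 1` in the pairing of
  -- quantiles.
  LightPath : (W : Fin n → Bool) (w : Fin n → ℕ) (σ τ : ℕ) → Set
  LightPath W w σ τ = ∃ λ u → ∃ λ v → ∃ λ l → ∃ λ a → ∃ λ b → ∃ λ W′ → Path u v l a b × u ≢ v × a ≢ b ×
    Split W (a ∷ b ∷ l) W′ × length l ≡ τ * 3 + 1 ×
    # W * ∑ (a ∷ b ∷ l) w ≤ suc τ * 3 * ∑ V (λ x → bit (W x) * w x) + suc (σ + σ) * ∑ (a ∷ b ∷ l) w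

  private
    t≤h : ∀ {t r k σ h w} → t + suc r ≡ suc k → suc k + (suc k + (suc σ + suc σ)) ≤ w → w ≤ suc (h + h) → t ≤ h
    t≤h {t} {r} {k} {σ} {h} {w} h0 h1 h2 =
      certₘ 1 (4 + 2 * r + 2 * σ) (2 ⊗ (≤-reflexive h0) ⊕ h1 ⊕ h2) (solve (t ∷ r ∷ k ∷ σ ∷ h ∷ w ∷ []))

    α-in : ∀ {t r k σ w} → t + suc r ≡ suc k → suc k + (suc k + (suc σ + suc σ)) ≤ w → suc (t + suc σ) ≤ w
    α-in {t} {r} {k} {σ} {w} h0 h1 =
      certₘ 1 (1 + 2 * r + w) (2 ⊗ (≤-reflexive h0) ⊕ h1) (solve (t ∷ r ∷ k ∷ σ ∷ w ∷ []))

    β-in : ∀ {t r k σ w} → t + suc r ≡ suc k → suc k + (suc k + (suc σ + suc σ)) ≤ w → suc (r + (suc k + suc σ)) ≤ w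
    β-in {t} {r} {k} {σ} {w} h0 h1 =
      cert (1 + t + σ) ((≤-reflexive h0) ⊕ h1) (solve (t ∷ r ∷ k ∷ σ ∷ w ∷ []))

    α≤β-index : ∀ {t r k} σ → t + suc r ≡ suc k → suc (t + σ) ≤ suc (r + (suc k + σ))
    α≤β-index {t} {r} {k} σ h0 =
      cert (1 + 2 * r) ((≤-reflexive h0)) (solve (t ∷ r ∷ k ∷ σ ∷ []))

    A-size : ∀ {t σ f a l} → suc (t + suc σ) ≤ f → f ≤ a + l → l ≤ t → suc σ ≤ a
    A-size {t} {σ} {f} {a} {l} h0 h1 h2 =
      cert 1 (h0 ⊕ h1 ⊕ h2) (solve (t ∷ σ ∷ f ∷ a ∷ l ∷ []))

    third : ∀ {t r k σ d b f w} → t + (suc σ + suc σ) ≤ d → suc (r + (suc k + suc σ)) ≤ f → f + d ≤ b + w → w ≤ suc (suc k + (suc k + (suc σ + suc σ))) → t + suc r ≡ suc k → σ ≤ b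
    third {t} {r} {k} {σ} {d} {b} {f} {w} h0 h1 h2 h3 h4 =
      cert 0 (h0 ⊕ h1 ⊕ h2 ⊕ h3 ⊕ (≤-reflexive (sym h4))) (solve (t ∷ r ∷ k ∷ σ ∷ d ∷ b ∷ f ∷ w ∷ []))

    final₁ : ∀ {w k s p} → w ≤ suc (suc k + (suc k + s)) → w ≤ 2 * suc k + suc s
    final₁ {w} {k} {s} {p} h0 =
      cert 0 h0 (solve (w ∷ k ∷ s ∷ p ∷ []))

    α≤β⇒ : ∀ {a b} → a ≤ b → 2 * (a + a + b) ≤ 3 * (a + b)
    α≤β⇒ {a} {b} h0 =
      cert 0 h0 (solve (a ∷ b ∷ []))

    low-arith : ∀ {k d s w} → k + k ≤ d → d + suc (suc s) ≡ w → suc k + (suc k + s) ≤ w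
    low-arith {k} {d} {s} {w} h0 h1 =
      cert 0 (h0 ⊕ (≤-reflexive h1)) (solve (k ∷ d ∷ s ∷ w ∷ []))

    high-arith : ∀ {k d s w} → d ≤ suc (k + k) → d + suc (suc s) ≡ w → w ≤ suc (suc k + (suc k + s))
    high-arith {k} {d} {s} {w} h0 h1 =
      cert 0 (h0 ⊕ (≤-reflexive (sym h1))) (solve (k ∷ d ∷ s ∷ w ∷ []))

    low′-arith : ∀ {k} s {w} → suc k + (suc k + (s + s)) ≤ w → suc k + (suc k + s) ≤ w
    low′-arith {k} s {w} h0 =
      cert s h0 (solve (k ∷ s ∷ w ∷ []))

  module _ {W : Fin n → Bool} (w : Fin n → ℕ) (σ′ τ : ℕ) (P : Posa h (suc σ′ + suc σ′) W ρ)
           (count : (τ * 3 + 1) * (# W * (# W * (suc τ * 3))) < σ′ * (σ′ * σ′))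
           (room : suc (suc (suc σ′ + suc σ′)) ≤ # W) where

    private
      open Quantiles W w
      σ = suc σ′

      module _ (k t r : ℕ) (t+r : t + suc r ≡ suc k) (low : suc k + (suc k + (σ + σ)) ≤ # W)
               (high : # W ≤ suc (suc k + (suc k + (σ + σ))))
               (cheap : suc k * (quantile (suc (t + σ)) + quantile (suc (r + (suc k + σ)))) ≤ ∑ V (λ x → bit (W x) * w x)) where

        α β : ℕ
        α = quantile (suc (t + σ))
        β = quantile (suc (r + (suc k + σ)))
        A B : Fin n → Bool
        A = W ∩ ((λ x → not (α <ᵇ w x)) ∩ atLeast ρ t)
        B = W ∩ (λ x → not (β <ᵇ w x))

        A-elim : ∀ {x} → A x ≡ true → W x ≡ true × w x ≤ α × t ≤ ρ x
        A-elim {x} e = let p , q = ∧-elim {W x} e ; q₁ , q₂ = ∧-elim {not (α <ᵇ w x)} q in p , ≮ᵇ⇒≥ q₁ , ≮ᵇ⇒≥ q₂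

        A-many : suc σ′ ≤ # A
        A-many = A-size (F-quantile (α-in t+r low)) (#-split W (λ x → not (α <ᵇ w x)) (λ x → ρ x <ᵇ t)) (P .Posa.low t)

        -- The pair has degree at least `t + 2 σ` into `W`, and at least `r + k + σ + 2` vertices of
        -- `W` have weight at most `β`. As `t + r = k` and `# W ≤ 2 k + 2 σ + 3`, the two sets share
        -- at least `σ − 1 = σ′` vertices.
        B-deg : ∀ {x y} → A x ≡ true → A y ≡ true → x ≢ y → σ′ ≤ # (B ∩ N x y)
        B-deg {x} {y} Ax Ay x≢y =
          let _ , _ , tx = A-elim Ax ; _ , _ , ty = A-elim Ay in
          ≤-trans (third (P .deg x≢y t tx ty (t≤h t+r low (P .size))) (F-quantile (β-in t+r low))
                         (#-common W (λ z → not (β <ᵇ w z)) (N x y)) high t+r)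
            (#-mono λ z e → let p , q = ∧-elim {W z} e ; q₁ , q₂ = ∧-elim {not (β <ᵇ w z)} q in ∧-intro (∧-intro p q₁) q₂)

        sides : Sides
        sides = record
          { A = A ; B = B ; W = W ; M = suc τ * 3 ; w = w ; α = α ; β = β
          ; A⊆W = λ e → proj₁ (A-elim e) ; B⊆W = λ {x} e → proj₁ (∧-elim {W x} e)
          ; wA = λ e → proj₁ (proj₂ (A-elim e)) ; wB = λ {x} e → ≮ᵇ⇒≥ (proj₂ (∧-elim {W x} e)) }

        open Alternating sides using (T; alternation; caps-total)

        many : (τ * 3 + 1) * (# W * (# W * (suc τ * 3))) < #³ (T 0)
        many = <-≤-trans count (≤-trans (#³-tri {A = A} {A} {B} B-deg (≤-trans (n≤1+n σ′) A-many) A-many)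
          (≤-trans (∑³-mono λ x y z → bit-mono λ e →
              let p , q , r , xyz = tri-elim {A = A} {A} {B} e in tri-intro {A = B} {A} {A} r p q (E-rotate (E-rotate xyz)))
            (≤-reflexive (sym (∑³-rotate (λ z x y → bit (T 0 z x y)))))))

        lightPath′ : LightPath W w σ τ
        lightPath′ =
          let u , v , l , a , b , W′ , p , u≢v , a≢b , sp , len , weight =
                alternation (τ * 3 + 1) (≤-reflexive (cong (2 +_) (+-comm (τ * 3) 1))) many
          in u , v , l , a , b , W′ , p , u≢v , a≢b , sp , len ,
             bound (≤-trans weight (≤-reflexive (caps-total τ)))
          where
          open ≤-Reasoning
          regroup₁ : ∀ k τ a b → 2 * k * (τ * (a + a + b)) ≡ τ * (k * (2 * (a + a + b)))
          regroup₁ = solve-∀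
          regroup₂ : ∀ k τ c → τ * (k * (3 * c)) ≡ τ * 3 * (k * c)
          regroup₂ = solve-∀
          bound : ∀ {x} → x ≤ suc τ * (α + α + β) → # W * x ≤ suc τ * 3 * ∑ V (λ x → bit (W x) * w x) + suc (σ + σ) * x
          bound {x} x≤ = begin
            # W * x                                              ≤⟨ *-monoˡ-≤ x (final₁ {k = k} {σ + σ} {0} high) ⟩
            (2 * suc k + suc (σ + σ)) * x                        ≡⟨ *-distribʳ-+ x (2 * suc k) _ ⟩
            2 * suc k * x + suc (σ + σ) * x                      ≤⟨ +-monoˡ-≤ _ (*-monoʳ-≤ (2 * suc k) x≤) ⟩
            2 * suc k * (suc τ * (α + α + β)) + suc (σ + σ) * x  ≡⟨ cong (_+ suc (σ + σ) * x) (regroup₁ (suc k) (suc τ) α β) ⟩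
            suc τ * (suc k * (2 * (α + α + β))) + suc (σ + σ) * x
              ≤⟨ +-monoˡ-≤ _ (*-monoʳ-≤ (suc τ) (*-monoʳ-≤ (suc k) (α≤β⇒ (quantile-mono (α≤β-index σ t+r))))) ⟩
            suc τ * (suc k * (3 * (α + β))) + suc (σ + σ) * x    ≡⟨ cong (_+ suc (σ + σ) * x) (regroup₂ (suc k) (suc τ) (α + β)) ⟩
            suc τ * 3 * (suc k * (α + β)) + suc (σ + σ) * x      ≤⟨ +-monoˡ-≤ _ (*-monoʳ-≤ (suc τ * 3) cheap) ⟩
            suc τ * 3 * ∑ V (λ x → bit (W x) * w x) + suc (σ + σ) * x ∎

    lightPath : LightPath W w (suc σ′) τ
    lightPath = go (halve (# W ∸ suc (suc (σ + σ))))
      where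
      go : (∃ λ k → # W ∸ suc (suc (σ + σ)) ≤ suc (k + k) × k + k ≤ # W ∸ suc (suc (σ + σ))) → LightPath W w (suc σ′) τ
      go (k , hi , lo) =
        let low = low-arith {k} lo (m∸n+n≡m room)
            t , r , t+r , cheap = quantile-pair k σ (low′-arith {k} σ low)
        in lightPath′ k t r t+r low (high-arith {k} hi (m∸n+n≡m room)) cheap

-- The multiplicative weights method in integers.

module MultiplicativeWeights where
  open Prelude
  open Certificates
  open Counting

  bernoulli : ∀ k j → (k + j) * k ^ j ≤ suc k ^ j * k
  bernoulli k zero    = ≤-reflexive (trans (*-identityʳ (k + 0)) (trans (+-identityʳ k) (sym (+-identityʳ k))))
  bernoulli k (suc j) = begin
    (k + suc j) * (k * k ^ j)        ≤⟨ drop k j (k ^ j) ⟩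
    suc k * ((k + j) * k ^ j)        ≤⟨ *-monoʳ-≤ (suc k) (bernoulli k j) ⟩
    suc k * (suc k ^ j * k)          ≡⟨ *-assoc (suc k) (suc k ^ j) k ⟨
    suc k * suc k ^ j * k            ∎
    where
    open ≤-Reasoning
    drop : ∀ k j p → (k + suc j) * (k * p) ≤ suc k * ((k + j) * p)
    drop k j p = subst ((k + suc j) * (k * p) ≤_) (eq k j p) (m≤m+n _ (j * p))
      where
      eq : ∀ k j p → (k + suc j) * (k * p) + j * p ≡ suc k * ((k + j) * p)
      eq = solve-∀

  power-upper : ∀ k g → g ≤ k → suc k ^ g * (k * k) ≤ k ^ g * (k * k + g * k + g * g)
  power-upper k zero    _ = ≤-reflexive (expand (k * k))
    where
    expand : ∀ a → 1 * a ≡ 1 * (a + 0 + 0)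
    expand = solve-∀
  power-upper k (suc g) g<k = begin
    suc k * suc k ^ g * (k * k)                     ≡⟨ *-assoc (suc k) (suc k ^ g) (k * k) ⟩
    suc k * (suc k ^ g * (k * k))                   ≤⟨ *-monoʳ-≤ (suc k) (power-upper k g (<⇒≤ g<k)) ⟩
    suc k * (k ^ g * (k * k + g * k + g * g))       ≡⟨ swap (suc k) (k ^ g) _ ⟩
    k ^ g * (suc k * (k * k + g * k + g * g))       ≤⟨ *-monoʳ-≤ (k ^ g) (compare-terms g k (*-monoʳ-≤ g (<⇒≤ g<k))) ⟩
    k ^ g * (k * (k * k + suc g * k + suc g * suc g)) ≡⟨ swap′ (k ^ g) k _ ⟩
    k * k ^ g * (k * k + suc g * k + suc g * suc g) ∎
    where
    open ≤-Reasoning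
    swap : ∀ a b c → a * (b * c) ≡ b * (a * c)
    swap = solve-∀
    swap′ : ∀ a b c → a * (b * c) ≡ b * a * c
    swap′ = solve-∀
    compare-terms : ∀ g k → g * g ≤ g * k → suc k * (k * k + g * k + g * g) ≤ k * (k * k + suc g * k + suc g * suc g)
    compare-terms g k h0 =
      cert k h0 (solve (g ∷ k ∷ []))

  -- For `g * g ≤ k` the quadratic term of `power-upper` is at most `1 / k`. This extra unit beside
  -- `g` is the origin of `suc μ` in the bounds of the method.
  power-linear : ∀ k g .{{_ : NonZero k}} → g * g ≤ k → suc k ^ g * k ≤ k ^ g * (k + suc g)
  power-linear k g gg≤k = *-cancelʳ-≤ _ _ k (begin
    suc k ^ g * k * k                       ≡⟨ *-assoc (suc k ^ g) k k ⟩
    suc k ^ g * (k * k)                     ≤⟨ power-upper k g (≤-trans (square g) gg≤k) ⟩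
    k ^ g * (k * k + g * k + g * g)         ≤⟨ *-monoʳ-≤ (k ^ g) (+-monoʳ-≤ (k * k + g * k) gg≤k) ⟩
    k ^ g * (k * k + g * k + k)             ≡⟨ collect (k ^ g) k g ⟩
    k ^ g * (k + suc g) * k                 ∎)
    where
    open ≤-Reasoning
    square : ∀ g → g ≤ g * g
    square zero    = z≤n
    square (suc g) = m≤m+n (suc g) _
    collect : ∀ p k g → p * (k * k + g * k + k) ≡ p * (k + suc g) * k
    collect = solve-∀

  -- The multiplicative weights method: i carries the weight (1 + 1/k) ^ Y i, scaled by a power of k.
  module Multiplicative {I : Set} (is : List I) (G k μ L : ℕ) .{{_ : NonZero k}} (G*G≤k : G * G ≤ k)
                        (small : length is < 2 ^ L) where

    -- By `scale`, `Φ i` is `(1 + 1/k) ^ Y i` times `k ^ (G * t)`; this power of `k` keeps it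
    -- integral because a round gains at most `G`. By `total`, the unscaled sum has grown at most by
    -- the factor `1 + (μ + 1)/k` per round.
    record Potential (t : ℕ) (Y : I → ℕ) : Set where
      field
        Φ     : I → ℕ
        scale : ∀ i → Φ i * k ^ Y i ≡ suc k ^ Y i * k ^ (G * t)
        total : ∑ is Φ * k ^ t ≤ (k + suc μ) ^ t * (length is * k ^ (G * t))
    open Potential

    initial : Potential 0 (λ _ → 0)
    initial .Φ _ = 1
    initial .scale _ = cong (λ e → 1 * k ^ e) (sym (*-zeroʳ G))
    initial .total = ≤-reflexive (trans (cong (_* 1) (∑-const is 1))
      (trans (*-identityʳ _) (trans (cong (λ e → length is * k ^ e) (sym (*-zeroʳ G))) (sym (+-identityʳ _)))))

    advance : ∀ {t Y} (g : I → ℕ) → (∀ i → g i ≤ G) → (pot : Potential t Y) →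
              ∑ is (λ i → pot .Φ i * g i) ≤ μ * ∑ is (pot .Φ) → Potential (suc t) (λ i → Y i + g i)
    advance {t} {Y} g g≤G pot mean = record { Φ = Φ′ ; scale = scale′ ; total = total′ }
      where
      Φ′ : I → ℕ
      Φ′ i = pot .Φ i * (suc k ^ g i * k ^ (G ∸ g i))
      kᴳ : ∀ i → k ^ (G ∸ g i) * k ^ g i ≡ k ^ G
      kᴳ i = trans (sym (^-distribˡ-+-* k (G ∸ g i) (g i))) (cong (k ^_) (m∸n+n≡m (g≤G i)))
      Gt : k ^ (G * suc t) ≡ k ^ G * k ^ (G * t)
      Gt = trans (cong (k ^_) (*-suc G t)) (^-distribˡ-+-* k G (G * t))
      scale′ : ∀ i → Φ′ i * k ^ (Y i + g i) ≡ suc k ^ (Y i + g i) * k ^ (G * suc t)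
      scale′ i = begin
        Φ′ i * k ^ (Y i + g i)
          ≡⟨ cong (Φ′ i *_) (^-distribˡ-+-* k (Y i) (g i)) ⟩
        pot .Φ i * (suc k ^ g i * k ^ (G ∸ g i)) * (k ^ Y i * k ^ g i)
          ≡⟨ move (pot .Φ i) (suc k ^ g i) (k ^ (G ∸ g i)) (k ^ Y i) (k ^ g i) ⟩
        (pot .Φ i * k ^ Y i) * (suc k ^ g i * (k ^ (G ∸ g i) * k ^ g i))
          ≡⟨ cong₂ (λ a b → a * (suc k ^ g i * b)) (pot .scale i) (kᴳ i) ⟩
        suc k ^ Y i * k ^ (G * t) * (suc k ^ g i * k ^ G)
          ≡⟨ move′ (suc k ^ Y i) (k ^ (G * t)) (suc k ^ g i) (k ^ G) ⟩
        suc k ^ Y i * suc k ^ g i * (k ^ G * k ^ (G * t))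
          ≡⟨ cong₂ _*_ (sym (^-distribˡ-+-* (suc k) (Y i) (g i))) (sym Gt) ⟩
        suc k ^ (Y i + g i) * k ^ (G * suc t) ∎
        where
        open ≡-Reasoning
        move : ∀ a b c d e → a * (b * c) * (d * e) ≡ (a * d) * (b * (c * e))
        move = solve-∀
        move′ : ∀ a b c d → a * b * (c * d) ≡ a * c * (d * b)
        move′ = solve-∀
      pointwise : ∀ i → k * Φ′ i ≤ k ^ G * (suc k * pot .Φ i + pot .Φ i * g i)
      pointwise i = begin
        k * (pot .Φ i * (suc k ^ g i * k ^ (G ∸ g i)))
          ≡⟨ move k (pot .Φ i) (suc k ^ g i) (k ^ (G ∸ g i)) ⟩
        pot .Φ i * (k ^ (G ∸ g i) * (suc k ^ g i * k))
          ≤⟨ *-monoʳ-≤ (pot .Φ i) (*-monoʳ-≤ (k ^ (G ∸ g i)) (power-linear k (g i) (≤-trans (*-mono-≤ (g≤G i) (g≤G i)) G*G≤k))) ⟩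
        pot .Φ i * (k ^ (G ∸ g i) * (k ^ g i * (k + suc (g i))))
          ≡⟨ cong (pot .Φ i *_) (trans (sym (*-assoc (k ^ (G ∸ g i)) (k ^ g i) _)) (cong (_* (k + suc (g i))) (kᴳ i))) ⟩
        pot .Φ i * (k ^ G * (k + suc (g i)))
          ≡⟨ move′ (pot .Φ i) (k ^ G) k (g i) ⟩
        k ^ G * (suc k * pot .Φ i + pot .Φ i * g i) ∎
        where
        open ≤-Reasoning
        move : ∀ k a b c → k * (a * (b * c)) ≡ a * (c * (b * k))
        move = solve-∀
        move′ : ∀ a c k g → a * (c * (k + suc g)) ≡ c * (suc k * a + a * g)
        move′ = solve-∀
      ∑Φ = ∑ is (pot .Φ)
      one-step : k * ∑ is Φ′ ≤ k ^ G * ((k + suc μ) * ∑Φ)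
      one-step = begin
        k * ∑ is Φ′                                                        ≡⟨ ∑-* is k Φ′ ⟨
        ∑ is (λ i → k * Φ′ i)                                              ≤⟨ ∑-mono is pointwise ⟩
        ∑ is (λ i → k ^ G * (suc k * pot .Φ i + pot .Φ i * g i))           ≡⟨ ∑-* is (k ^ G) _ ⟩
        k ^ G * ∑ is (λ i → suc k * pot .Φ i + pot .Φ i * g i)             ≡⟨ cong (k ^ G *_) (trans (∑-+ is _ _) (cong (_+ ∑ is (λ i → pot .Φ i * g i)) (∑-* is (suc k) (pot .Φ)))) ⟩
        k ^ G * (suc k * ∑Φ + ∑ is (λ i → pot .Φ i * g i))                 ≤⟨ *-monoʳ-≤ (k ^ G) (+-monoʳ-≤ (suc k * ∑Φ) mean) ⟩
        k ^ G * (suc k * ∑Φ + μ * ∑Φ)                                      ≡⟨ collect (k ^ G) k μ ∑Φ ⟩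
        k ^ G * ((k + suc μ) * ∑Φ)                                         ∎
        where
        open ≤-Reasoning
        collect : ∀ p k m s → p * (suc k * s + m * s) ≡ p * ((k + suc m) * s)
        collect = solve-∀
      total′ : ∑ is Φ′ * k ^ suc t ≤ (k + suc μ) ^ suc t * (length is * k ^ (G * suc t))
      total′ = begin
        ∑ is Φ′ * (k * k ^ t)                              ≡⟨ move (∑ is Φ′) k (k ^ t) ⟩
        k * ∑ is Φ′ * k ^ t                                ≤⟨ *-monoˡ-≤ (k ^ t) one-step ⟩
        k ^ G * ((k + suc μ) * ∑Φ) * k ^ t                 ≡⟨ move′ (k ^ G) (k + suc μ) ∑Φ (k ^ t) ⟩
        k ^ G * (k + suc μ) * (∑Φ * k ^ t)                 ≤⟨ *-monoʳ-≤ (k ^ G * (k + suc μ)) (pot .total) ⟩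
        k ^ G * (k + suc μ) * ((k + suc μ) ^ t * (length is * k ^ (G * t)))
          ≡⟨ move″ (k ^ G) (k + suc μ) ((k + suc μ) ^ t) (length is) (k ^ (G * t)) ⟩
        (k + suc μ) * (k + suc μ) ^ t * (length is * (k ^ G * k ^ (G * t)))
          ≡⟨ cong (λ e → (k + suc μ) ^ suc t * (length is * e)) (sym Gt) ⟩
        (k + suc μ) ^ suc t * (length is * k ^ (G * suc t)) ∎
        where
        open ≤-Reasoning
        move : ∀ a b c → a * (b * c) ≡ b * a * c
        move = solve-∀
        move′ : ∀ a b c d → a * (b * c) * d ≡ a * b * (c * d)
        move′ = solve-∀
        move″ : ∀ a b c d e → a * b * (c * (d * e)) ≡ b * c * (d * (a * e))
        move″ = solve-∀

    private
      ^-*-mono : ∀ {a b c d} t → a * b ≤ c * d → a ^ t * b ^ t ≤ c ^ t * d ^ t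
      ^-*-mono zero    h = ≤-refl
      ^-*-mono {a} {b} {c} {d} (suc t) h = begin
        a * a ^ t * (b * b ^ t)      ≡⟨ [m*n]*[o*p]≡[m*o]*[n*p] a (a ^ t) b (b ^ t) ⟩
        a * b * (a ^ t * b ^ t)      ≤⟨ *-mono-≤ h (^-*-mono t h) ⟩
        c * d * (c ^ t * d ^ t)      ≡⟨ [m*n]*[o*p]≡[m*o]*[n*p] c d (c ^ t) (d ^ t) ⟩
        c * c ^ t * (d * d ^ t)      ∎
        where open ≤-Reasoning

      drift : ∀ t → (k + suc μ) ^ t * k ^ (suc μ * t) ≤ suc k ^ (suc μ * t) * k ^ t
      drift t = subst₂ (λ a b → (k + suc μ) ^ t * a ≤ b * k ^ t) (^-*-assoc k (suc μ) t) (^-*-assoc (suc k) (suc μ) t)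
        (^-*-mono t (bernoulli k (suc μ)))

      doubling : 2 ^ L * k ^ (k * L) ≤ suc k ^ (k * L)
      doubling = subst₂ (λ a b → 2 ^ L * a ≤ b) (^-*-assoc k k L) (^-*-assoc (suc k) k L)
        (subst (2 ^ L * (k ^ k) ^ L ≤_) (trans (cong ((suc k ^ k) ^ L *_) (^-zeroˡ L)) (*-identityʳ _))
          (^-*-mono L (≤-trans (*-cancelʳ-≤ (2 * k ^ k) (suc k ^ k) k (subst (_≤ suc k ^ k * k) (double k (k ^ k)) (bernoulli k k))) (≤-reflexive (sym (*-identityʳ (suc k ^ k)))))))
        where
        double : ∀ k p → (k + k) * p ≡ 2 * p * k
        double = solve-∀

    -- A single potential is at most the sum, so `(1 + 1/k) ^ Y i` is at most the number of indices
    -- times `(1 + (μ + 1)/k) ^ t`. Bernoulli's inequality compares both factors with powers of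
    -- `1 + 1/k`: `drift` treats the rounds, and `doubling` uses that `(1 + 1/k) ^ k` is at least 2.
    bounded : ∀ {t Y} → Potential t Y → ∀ {i} → i ∈ is → Y i < suc μ * t + k * L
    bounded {t} {Y} pot {i} i∈ = ≰⇒> λ big → contradiction (chain big) (<-irrefl refl)
      where
      chain : suc μ * t + k * L ≤ Y i → (k + suc μ) ^ t * length is * k ^ Y i < (k + suc μ) ^ t * length is * k ^ Y i
      chain big = begin-strict
        (k + suc μ) ^ t * length is * k ^ Y i
          <⟨ *-monoˡ-< (k ^ Y i) {{m^n≢0 k (Y i)}} (*-monoʳ-< ((k + suc μ) ^ t) {{m^n≢0 (k + suc μ) t {{>-nonZero (≤-trans (s≤s z≤n) (m≤n+m (suc μ) k))}}}} small) ⟩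
        (k + suc μ) ^ t * 2 ^ L * k ^ Y i
          ≡⟨ cong (λ e → (k + suc μ) ^ t * 2 ^ L * k ^ e) (sym Y≡) ⟩
        (k + suc μ) ^ t * 2 ^ L * k ^ (suc μ * t + k * L + e)
          ≡⟨ cong ((k + suc μ) ^ t * 2 ^ L *_) (split-power k) ⟩
        (k + suc μ) ^ t * 2 ^ L * (k ^ (suc μ * t) * k ^ (k * L) * k ^ e)
          ≡⟨ move ((k + suc μ) ^ t) (2 ^ L) (k ^ (suc μ * t)) (k ^ (k * L)) (k ^ e) ⟩
        (k + suc μ) ^ t * k ^ (suc μ * t) * (2 ^ L * k ^ (k * L)) * k ^ e
          ≤⟨ *-mono-≤ (*-mono-≤ (drift t) doubling) (^-monoˡ-≤ e (n≤1+n k)) ⟩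
        suc k ^ (suc μ * t) * k ^ t * suc k ^ (k * L) * suc k ^ e
          ≡⟨ move′ (suc k ^ (suc μ * t)) (k ^ t) (suc k ^ (k * L)) (suc k ^ e) ⟩
        suc k ^ (suc μ * t) * suc k ^ (k * L) * suc k ^ e * k ^ t
          ≡⟨ cong (_* k ^ t) (sym (split-power (suc k))) ⟩
        suc k ^ (suc μ * t + k * L + e) * k ^ t
          ≡⟨ cong (λ e → suc k ^ e * k ^ t) Y≡ ⟩
        suc k ^ Y i * k ^ t
          ≤⟨ *-cancelʳ-≤ _ _ (k ^ (G * t)) {{m^n≢0 k (G * t)}} cancelled ⟩
        (k + suc μ) ^ t * length is * k ^ Y i ∎
        where
        open ≤-Reasoning
        e = Y i ∸ (suc μ * t + k * L)
        Y≡ : suc μ * t + k * L + e ≡ Y i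
        Y≡ = m+[n∸m]≡n big
        split-power : ∀ b → b ^ (suc μ * t + k * L + e) ≡ b ^ (suc μ * t) * b ^ (k * L) * b ^ e
        split-power b = trans (^-distribˡ-+-* b (suc μ * t + k * L) e) (cong (_* b ^ e) (^-distribˡ-+-* b (suc μ * t) (k * L)))
        move : ∀ a b c d e → a * b * (c * d * e) ≡ a * c * (b * d) * e
        move = solve-∀
        move′ : ∀ a b c d → a * b * c * d ≡ a * c * d * b
        move′ = solve-∀
        cancelled : suc k ^ Y i * k ^ t * k ^ (G * t) ≤ (k + suc μ) ^ t * length is * k ^ Y i * k ^ (G * t)
        cancelled = begin
          suc k ^ Y i * k ^ t * k ^ (G * t)          ≡⟨ swap₁ (suc k ^ Y i) (k ^ t) (k ^ (G * t)) ⟩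
          suc k ^ Y i * k ^ (G * t) * k ^ t          ≡⟨ cong (_* k ^ t) (sym (pot .scale i)) ⟩
          pot .Φ i * k ^ Y i * k ^ t                 ≤⟨ *-monoˡ-≤ (k ^ t) (*-monoˡ-≤ (k ^ Y i) (∑-∈ (pot .Φ) i∈)) ⟩
          ∑ is (pot .Φ) * k ^ Y i * k ^ t            ≡⟨ swap₁ (∑ is (pot .Φ)) (k ^ Y i) (k ^ t) ⟩
          ∑ is (pot .Φ) * k ^ t * k ^ Y i            ≤⟨ *-monoˡ-≤ (k ^ Y i) (pot .total) ⟩
          (k + suc μ) ^ t * (length is * k ^ (G * t)) * k ^ Y i ≡⟨ swap₂ ((k + suc μ) ^ t) (length is) (k ^ (G * t)) (k ^ Y i) ⟩
          (k + suc μ) ^ t * length is * k ^ Y i * k ^ (G * t) ∎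
          where
          swap₁ : ∀ a b c → a * b * c ≡ a * c * b
          swap₁ = solve-∀
          swap₂ : ∀ a b c d → a * (b * c) * d ≡ a * b * d * c
          swap₂ = solve-∀

    -- A move answers arbitrary weights and may use the bounds established so far. A state can
    -- therefore be kept alive by the very estimate that the method produces.
    module _ (State : ℕ → (I → ℕ) → Set) (q : ℕ)
      (move : ∀ t (Y : I → ℕ) → t < q → State t Y → (∀ {i : I} → i ∈ is → Y i < suc μ * t + k * L) → ∀ (ω : I → ℕ) →
              ∃ λ (g : I → ℕ) → (∀ i → g i ≤ G) × ∑ is (λ i → ω i * g i) ≤ μ * ∑ is ω × State (suc t) (λ i → Y i + g i)) where

      Position : ℕ → Set
      Position t = ∃ λ Y → State t Y × Potential t Y

      next : ∀ {t} → t < q → Position t → Position (suc t)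
      next {t} t<q (Y , st , pot) =
        let g , g≤G , mean , st′ = move t Y t<q st (bounded pot) (pot .Φ) in _ , st′ , advance g g≤G pot mean

      play : State 0 (λ _ → 0) → ∀ t → t ≤ q → Position t
      play s zero    _   = _ , s , initial
      play s (suc t) t<q = next t<q (play s t (<⇒≤ t<q))

      outcome : State 0 (λ _ → 0) → ∃ λ Y → State q Y × (∀ {i} → i ∈ is → Y i < suc μ * q + k * L)
      outcome s = let Y , st , pot = play s q ≤-refl in Y , st , bounded pot

-- Absorbing gadgets: counting and selection.

module Gadget {n : ℕ} (H : 3Graph n) where
  open Prelude
  open Certificates
  open Counting
  open Triples
  open Paths H
  open Connecting H
  open import Data.Fin using (Fin)
  open import Data.List.Relation.Unary.All as All using (All)
  open MultiplicativeWeights using (module Multiplicative)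

  private variable
    a b c d x y z v : Fin n
    W W′ : Fin n → Bool
    ρ : Fin n → ℕ
    h s : ℕ

  -- The gadget (g₂ , g₃ , g₄ , g₁ , g₅) stands for the tight path g₁ g₂ g₃ g₄ g₅.
  Gadget : Set
  Gadget = Fin n × Fin n × Fin n × Fin n × Fin n

  verts : Gadget → List (Fin n)
  verts (g₂ , g₃ , g₄ , g₁ , g₅) = g₁ ∷ g₂ ∷ g₃ ∷ g₄ ∷ g₅ ∷ []

  opaque
    gadgets : List Gadget
    gadgets = cartesianProduct V (cartesianProduct V (cartesianProduct V (cartesianProduct V V)))

    ∑-gadgets : ∀ f → ∑ gadgets f ≡
      ∑ V λ g₂ → ∑ V λ g₃ → ∑ V λ g₄ → ∑ V λ g₁ → ∑ V λ g₅ → f (g₂ , g₃ , g₄ , g₁ , g₅)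
    ∑-gadgets f = trans (∑-cartesianProduct V _ f) (∑-cong V λ _ → trans (∑-cartesianProduct V _ _)
      (∑-cong V λ _ → trans (∑-cartesianProduct V _ _) (∑-cong V λ _ → ∑-cartesianProduct V _ _)))

  length-gadgets : length gadgets ≡ n * (n * (n * (n * n)))
  length-gadgets = trans (sym (trans (∑-const gadgets 1) (*-identityʳ _))) (trans (∑-gadgets (λ _ → 1))
    (layer λ _ → layer λ _ → layer λ _ → layer λ _ → trans (∑-const V 1) (trans (*-identityʳ _) length-V)))
    where
    layer : ∀ {f : Fin n → ℕ} {c} → (∀ x → f x ≡ c) → ∑ V f ≡ n * c
    layer {c = c} e = trans (∑-cong V e) (trans (∑-const V c) (cong (_* c) length-V))

  -- The edges separate vertices at distance at most two on the path. The deletions demand the three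
  -- remaining inequalities, between `g₁` and `g₄`, `g₁` and `g₅`, `g₂` and `g₅`.
  valid : (Fin n → Bool) → Gadget → Bool
  valid W (g₂ , g₃ , g₄ , g₁ , g₅) =
    W g₂ ∧ (W g₃ ∧ (W g₄ ∧ ((W ─ g₄) g₁ ∧ ((W ─ g₁ ─ g₂) g₅ ∧
    (edge H g₁ g₂ g₃ ∧ (edge H g₂ g₃ g₄ ∧ edge H g₃ g₄ g₅))))))

  -- v can be inserted between g₂ and g₃.
  inserts : Fin n → Gadget → Bool
  inserts v (g₂ , g₃ , g₄ , g₁ , g₅) = edge H g₁ g₂ v ∧ (edge H g₂ v g₃ ∧ edge H v g₃ g₄)

  module _ (ρ : Fin n → ℕ) (σ : ℕ) where

    -- v can take the place of g₃, which lies at least σ higher.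
    swaps : Fin n → Gadget → Bool
    swaps v (g₂ , g₃ , g₄ , g₁ , g₅) =
      edge H g₁ g₂ v ∧ (edge H g₂ v g₄ ∧ (edge H v g₄ g₅ ∧ not (ρ g₃ <ᵇ ρ v + σ)))

    fits : Fin n → Gadget → Bool
    fits v g = inserts v g ∨ swaps v g

    good : (Fin n → Bool) → Fin n → Gadget → Bool
    good W v g = valid W g ∧ fits v g

  valid-path : ∀ {g₁ g₂ g₃ g₄ g₅} → valid W (g₂ , g₃ , g₄ , g₁ , g₅) ≡ true →
    Path g₁ g₂ (g₁ ∷ g₂ ∷ g₃ ∷ []) g₄ g₅ × ∃ λ W′ → Split W (g₁ ∷ g₂ ∷ g₃ ∷ g₄ ∷ g₅ ∷ []) W′
  valid-path {W} {g₁} {g₂} {g₃} {g₄} {g₅} e =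
    let W₂ , e = ∧-elim {W g₂} e ; W₃ , e = ∧-elim {W g₃} e ; W₄ , e = ∧-elim {W g₄} e
        W₁′ , e = ∧-elim {(W ─ g₄) g₁} e ; W₅′ , e = ∧-elim {(W ─ g₁ ─ g₂) g₅} e
        e₁ , e = ∧-elim {edge H g₁ g₂ g₃} e ; e₂ , e₃ = ∧-elim {edge H g₂ g₃ g₄} e
        W₁ , g₁≢g₄ = ─-elim {W = W} W₁′ ; W₅″ , g₅≢g₂ = ─-elim {W = W ─ g₁} W₅′ ; W₅ , g₅≢g₁ = ─-elim {W = W} W₅″
    in e₁ ∷ e₂ ∷ e₃ ∷ [] , _ ,
       Split-++ (remove₃ W₁ W₂ W₃ (E-≢₁₂ e₁) (E-≢₁₃ e₁) (E-≢₂₃ e₁))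
         (Split-++ {l = g₄ ∷ []} (remove (keep₃ W₄ (≢-sym g₁≢g₄) (≢-sym (E-≢₁₃ e₂)) (≢-sym (E-≢₂₃ e₂))))
           (remove {x = g₅} (─-intro {W = W ─ g₁ ─ g₂ ─ g₃} (keep₃ W₅ g₅≢g₁ g₅≢g₂ (≢-sym (E-≢₁₃ e₃))) (≢-sym (E-≢₂₃ e₃)))))
    where
    keep₃ : W x ≡ true → x ≢ g₁ → x ≢ g₂ → x ≢ g₃ → (W ─ g₁ ─ g₂ ─ g₃) x ≡ true
    keep₃ Wx p q r = ─-intro {W = W ─ g₁ ─ g₂} (─-intro {W = W ─ g₁} (─-intro {W = W} Wx p) q) r

  module _ (σ : ℕ) (P : Posa h (2 + σ) W ρ) (tops : suc σ ≤ # (W ∩ atLeast ρ h)) where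

    private
      W∩-elim : ∀ p q → (W ∩ (p ∩ q)) x ≡ true → W x ≡ true × p x ≡ true × q x ≡ true
      W∩-elim {x} p q e = let a , e′ = ∧-elim {W x} e ; b , c = ∧-elim {p x} e′ in a , b , c

      ∨-introˡ : ∀ {a b} → a ≡ true → a ∨ b ≡ true
      ∨-introˡ refl = refl

      ∨-introʳ : ∀ a {b} → b ≡ true → a ∨ b ≡ true
      ∨-introʳ true  _ = refl
      ∨-introʳ false e = e

      top-choice : ∀ v → σ ≤ # ((W ∩ atLeast ρ h) ─ v)
      top-choice v = s≤s⁻¹ (≤-trans tops (#-─ (W ∩ atLeast ρ h) v))

    -- The vertices are chosen in the order of the components of a gadget, each in at least `σ`
    -- ways. As `v`, `g₂` and `g₃` are high, `g₄` and `g₁` can be taken as common neighbours of two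
    -- high pairs; for `g₅` the minimum degree suffices.
    insertions : ∀ k v → h ≤ ρ v → σ * (σ * (σ * (σ * σ))) ≤ ∑ gadgets (λ g → bit (good ρ k W v g))
    insertions k v hv = subst (σ * (σ * (σ * (σ * σ))) ≤_) (sym (∑-gadgets (λ g → bit (good ρ k W v g))))
      (∑-at-least ((W ∩ atLeast ρ h) ─ v) (top-choice v) λ {g₂} c₂ →
        let W₂′ , g₂≢v = ─-elim {W = W ∩ atLeast ρ h} c₂ ; W₂ , h₂ = ∧-elim {W g₂} W₂′ in from-g₂ W₂ (≮ᵇ⇒≥ h₂) g₂≢v)
      where
      drop₂ : ∀ {k} s → 2 + s ≤ k → s ≤ k
      drop₂ {k} s h0 =
        cert 2 h0 (solve (k ∷ s ∷ []))
      drop-common : ∀ {k} s → 2 + s + (2 + s) ≤ suc k → suc s ≤ k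
      drop-common {k} s h0 =
        certₘ 1 (2 + k) h0 (solve (k ∷ s ∷ []))
      drop₄ : ∀ {k j l} s → 2 + s ≤ k → k ≤ suc j → j ≤ suc l → s ≤ l
      drop₄ {k} {j} {l} s h0 h1 h2 =
        cert 0 (h0 ⊕ h1 ⊕ h2) (solve (k ∷ j ∷ l ∷ s ∷ []))
      from-g₂ : ∀ {g₂} → W g₂ ≡ true → h ≤ ρ g₂ → g₂ ≢ v → σ * (σ * (σ * σ)) ≤
        ∑ V λ g₃ → ∑ V λ g₄ → ∑ V λ g₁ → ∑ V λ g₅ → bit (good ρ k W v (g₂ , g₃ , g₄ , g₁ , g₅))
      from-g₂ {g₂} W₂ h₂ g₂≢v = ∑-at-least (topNbr W ρ h v g₂) (drop₂ σ (deg-top P (≢-sym g₂≢v) hv h₂)) λ {g₃} c₃ →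
        let W₃ , vg₂g₃ , h₃ = topNbr-elim W ρ h v g₂ c₃ in from-g₃ W₃ vg₂g₃ h₃
        where
        from-g₃ : ∀ {g₃} → W g₃ ≡ true → E v g₂ g₃ → h ≤ ρ g₃ → σ * (σ * σ) ≤
          ∑ V λ g₄ → ∑ V λ g₁ → ∑ V λ g₅ → bit (good ρ k W v (g₂ , g₃ , g₄ , g₁ , g₅))
        from-g₃ {g₃} W₃ vg₂g₃ h₃ =
          ∑-at-least (W ∩ (N g₂ g₃ ∩ N v g₃)) (≤-trans (n≤1+n σ) (drop-common σ (common-top P (E-≢₂₃ vg₂g₃) h₂ h₃ (E-≢₁₃ vg₂g₃) hv h₃))) λ {g₄} c₄ →
            let W₄ , g₂g₃g₄ , vg₃g₄ = W∩-elim (N g₂ g₃) (N v g₃) c₄ in from-g₄ W₄ g₂g₃g₄ vg₃g₄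
          where
          from-g₄ : ∀ {g₄} → W g₄ ≡ true → E g₂ g₃ g₄ → E v g₃ g₄ → σ * σ ≤
            ∑ V λ g₁ → ∑ V λ g₅ → bit (good ρ k W v (g₂ , g₃ , g₄ , g₁ , g₅))
          from-g₄ {g₄} W₄ g₂g₃g₄ vg₃g₄ =
            ∑-at-least ((W ∩ (N g₂ g₃ ∩ N v g₂)) ─ g₄)
              (s≤s⁻¹ (≤-trans (drop-common σ (common-top P (E-≢₂₃ vg₂g₃) h₂ h₃ (E-≢₁₂ vg₂g₃) hv h₂)) (#-─ (W ∩ (N g₂ g₃ ∩ N v g₂)) g₄))) λ {g₁} c₁ →
              let c₁′ , g₁≢g₄ = ─-elim {W = W ∩ (N g₂ g₃ ∩ N v g₂)} c₁ ; W₁ , g₂g₃g₁ , vg₂g₁ = W∩-elim (N g₂ g₃) (N v g₂) c₁′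
              in from-g₁ W₁ g₁≢g₄ g₂g₃g₁ vg₂g₁
            where
            from-g₁ : ∀ {g₁} → W g₁ ≡ true → g₁ ≢ g₄ → E g₂ g₃ g₁ → E v g₂ g₁ → σ ≤
              ∑ V λ g₅ → bit (good ρ k W v (g₂ , g₃ , g₄ , g₁ , g₅))
            from-g₁ {g₁} W₁ g₁≢g₄ g₂g₃g₁ vg₂g₁ = ≤-trans
              (drop₄ σ (P .deg (E-≢₂₃ g₂g₃g₄) 0 z≤n z≤n z≤n) (#-─ (W ∩ N g₃ g₄) g₁) (#-─ ((W ∩ N g₃ g₄) ─ g₁) g₂))
              (#-mono λ g₅ c₅ →
                let c₅′ , g₅≢g₂ = ─-elim {W = (W ∩ N g₃ g₄) ─ g₁} c₅ ; c₅″ , g₅≢g₁ = ─-elim {W = W ∩ N g₃ g₄} c₅′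
                    W₅ , g₃g₄g₅ = ∧-elim {W g₅} c₅″ in
                ∧-intro (∧-intro W₂ (∧-intro W₃ (∧-intro W₄ (∧-intro (─-intro {W = W} W₁ g₁≢g₄)
                          (∧-intro (─-intro {W = W ─ g₁} (─-intro {W = W} W₅ g₅≢g₁) g₅≢g₂)
                            (∧-intro (E-rotate (E-rotate g₂g₃g₁)) (∧-intro g₂g₃g₄ g₃g₄g₅)))))))
                        (∨-introˡ (∧-intro (E-reverse vg₂g₁) (∧-intro (E-swap₁ vg₂g₃) vg₃g₄))))

    module _ (k j κ C : ℕ) (gap : k + j ≤ 2 + σ)
             (enough : # W * (# W * (2 + κ)) + # W * (# W * (2 + κ)) + C ≤ σ * (σ * j)) (v : Fin n) (hv : ρ v ≤ h) where

      private
        A : Fin n → Bool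
        A = (W ∩ atLeast ρ h) ─ v
        t heavy : Fin n → Fin n → Fin n → Bool
        t x y w = A x ∧ (topNbr W ρ (ρ v + 0) v x y ∧ topNbr W ρ (ρ v + k) x y w)
        heavy x y w = t x y w ∧ (not (# (λ x′ → t x′ y w) <ᵇ 2 + κ) ∧ not (# (λ y′ → t x y′ w) <ᵇ 2 + κ))

        record Triple (x y w : Fin n) : Set where
          constructor triple
          field
            Wx : W x ≡ true
            Wy : W y ≡ true
            Ww : W w ≡ true
            vxy : E v x y
            xyw : E x y w
            up  : ρ v + k ≤ ρ w
        open Triple

        A-elim : ∀ {x} → A x ≡ true → W x ≡ true × h ≤ ρ x × x ≢ v
        A-elim {x} e = let e′ , x≢v = ─-elim {W = W ∩ atLeast ρ h} e ; Wx , hx = ∧-elim {W x} e′ in Wx , ≮ᵇ⇒≥ hx , x≢v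

        t-elim : ∀ {x y w} → t x y w ≡ true → Triple x y w
        t-elim {x} {y} {w} e =
          let a , e′ = ∧-elim {A x} e ; b , c = ∧-elim {topNbr W ρ (ρ v + 0) v x y} e′
              Wx , _ , _ = A-elim a ; Wy , vxy , _ = topNbr-elim W ρ (ρ v + 0) v x b ; Ww , xyw , up = topNbr-elim W ρ (ρ v + k) x y c
          in triple Wx Wy Ww vxy xyw up

        j≤ : ∀ {k j s d} → k + j ≤ 2 + s → 2 + s ≤ d + k → j ≤ d
        j≤ {k} {j} {s} {d} h0 h1 =
          cert 0 (h0 ⊕ h1) (solve (k ∷ j ∷ s ∷ d ∷ []))
        σ≤ : ∀ {s d} → 2 + s ≤ d + 0 → s ≤ d
        σ≤ {s} {d} h0 =
          cert 2 h0 (solve (s ∷ d ∷ []))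
        many : σ * (σ * j) ≤ #³ t
        many = ∑-at-least A (top-choice v) λ {x} Ax →
          let _ , hx , x≢v = A-elim Ax in
          ∑-at-least (topNbr W ρ (ρ v + 0) v x) (σ≤ (deg-high P (≢-sym x≢v) (ρ v) 0 ≤-refl (≤-trans hv hx) hv)) λ {y} By →
            let _ , vxy , vy = topNbr-elim W ρ (ρ v + 0) v x By in
            ≤-trans (j≤ gap (deg-high P (E-≢₂₃ vxy) (ρ v) k (≤-trans hv hx) (≤-trans (m≤m+n (ρ v) 0) vy) hv))
              (#-mono λ w Cw → ∧-intro Ax (∧-intro By Cw))

        C≤ : ∀ {c a b r t} → t ≤ r + a + b → a + b + c ≤ t → c ≤ r
        C≤ {c} {a} {b} {r} {t} h0 h1 =
          cert 0 (h0 ⊕ h1) (solve (c ∷ a ∷ b ∷ r ∷ t ∷ []))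
        C≤heavy : C ≤ #³ heavy
        C≤heavy = C≤ (∑³-heavy (2 + κ) {W} {W} {W} t λ e → let r = t-elim e in r .Wx , r .Wy , r .Ww) (≤-trans enough many)

        target : Fin n → Fin n → Fin n → Fin n → Fin n → Bool
        target x y w g₁ g₅ = valid W (x , w , y , g₁ , g₅) ∧ fits ρ k v (x , w , y , g₁ , g₅)

        complete : ∀ {x y w y′ x′} → Triple x y w → Triple x y′ w → Triple x′ y w → y′ ≢ y → x′ ≢ y′ → x′ ≢ x →
                   target x y w y′ x′ ≡ true
        complete {x} {y} {w} {y′} {x′} r r₁ r₂ y′≢y x′≢y′ x′≢x =
          ∧-intro (∧-intro (r .Wx) (∧-intro (r .Ww) (∧-intro (r .Wy) (∧-intro (─-intro {W = W} (r₁ .Wy) y′≢y)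
                    (∧-intro (─-intro {W = W ─ y′} (─-intro {W = W} (r₂ .Wx) x′≢y′) x′≢x)
                      (∧-intro (E-swap₁ (r₁ .xyw)) (∧-intro (E-swap₂ (r .xyw)) (E-reverse (r₂ .xyw)))))))))
                  (∨-introʳ (inserts v (x , w , y , y′ , x′))
                    (∧-intro (E-reverse (r₁ .vxy)) (∧-intro (E-swap₁ (r .vxy)) (∧-intro (E-swap₂ (r₂ .vxy)) (≮ᵇ-intro (r .up))))))

        drop₁ : ∀ {k} s {l} → 2 + s ≤ k → k ≤ suc l → s ≤ l
        drop₁ {k} s {l} h0 h1 =
          cert 1 (h0 ⊕ h1) (solve (k ∷ s ∷ l ∷ []))
        drop₂′ : ∀ {k} s {j l} → 2 + s ≤ k → k ≤ suc j → j ≤ suc l → s ≤ l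
        drop₂′ {k} s {j} {l} h0 h1 h2 =
          cert 0 (h0 ⊕ h1 ⊕ h2) (solve (k ∷ s ∷ j ∷ l ∷ []))
        completions : ∀ {x y w} → heavy x y w ≡ true → κ * κ ≤ ∑ V λ g₁ → ∑ V λ g₅ → bit (target x y w g₁ g₅)
        completions {x} {y} {w} e =
          let e₀ , d = ∧-elim {t x y w} e ; d₁ , d₂ = ∧-elim {not (# (λ x′ → t x′ y w) <ᵇ 2 + κ)} d in
          ∑-at-least ((λ y′ → t x y′ w) ─ y) (drop₁ κ (≮ᵇ⇒≥ d₂) (#-─ (λ y′ → t x y′ w) y)) λ {y′} e₁ →
            let t₁ , y′≢y = ─-elim {W = λ y′ → t x y′ w} e₁ in
            ≤-trans (drop₂′ κ (≮ᵇ⇒≥ d₁) (#-─ (λ x′ → t x′ y w) x) (#-─ ((λ x′ → t x′ y w) ─ x) y′))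
              (#-mono λ x′ e₂ →
                let e₃ , x′≢y′ = ─-elim {W = (λ x′ → t x′ y w) ─ x} e₂ ; t₂ , x′≢x = ─-elim {W = λ x′ → t x′ y w} e₃ in
                complete (t-elim e₀) (t-elim t₁) (t-elim t₂) y′≢y x′≢y′ x′≢x)

      -- In a heavy triple `x y w`, where `v x y` and `x y w` are edges and `w` lies `k` above `v`,
      -- exchange `y` for `y′` and `x` for `x′`. The gadget is `y′ x w y x′`, and the edges
      -- `v x y′`, `v x y`, `v x′ y` allow `v` in place of `w`. The 2 in the threshold `2 + κ` pays
      -- for keeping the vertices distinct.
      replacements : C * (κ * κ) ≤ ∑ gadgets (λ g → bit (good ρ k W v g))
      replacements = begin
        C * (κ * κ)                                      ≤⟨ *-monoˡ-≤ (κ * κ) C≤heavy ⟩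
        #³ heavy * (κ * κ)                               ≡⟨ ∑³-*ʳ (λ x y w → bit (heavy x y w)) (κ * κ) ⟨
        ∑³ (λ x y w → bit (heavy x y w) * (κ * κ))       ≤⟨ ∑³-mono (λ x y w → cell x y w) ⟩
        ∑³ (λ x y w → ∑ V λ g₁ → ∑ V λ g₅ → bit (target x y w g₁ g₅)) ≡⟨ ∑-cong V (λ x → ∑-swap V V _) ⟩
        ∑³ (λ x w y → ∑ V λ g₁ → ∑ V λ g₅ → bit (target x y w g₁ g₅)) ≡⟨ ∑-gadgets (λ g → bit (good ρ k W v g)) ⟨
        ∑ gadgets (λ g → bit (good ρ k W v g))               ∎
        where
        open ≤-Reasoning
        cell : ∀ x y w → bit (heavy x y w) * (κ * κ) ≤ ∑ V λ g₁ → ∑ V λ g₅ → bit (target x y w g₁ g₅)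
        cell x y w with heavy x y w in e
        ... | true  = ≤-trans (≤-reflexive (+-identityʳ (κ * κ))) (completions {x} {y} {w} e)
        ... | false = z≤n

  flat : List Gadget → List (Fin n)
  flat []       = []
  flat (g ∷ gs) = verts g ++ flat gs

  TightGadget : Gadget → Set
  TightGadget (g₂ , g₃ , g₄ , g₁ , g₅) = Path g₁ g₂ (g₁ ∷ g₂ ∷ g₃ ∷ []) g₄ g₅

  valid⇒ : ∀ {W} g → valid W g ≡ true → TightGadget g × ∃ λ W′ → Split W (verts g) W′
  valid⇒ {W} (g₂ , g₃ , g₄ , g₁ , g₅) e = valid-path {W} e

  length-flat : ∀ gs → length (flat gs) ≡ length gs * 5
  length-flat []       = refl
  length-flat (_ ∷ gs) = cong (5 +_) (length-flat gs)

  everything : Fin n → Bool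
  everything _ = true

  ∑-≤ : ∀ {A : Set} (xs : List A) {f g} → 0 < length xs → ∑ xs f ≤ ∑ xs g → ∃ λ x → f x ≤ g x
  ∑-≤ (x ∷ xs) {f} {g} _ le with f x ≤? g x
  ... | yes p = x , p
  ∑-≤ (x ∷ []) {f} {g} _ le | no ¬p = contradiction (subst₂ _≤_ (+-identityʳ (f x)) (+-identityʳ (g x)) le) ¬p
  ∑-≤ (x ∷ y ∷ ys) {f} {g} _ le | no ¬p =
    ∑-≤ (y ∷ ys) (s≤s z≤n) (+-cancelˡ-≤ (g x) _ _ (≤-trans (+-monoˡ-≤ _ (<⇒≤ (≰⇒> ¬p))) le))

  module Selection {h} (σ k j κ C C₅ Δ q L : ℕ) (P : Posa h (q * 5 + (2 + σ)) everything ρ)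
    (tops : q * 5 + suc σ ≤ # (everything ∩ atLeast ρ h)) (gap : k + j ≤ 2 + σ)
    (enough : n * (n * (2 + κ)) + n * (n * (2 + κ)) + C ≤ σ * (σ * j))
    (C₅≤₁ : C₅ ≤ σ * (σ * (σ * (σ * σ)))) (C₅≤₂ : C₅ ≤ C * (κ * κ))
    (dense : n * (n * (n * (n * n))) ≤ suc Δ * C₅) (0<n : 0 < n) (log : n < 2 ^ L) where

    hits : Fin n → List Gadget → ℕ
    hits v gs = ∑ gs (λ g → bit (fits ρ k v g))

    -- A round scores `U` for a vertex that is missed and 0 for one that is served. Some gadget
    -- serves a share `1 / (Δ + 1)` of the weight, so the mean score is at most `U − 2 = 2 Δ`. The
    -- factor 2 in `U` keeps this below `U` even after the method adds 1 per round.
    U : ℕ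
    U = 2 + 2 * Δ

    private
      serving : ∀ {l} → Split everything l W → length l ≤ q * 5 → ∀ v → C₅ ≤ ∑ gadgets (λ g → bit (good ρ k W v g))
      serving {W} {l} sp len v with ≤-total h (ρ v)
      ... | inj₁ hv = ≤-trans C₅≤₁ (insertions σ (Posa-split sp (q * 5) len P) tops′ k v hv)
        where
        arith : ∀ {q s a b l} → q + s ≤ a → a ≤ b + l → l ≤ q → s ≤ b
        arith {q} {s} {a} {b} {l} h0 h1 h2 =
          cert 0 (h0 ⊕ h1 ⊕ h2) (solve (q ∷ s ∷ a ∷ b ∷ l ∷ []))
        tops′ : suc σ ≤ # (W ∩ atLeast ρ h)
        tops′ = arith tops (Split-#∩ sp (atLeast ρ h)) len
      ... | inj₂ vh = ≤-trans C₅≤₂ (replacements σ (Posa-split sp (q * 5) len P) tops′ k j κ C gap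
          (≤-trans (+-monoˡ-≤ C (+-mono-≤ (*-mono-≤ W≤n (*-monoˡ-≤ (2 + κ) W≤n)) (*-mono-≤ W≤n (*-monoˡ-≤ (2 + κ) W≤n)))) enough) v vh)
        where
        arith : ∀ {q s a b l} → q + s ≤ a → a ≤ b + l → l ≤ q → s ≤ b
        arith {q} {s} {a} {b} {l} h0 h1 h2 =
          cert 0 (h0 ⊕ h1 ⊕ h2) (solve (q ∷ s ∷ a ∷ b ∷ l ∷ []))
        tops′ : suc σ ≤ # (W ∩ atLeast ρ h)
        tops′ = arith tops (Split-#∩ sp (atLeast ρ h)) len
        W≤n : # W ≤ n
        W≤n = ≤-trans (∑-mono V (λ x → bit≤1 (W x))) (≤-reflexive (trans (∑-const V 1) (trans (*-identityʳ _) length-V)))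

      -- The average runs over all gadgets. An invalid one contributes 0, so a gadget that reaches
      -- the positive average is valid.
      average : ∀ {l} → Split everything l W → length l ≤ q * 5 → ∀ (ω : Fin n → ℕ) → 0 < ∑ V ω →
                ∃ λ g → valid W g ≡ true × ∑ V ω ≤ suc Δ * ∑ V (λ v → ω v * bit (fits ρ k v g))
      average {W} sp len ω 0<Ω = conclude (∑-≤ gadgets nonempty total)
        where
        open ≤-Reasoning
        Ω = ∑ V ω
        nonempty : 0 < length gadgets
        nonempty = subst (0 <_) (sym length-gadgets) (*-mono-≤ 0<n (*-mono-≤ 0<n (*-mono-≤ 0<n (*-mono-≤ 0<n 0<n))))
        total : ∑ gadgets (λ _ → Ω) ≤ ∑ gadgets (λ g → suc Δ * ∑ V (λ v → ω v * bit (good ρ k W v g)))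
        total = begin
          ∑ gadgets (λ _ → Ω)                   ≡⟨ trans (∑-const gadgets Ω) (cong (_* Ω) length-gadgets) ⟩
          n * (n * (n * (n * n))) * Ω           ≤⟨ *-monoˡ-≤ Ω dense ⟩
          suc Δ * C₅ * Ω                        ≡⟨ *-assoc (suc Δ) C₅ Ω ⟩
          suc Δ * (C₅ * Ω)                      ≡⟨ cong (suc Δ *_) (∑-* V C₅ ω) ⟨
          suc Δ * ∑ V (λ v → C₅ * ω v)          ≤⟨ *-monoʳ-≤ (suc Δ) (∑-mono V λ v → ≤-trans (≤-reflexive (*-comm C₅ (ω v)))
                                                     (*-monoʳ-≤ (ω v) (serving sp len v))) ⟩
          suc Δ * ∑ V (λ v → ω v * ∑ gadgets (λ g → bit (good ρ k W v g)))
            ≡⟨ cong (suc Δ *_) (∑-cong V λ v → ∑-* gadgets (ω v) (λ g → bit (good ρ k W v g))) ⟨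
          suc Δ * ∑ V (λ v → ∑ gadgets (λ g → ω v * bit (good ρ k W v g)))
            ≡⟨ cong (suc Δ *_) (∑-swap V gadgets (λ v g → ω v * bit (good ρ k W v g))) ⟩
          suc Δ * ∑ gadgets (λ g → ∑ V (λ v → ω v * bit (good ρ k W v g)))
            ≡⟨ ∑-* gadgets (suc Δ) (λ g → ∑ V (λ v → ω v * bit (good ρ k W v g))) ⟨
          ∑ gadgets (λ g → suc Δ * ∑ V (λ v → ω v * bit (good ρ k W v g))) ∎
        conclude : (∃ λ g → Ω ≤ suc Δ * ∑ V (λ v → ω v * bit (good ρ k W v g))) →
                   ∃ λ g → valid W g ≡ true × Ω ≤ suc Δ * ∑ V (λ v → ω v * bit (fits ρ k v g))
        conclude (g , le) = g , is-valid , ≤-trans le (*-monoʳ-≤ (suc Δ) (∑-mono V λ v → *-monoʳ-≤ (ω v) (bit-mono λ e → proj₂ (∧-elim {valid W g} e))))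
          where
          invalid : valid W g ≡ false → suc Δ * ∑ V (λ v → ω v * bit (good ρ k W v g)) ≡ 0
          invalid e = trans (cong (suc Δ *_) (trans (∑-cong V λ v → trans (cong (λ b → ω v * bit (b ∧ fits ρ k v g)) e) (*-zeroʳ (ω v)))
            (trans (∑-const V 0) (*-zeroʳ (length (V {n})))))) (*-zeroʳ (suc Δ))
          decide : ∀ b → valid W g ≡ b → valid W g ≡ true
          decide true  e = e
          decide false e = contradiction (≤-trans 0<Ω (≤-trans le (≤-reflexive (invalid e)))) λ ()
          is-valid : valid W g ≡ true
          is-valid = decide _ refl

      choose : ∀ {l} → Split everything l W → length l ≤ q * 5 → ∀ (ω : Fin n → ℕ) →
               ∃ λ g → valid W g ≡ true × ∑ V ω ≤ suc Δ * ∑ V (λ v → ω v * bit (fits ρ k v g))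
      choose sp len ω with ∑ V ω in e
      ... | suc Ω = let g , va , le = average sp len ω (subst (0 <_) (sym e) (s≤s z≤n)) in
                    g , va , subst (_≤ suc Δ * ∑ V (λ v → ω v * bit (fits ρ k v g))) e le
      -- If all weights vanish, any valid gadget will do, and uniform weights produce one.
      ... | zero  = let g , va , _ = average sp len (λ _ → 1) (subst (0 <_) (sym (trans (∑-const V 1) (trans (*-identityʳ _) length-V))) 0<n) in
                    g , va , z≤n

    State : ℕ → (Fin n → ℕ) → Set
    State t Y = ∃ λ gs → ∃ λ W → length gs ≡ t × All TightGadget gs × Split everything (flat gs) W ×
                (∀ v → Y v + U * hits v gs ≡ U * t)

    private
      move : ∀ t Y → t < q → State t Y → ∀ ω →
             ∃ λ g → (∀ i → g i ≤ U) × ∑ V (λ i → ω i * g i) ≤ 2 * Δ * ∑ V ω × State (suc t) (λ i → Y i + g i)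
      move t Y t<q (gs , W , len , tight , sp , count) ω = from (choose sp short ω)
        where
        short : length (flat gs) ≤ q * 5
        short = ≤-trans (≤-reflexive (trans (length-flat gs) (cong (_* 5) len))) (*-monoˡ-≤ 5 (<⇒≤ t<q))
        from : (∃ λ g → valid W g ≡ true × ∑ V ω ≤ suc Δ * ∑ V (λ v → ω v * bit (fits ρ k v g))) →
               ∃ λ g → (∀ i → g i ≤ U) × ∑ V (λ i → ω i * g i) ≤ 2 * Δ * ∑ V ω × State (suc t) (λ i → Y i + g i)
        from (g , va , le) = from′ (valid⇒ g va)
          where
          miss : Fin n → ℕ
          miss v = U * bit (not (fits ρ k v g))
          complement : ∀ b → U * bit (not b) + U * bit b ≡ U
          complement true  = trans (cong (_+ U * 1) (*-zeroʳ U)) (*-identityʳ U)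
          complement false = trans (cong₂ _+_ (*-identityʳ U) (*-zeroʳ U)) (+-identityʳ U)
          mean-arith : ∀ {m f o} d → m + (2 + 2 * d) * f ≡ (2 + 2 * d) * o → o ≤ suc d * f → m ≤ 2 * d * o
          mean-arith {m} {f} {o} d h0 h1 =
            cert 0 ((≤-reflexive h0) ⊕ 2 ⊗ h1) (solve (m ∷ f ∷ o ∷ d ∷ []))
          mean : ∑ V (λ i → ω i * miss i) ≤ 2 * Δ * ∑ V ω
          mean = mean-arith Δ (trans (cong (∑ V (λ i → ω i * miss i) +_) (sym (∑-* V U _))) (trans (sym (∑-+ V _ _))
            (trans (∑-cong V (λ v → trans (swap (ω v) (miss v) U _) (trans (cong (ω v *_) (complement (fits ρ k v g))) (*-comm (ω v) U)))) (∑-* V U ω)))) le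
            where
            swap : ∀ w m u b → w * m + u * (w * b) ≡ w * (m + u * b)
            swap = solve-∀
          from′ : TightGadget g × (∃ λ W′ → Split W (verts g) W′) → _
          from′ (tg , W′ , sp′) = miss , (λ v → ≤-trans (m≤m+n (miss v) _) (≤-reflexive (complement (fits ρ k v g)))) , mean ,
            g ∷ gs , W′ , cong suc len , tg All.∷ tight , Split-++ʳ sp sp′ ,
            λ v → trans (regroup (Y v) (miss v) U (bit (fits ρ k v g)) (hits v gs))
                    (trans (cong₂ _+_ (complement (fits ρ k v g)) (count v)) (sym (*-suc U t)))
            where
            regroup : ∀ y m u b c → y + m + u * (b + c) ≡ (m + u * b) + (y + u * c)
            regroup = solve-∀

    selection : ∃ λ gs → ∃ λ W → length gs ≡ q × All TightGadget gs × Split everything (flat gs) W ×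
                (∀ v → q < U * U * L + U * hits v gs)
    selection = conclude (outcome State q (λ t Y t<q st _ ω → move t Y t<q st ω) start)
      where
      open Multiplicative {I = Fin n} V U (U * U) (2 * Δ) L ≤-refl (subst (_< 2 ^ L) (sym length-V) log)
      start : State 0 (λ _ → 0)
      start = [] , everything , refl , All.[] , Split-[] , λ v → refl
      conclude : (∃ λ Y → State q Y × (∀ {i} → i ∈ V → Y i < suc (2 * Δ) * q + U * U * L)) → _
      conclude (Y , (gs , W , len , tight , sp , count) , bound) =
        gs , W , len , tight , sp , λ v → arith {hits v gs} Δ (bound (∈-V v)) (count v)
        where
        arith : ∀ {f y q l} d → y < suc (2 * d) * q + l → y + (2 + 2 * d) * f ≡ (2 + 2 * d) * q → q < l + (2 + 2 * d) * f
        arith {f} {y} {q} {l} d h0 h1 =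
          cert 0 (h0 ⊕ (≤-reflexive (sym h1))) (solve (f ∷ y ∷ q ∷ l ∷ d ∷ []))

-- Paths through gadgets, and absorption into them.

module Chains {n : ℕ} (H : 3Graph n) where
  open Prelude
  open Counting
  open Paths H
  open Connecting H
  open Gadget H
  open import Data.Fin using (Fin)
  open import Data.List.Relation.Unary.All as All using (All)

  private variable
    a b c d e f x y z v : Fin n
    W W′ : Fin n → Bool
    ρ : Fin n → ℕ
    h s : ℕ
    l l′ : List (Fin n)
    gs : List Gadget

  -- A tight path passing through the gadgets of the list, all of them still unused.
  data Chain : Fin n → Fin n → List Gadget → List (Fin n) → Fin n → Fin n → Set where
    done : Path a b l c d → Chain a b [] l c d
    pass : ∀ {g₁ g₂ g₃ g₄ g₅} → Path a b l g₁ g₂ → TightGadget (g₂ , g₃ , g₄ , g₁ , g₅) →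
           Chain g₄ g₅ gs l′ c d → Chain a b ((g₂ , g₃ , g₄ , g₁ , g₅) ∷ gs) (l ++ g₁ ∷ g₂ ∷ g₃ ∷ l′) c d

  prepend : Path a b l c d → Chain c d gs l′ e f → Chain a b gs (l ++ l′) e f
  prepend p (done q) = done (p ⋈ q)
  prepend {l = l} p (pass {l = l₀} q t ch) = subst (λ l → Chain _ _ _ l _ _) (++-assoc l l₀ _) (pass (p ⋈ q) t ch)

  append : Chain a b gs l c d → Path c d l′ e f → Chain a b gs (l ++ l′) e f
  append (done p) q = done (p ⋈ q)
  append (pass {l = l₀} {l′ = l₁} p t ch) q =
    subst (λ l → Chain _ _ _ l _ _) (sym (++-assoc l₀ _ _)) (pass p t (append ch q))

  Chain⇒Path : Chain a b gs l c d → Path a b l c d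
  Chain⇒Path (done p) = p
  Chain⇒Path (pass p t ch) = p ⋈ (t ⋈ Chain⇒Path ch)

  last-edge : ∀ {g₁ g₂ g₃ g₄ g₅} → TightGadget (g₂ , g₃ , g₄ , g₁ , g₅) → E g₃ g₄ g₅
  last-edge (_ ∷ _ ∷ e ∷ []) = e

  first-edge : ∀ {g₁ g₂ g₃ g₄ g₅} → TightGadget (g₂ , g₃ , g₄ , g₁ , g₅) → E g₁ g₂ g₃
  first-edge (e ∷ _ ∷ _ ∷ []) = e

  module _ (ρ : Fin n → ℕ) (σ : ℕ) where

    hitsOf : Fin n → List Gadget → ℕ
    hitsOf v gs = ∑ gs (λ g → bit (fits ρ σ v g))

    -- The alternatives are insertion and replacement, with `w` the vertex thrown out. The gadget
    -- that was used dissolves into the path, so no hit count falls by more than one.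
    Absorbed : (a b : Fin n) (gs : List Gadget) (l : List (Fin n)) (c d v : Fin n) → Set
    Absorbed a b gs l c d v = ∃ λ gs′ → ∃ λ l′ → Chain a b gs′ l′ c d × (∀ u → hitsOf u gs ≤ suc (hitsOf u gs′)) ×
      ((∀ u → occ u l′ ≡ δ u v + occ u l) ⊎
       (∃ λ w → ρ v + σ ≤ ρ w × (∀ u → δ u w + occ u l′ ≡ δ u v + occ u l)))

    absorb-one : ∀ gs v → 0 < hitsOf v gs → Chain a b gs l c d → Absorbed a b gs l c d v
    absorb-one {a} {b} {c = c} {d} ((g₂ , g₃ , g₄ , g₁ , g₅) ∷ gs) v hit (pass {l = l} {l′ = l′} p t ch) =
      by-insertion _ refl
      where
      g : Gadget
      g = g₂ , g₃ , g₄ , g₁ , g₅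
      old : List (Fin n)
      old = l ++ g₁ ∷ g₂ ∷ g₃ ∷ l′
      fewer : ∀ u → hitsOf u (g ∷ gs) ≤ suc (hitsOf u gs)
      fewer u = +-monoˡ-≤ (hitsOf u gs) (bit≤1 (fits ρ σ u g))
      count-old : ∀ u → occ u old ≡ occ u l + (δ u g₁ + (δ u g₂ + (δ u g₃ + occ u l′)))
      count-old u = ∑-++ l _ (δ u)
      inserted : inserts v g ≡ true → Absorbed a b (g ∷ gs) old c d v
      inserted e =
        let e₁ , e′ = ∧-elim {edge H g₁ g₂ v} e ; e₂ , e₃ = ∧-elim {edge H g₂ v g₃} e′ in
        gs , l ++ (g₁ ∷ g₂ ∷ v ∷ g₃ ∷ []) ++ l′ , prepend p (prepend (e₁ ∷ e₂ ∷ e₃ ∷ last-edge t ∷ []) ch) , fewer ,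
        inj₁ λ u → trans (∑-++ l _ (δ u)) (trans (shuffle (occ u l) (δ u g₁) (δ u g₂) (δ u v) (δ u g₃) (occ u l′)) (cong (δ u v +_) (sym (count-old u))))
        where
        shuffle : ∀ l a b v c m → l + (a + (b + (v + (c + m)))) ≡ v + (l + (a + (b + (c + m))))
        shuffle = solve-∀
      swapped : swaps ρ σ v g ≡ true → Absorbed a b (g ∷ gs) old c d v
      swapped e =
        let e₁ , e′ = ∧-elim {edge H g₁ g₂ v} e ; e₂ , e″ = ∧-elim {edge H g₂ v g₄} e′ ; e₃ , up = ∧-elim {edge H v g₄ g₅} e″ in
        gs , l ++ (g₁ ∷ g₂ ∷ v ∷ []) ++ l′ , prepend p (prepend (e₁ ∷ e₂ ∷ e₃ ∷ []) ch) , fewer ,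
        inj₂ (g₃ , ≮ᵇ⇒≥ up , λ u → trans (cong (δ u g₃ +_) (∑-++ l _ (δ u)))
          (trans (shuffle (occ u l) (δ u g₁) (δ u g₂) (δ u v) (δ u g₃) (occ u l′)) (cong (δ u v +_) (sym (count-old u)))))
        where
        shuffle : ∀ l a b v c m → c + (l + (a + (b + (v + m)))) ≡ v + (l + (a + (b + (c + m))))
        shuffle = solve-∀
      later : fits ρ σ v g ≡ false → Absorbed a b (g ∷ gs) old c d v
      later e = conclude (absorb-one gs v (subst (λ t → 0 < bit t + hitsOf v gs) e hit) ch)
        where
        conclude : Absorbed g₄ g₅ gs l′ c d v → Absorbed a b (g ∷ gs) old c d v
        conclude (gs′ , l″ , ch′ , few , r) = g ∷ gs′ , l ++ g₁ ∷ g₂ ∷ g₃ ∷ l″ , pass p t ch′ ,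
          (λ u → ≤-trans (+-monoʳ-≤ (bit (fits ρ σ u g)) (few u)) (≤-reflexive (+-suc _ _))) , extend r
          where
          shuffle : ∀ l a b c m v → l + (a + (b + (c + (v + m)))) ≡ v + (l + (a + (b + (c + m))))
          shuffle = solve-∀
          lift : ∀ u x y → x + occ u l″ ≡ y + occ u l′ → x + occ u (l ++ g₁ ∷ g₂ ∷ g₃ ∷ l″) ≡ y + occ u old
          lift u x y eq = trans (cong (x +_) (∑-++ l _ (δ u))) (trans (sym (shuffle (occ u l) (δ u g₁) (δ u g₂) (δ u g₃) (occ u l″) x))
            (trans (cong (λ t → occ u l + (δ u g₁ + (δ u g₂ + (δ u g₃ + t)))) eq)
              (trans (shuffle (occ u l) (δ u g₁) (δ u g₂) (δ u g₃) (occ u l′) y) (cong (y +_) (sym (count-old u))))))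
          extend : _ → _
          extend (inj₁ h)            = inj₁ λ u → lift u 0 (δ u v) (h u)
          extend (inj₂ (w , up , h)) = inj₂ (w , up , λ u → lift u (δ u w) (δ u v) (h u))
      by-swap : inserts v g ≡ false → ∀ q → swaps ρ σ v g ≡ q → Absorbed a b (g ∷ gs) old c d v
      by-swap _  true  e = swapped e
      by-swap ne false e = later (cong₂ _∨_ ne e)
      by-insertion : ∀ q → inserts v g ≡ q → Absorbed a b (g ∷ gs) old c d v
      by-insertion true  e = inserted e
      by-insertion false e = by-swap e _ refl

    module _ (cost : Fin n → ℕ) (cost>0 : ∀ v → 0 < cost v) (cost-drops : ∀ {v w} → ρ v + σ ≤ ρ w → cost w < cost v) where

      -- Every absorption lowers the total cost of the leftover vertices: an insertion deletes a
      -- term, a replacement puts a cheaper vertex in its place. So `fuel` bounds the number of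
      -- absorptions, and with it the number of gadgets any vertex can miss.
      absorb : ∀ fuel A → ∑ A cost ≤ fuel → (∀ u → fuel ≤ hitsOf u gs) → Chain a b gs l c d →
               ∃ λ l′ → Path a b l′ c d × (∀ u → occ u l′ ≡ occ u A + occ u l)
      absorb fuel [] _ _ ch = _ , Chain⇒Path ch , λ u → refl
      absorb zero (v ∷ A) le _ _ = contradiction (≤-trans (cost>0 v) (≤-trans (m≤m+n _ _) le)) λ ()
      absorb {gs} {l = l} {c = c} {d} (suc fuel) (v ∷ A) le enough ch = conclude (absorb-one gs v (≤-trans (s≤s z≤n) (enough v)) ch)
        where
        conclude : Absorbed _ _ gs l c d v → ∃ λ l′ → Path _ _ l′ c d × (∀ u → occ u l′ ≡ δ u v + occ u A + occ u l)
        conclude (gs′ , l′ , ch′ , few , inj₁ h) =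
          let l″ , p , o = absorb fuel A (s≤s⁻¹ (≤-trans (+-monoˡ-≤ (∑ A cost) (cost>0 v)) le)) (λ u → s≤s⁻¹ (≤-trans (enough u) (few u))) ch′ in
          l″ , p , λ u → trans (o u) (trans (cong (occ u A +_) (h u)) (shuffle (occ u A) (δ u v) (occ u l)))
          where
          shuffle : ∀ a v l → a + (v + l) ≡ v + a + l
          shuffle = solve-∀
        conclude (gs′ , l′ , ch′ , few , inj₂ (w , up , h)) =
          let l″ , p , o = absorb fuel (w ∷ A) (s≤s⁻¹ (≤-trans (+-monoˡ-≤ (∑ A cost) (cost-drops up)) le)) (λ u → s≤s⁻¹ (≤-trans (enough u) (few u))) ch′ in
          l″ , p , λ u → trans (o u) (trans (shuffle (δ u w) (occ u A) (occ u l′)) (trans (cong (occ u A +_) (h u)) (shuffle′ (occ u A) (δ u v) (occ u l))))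
          where
          shuffle : ∀ w a l → w + a + l ≡ a + (w + l)
          shuffle = solve-∀
          shuffle′ : ∀ a v l → a + (v + l) ≡ v + a + l
          shuffle′ = solve-∀

  Connectable : (h S k : ℕ) (ρ : Fin n → ℕ) → Set
  Connectable h S k ρ = ∀ {W a b c d} → Posa h S W ρ → a ≢ b → c ≢ d → Connection k W a b c d

  module _ {h S k : ℕ} {ρ : Fin n → ℕ} (conn : Connectable h S k ρ) {e f : Fin n} (e≢f : e ≢ f) where

    -- The chain is built from its end `e f` backwards: the last pair of a new gadget is connected
    -- to the current front, and the gadget becomes the new front.
    chain-up : ∀ gs → All TightGadget gs → Posa h (length gs * k + S) W ρ →
      ∃ λ x → ∃ λ y → ∃ λ l → ∃ λ new → ∃ λ W′ → Chain x y gs l e f × x ≢ y × Split W new W′ ×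
      length new ≡ length gs * k × (∀ v → occ v l ≡ occ v (flat gs) + occ v new)
    chain-up [] All.[] P = _ , _ , [] , [] , _ , done [] , e≢f , Split-[] , refl , λ v → refl
    chain-up {W} (g@(g₂ , g₃ , g₄ , g₁ , g₅) ∷ gs) (t All.∷ ts) P =
      from (chain-up gs ts P′)
      where
      P′ : Posa h (length gs * k + S) W ρ
      P′ = Posa-weaken k (subst (λ t → Posa h t W ρ) (+-assoc k (length gs * k) S) P)
      from : _ → _
      from (x , y , l , new , W′ , ch , x≢y , sp , len , o) =
        join (conn (Posa-split sp (length gs * k) (≤-reflexive len) P′) (E-≢₂₃ (last-edge t)) x≢y)
        where
        join : Connection k W′ g₄ g₅ x y → _
        join (l₀ , L , W″ , p , o′ , sp′ , len′) =
          g₁ , g₂ , g₁ ∷ g₂ ∷ g₃ ∷ (L ++ l) , new ++ l₀ , W″ , pass [] t (prepend p ch) , E-≢₁₂ (first-edge t) , Split-++ sp sp′ ,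
          trans (length-++ new) (trans (+-comm (length new) _) (cong₂ _+_ len′ len)) , count
          where
          count : ∀ v → occ v (g₁ ∷ g₂ ∷ g₃ ∷ (L ++ l)) ≡ occ v (flat (g ∷ gs)) + occ v (new ++ l₀)
          count v = begin
            δ v g₁ + (δ v g₂ + (δ v g₃ + occ v (L ++ l)))
              ≡⟨ cong (λ t → δ v g₁ + (δ v g₂ + (δ v g₃ + t))) (trans (∑-++ L l (δ v)) (cong₂ _+_ (o′ v) (o v))) ⟩
            δ v g₁ + (δ v g₂ + (δ v g₃ + (δ v g₄ + (δ v g₅ + occ v l₀) + (occ v (flat gs) + occ v new))))
              ≡⟨ shuffle (δ v g₁) (δ v g₂) (δ v g₃) (δ v g₄) (δ v g₅) (occ v l₀) (occ v (flat gs)) (occ v new) ⟩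
            δ v g₁ + (δ v g₂ + (δ v g₃ + (δ v g₄ + (δ v g₅ + occ v (flat gs))))) + (occ v new + occ v l₀)
              ≡⟨ cong (occ v (flat (g ∷ gs)) +_) (sym (∑-++ new l₀ (δ v))) ⟩
            occ v (flat (g ∷ gs)) + occ v (new ++ l₀) ∎
            where
            open ≡-Reasoning
            shuffle : ∀ a b c d e m f w → a + (b + (c + (d + (e + m) + (f + w)))) ≡ a + (b + (c + (d + (e + f)))) + (w + m)
            shuffle = solve-∀

-- Positions inside a subset, and transport of Pósa's condition between sets of close densities.

module Ranks where
  open Prelude
  open Certificates
  open Counting
  open import Data.Nat.DivMod using (_/_; _%_; m≡m%n+[m/n]*n; m%n<n)
  open import Data.Fin using (Fin; toℕ; fromℕ<)
  open import Data.Fin.Properties using (toℕ-fromℕ<; toℕ-injective; toℕ<n)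
  import Data.Fin as Fin

  module _ {n : ℕ} where

    below : ℕ → Fin n → Bool
    below j x = toℕ x <ᵇ j

    below-step : ∀ (X : Fin n → Bool) {j} (j<n : j < n) →
                 # (X ∩ below (suc j)) ≤ # (X ∩ below j) + bit (X (fromℕ< j<n))
    below-step X {j} j<n = begin
      # (X ∩ below (suc j))                                        ≤⟨ ∑-mono V pointwise ⟩
      ∑ V (λ x → bit (X x ∧ below j x) + δ x z * bit (X z))        ≡⟨ ∑-+ V _ _ ⟩
      # (X ∩ below j) + ∑ V (λ x → δ x z * bit (X z))              ≡⟨ cong (# (X ∩ below j) +_) (trans (∑-cong V λ x → *-comm (δ x z) _)
                                                                       (trans (∑-* V (bit (X z)) (λ x → δ x z)) (trans (cong (bit (X z) *_) (∑-δ z)) (*-identityʳ _)))) ⟩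
      # (X ∩ below j) + bit (X z)                                  ∎
      where
      open ≤-Reasoning
      z : Fin n
      z = fromℕ< j<n
      pointwise : ∀ x → bit (X x ∧ below (suc j) x) ≤ bit (X x ∧ below j x) + δ x z * bit (X z)
      pointwise x with x Fin.≟ z
      ... | yes refl = ≤-trans (bit-mono (λ e → proj₁ (∧-elim {X z} e))) (≤-trans (≤-reflexive (sym (+-identityʳ _))) (m≤n+m _ (bit (X z ∧ below j z))))
      ... | no x≢z = ≤-trans (bit-mono λ e → let p , q = ∧-elim {X x} e in ∧-intro p (<ᵇ-intro (smaller (<ᵇ-true {toℕ x} {suc j} q)))) (m≤m+n _ _)
        where
        smaller : toℕ x < suc j → toℕ x < j
        smaller lt with m≤n⇒m<n∨m≡n (s≤s⁻¹ lt)
        ... | inj₁ p = p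
        ... | inj₂ e = contradiction (toℕ-injective (trans e (sym (toℕ-fromℕ< j<n)))) x≢z

    below-mono : ∀ (X : Fin n → Bool) {j} → n ≤ j → # (X ∩ below (suc j)) ≤ # (X ∩ below j)
    below-mono X n≤j = #-mono λ x e → let p , _ = ∧-elim {X x} e in ∧-intro p (<ᵇ-intro (<-≤-trans (toℕ<n x) n≤j))

    #-below : ∀ (X : Fin n → Bool) j → # (X ∩ below j) ≤ j
    #-below X zero = ≤-trans (∑-mono V λ x → bit-mono {X x ∧ below 0 x} {false} λ e → contradiction (proj₂ (∧-elim {X x} e)) λ ())
      (≤-reflexive (trans (∑-const V 0) (*-zeroʳ (length (V {n})))))
    #-below X (suc j) with j <? n
    ... | yes j<n = ≤-trans (below-step X j<n) (≤-trans (+-mono-≤ (#-below X j) (bit≤1 _)) (≤-reflexive (+-comm j 1)))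
    ... | no j≮n = ≤-trans (below-mono X (≮⇒≥ j≮n)) (≤-trans (#-below X j) (n≤1+n j))

    rank : (Fin n → Bool) → Fin n → ℕ
    rank W x = # (W ∩ below (toℕ x))

    -- Scan the vertices by label. When a member `z` of `X` is reached, the earlier members of `X`
    -- are among those counted by `rank W z`, which is less than `c`; so adding `z` keeps the count
    -- at most `c`.
    rank-below : ∀ (W : Fin n → Bool) c → # (W ∩ (λ x → rank W x <ᵇ c)) ≤ c
    rank-below W c = ≤-trans (#-mono λ x e → ∧-intro e (<ᵇ-intro (toℕ<n x))) (go n)
      where
      X : Fin n → Bool
      X = W ∩ (λ x → rank W x <ᵇ c)
      go : ∀ j → # (X ∩ below j) ≤ c
      go zero = ≤-trans (#-below X 0) z≤n
      go (suc j) with j <? n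
      ... | no j≮n = ≤-trans (below-mono X (≮⇒≥ j≮n)) (go j)
      ... | yes j<n = by-membership (X z) refl
        where
        z : Fin n
        z = fromℕ< j<n
        by-membership : ∀ b → X z ≡ b → # (X ∩ below (suc j)) ≤ c
        by-membership false e = ≤-trans (below-step X j<n) (≤-trans (≤-reflexive (trans (cong (λ b → # (X ∩ below j) + bit b) e) (+-identityʳ _))) (go j))
        by-membership true  e = begin
          # (X ∩ below (suc j))         ≤⟨ below-step X j<n ⟩
          # (X ∩ below j) + bit (X z)   ≤⟨ +-mono-≤ (#-mono (λ x q → let p , r = ∧-elim {X x} q in
                                             ∧-intro (proj₁ (∧-elim {W x} p)) (subst (λ i → (toℕ x <ᵇ i) ≡ true) (sym (toℕ-fromℕ< j<n)) r))) (bit≤1 (X z)) ⟩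
          rank W z + 1                  ≡⟨ +-comm _ 1 ⟩
          suc (rank W z)                ≤⟨ <ᵇ-true {rank W z} (proj₂ (∧-elim {W z} e)) ⟩
          c                             ∎
          where open ≤-Reasoning

    ∑-δ-* : ∀ (l : List (Fin n)) v (f : Fin n → ℕ) → ∑ l (λ x → δ v x * f x) ≡ occ v l * f v
    ∑-δ-* []      v f = refl
    ∑-δ-* (x ∷ l) v f = trans (cong₂ _+_ (first x) (∑-δ-* l v f)) (sym (*-distribʳ-+ (f v) (δ v x) (occ v l)))
      where
      first : ∀ x → δ v x * f x ≡ δ v x * f v
      first x with v Fin.≟ x
      ... | yes refl = refl
      ... | no _     = refl

    ∑-∑-δ : ∀ (l : List (Fin n)) (f : Fin n → ℕ) → ∑ V (λ v → occ v l * f v) ≡ ∑ l f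
    ∑-∑-δ l f = begin
      ∑ V (λ v → occ v l * f v)                  ≡⟨ ∑-cong V (λ v → ∑-δ-* l v f) ⟨
      ∑ V (λ v → ∑ l (λ x → δ v x * f x))        ≡⟨ ∑-swap V l _ ⟩
      ∑ l (λ x → ∑ V (λ v → δ v x * f x))        ≡⟨ ∑-cong l (λ x → trans (∑-cong V λ v → *-comm (δ v x) (f x))
                                                      (trans (∑-* V (f x) (λ v → δ v x)) (trans (cong (f x *_) (∑-δ x)) (*-identityʳ _)))) ⟩
      ∑ l f                                      ∎
      where open ≡-Reasoning

    Split-loss : ∀ {W l W′} → Split {n} W l W′ → ∀ p → # (W ∩ p) ≤ # (W′ ∩ p) + ∑ l (bit ∘ p)
    Split-loss {W} {l} {W′} s p = begin
      # (W ∩ p)                                                    ≤⟨ ∑-mono V bound ⟩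
      ∑ V (λ v → bit (W′ v ∧ p v) + occ v l * bit (p v))           ≡⟨ ∑-+ V _ _ ⟩
      # (W′ ∩ p) + ∑ V (λ v → occ v l * bit (p v))                 ≡⟨ cong (# (W′ ∩ p) +_) (∑-∑-δ l (bit ∘ p)) ⟩
      # (W′ ∩ p) + ∑ l (bit ∘ p)                                   ∎
      where
      open ≤-Reasoning
      bound : ∀ v → bit (W v ∧ p v) ≤ bit (W′ v ∧ p v) + occ v l * bit (p v)
      bound v with p v | W v | W′ v | s .at v
      ... | false | false | _     | _ = z≤n
      ... | false | true  | _     | _ = z≤n
      ... | true  | false | _     | _ = z≤n
      ... | true  | true  | true  | _ = s≤s z≤n
      ... | true  | true  | false | e = ≤-reflexive (trans (sym e) (trans (+-identityʳ _) (sym (*-identityʳ _))))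

  floor : ∀ a m → 0 < m → ∃ λ v → v * m ≤ a × a < suc v * m
  floor a m@(suc _) _ = a / m , ≤-trans (m≤n+m _ (a % m)) (≤-reflexive (sym (m≡m%n+[m/n]*n a m))) ,
    subst (_< suc (a / m) * m) (sym (m≡m%n+[m/n]*n a m)) (+-monoˡ-< (a / m * m) (m%n<n a m))

  -- Densities s₀ / m₀ and s / m that differ by at most 1 / A transport Pósa's condition from m₀ to m.
  module Rescale (A S s₁ h₀ n m₀ m : ℕ) (0<A : 0 < A) (0<m : 0 < m) (0<m₀ : 0 < m₀) (slack : 4 * m₀ ≤ A * s₁) (A*S≤ : A * S ≤ 2 * m)
                 (m₀≤n : m₀ ≤ n) (n≤h₀ : n ≤ suc (h₀ + h₀)) (c h : ℕ) (c≤h : c ≤ h) (h+h≤m : h + h ≤ m) where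

    private
      0<Am : 0 < A * m
      0<Am = *-mono-≤ 0<A 0<m
      found : ∃ λ v → v * (A * m) ≤ A * c * m₀ ∸ m * m₀ × A * c * m₀ ∸ m * m₀ < suc v * (A * m)
      found = floor (A * c * m₀ ∸ m * m₀) (A * m) 0<Am

    -- The position in the old set that matches the density `c / m` lowered by `1 / A`, that is
    -- `m₀ (c / m − 1 / A)` rounded down. Truncated subtraction makes it 0 if this is negative.
    c₀ : ℕ
    c₀ = proj₁ found

    private
      instance
        nz : NonZero (A * m)
        nz = >-nonZero 0<Am

      upper : c₀ * (A * m) ≤ A * c * m₀ ∸ m * m₀
      upper = proj₁ (proj₂ found)

      lower : A * c * m₀ < suc c₀ * (A * m) + m * m₀
      lower = ≤-<-trans (≤-trans (m≤n+m∸n (A * c * m₀) (m * m₀)) (≤-reflexive (+-comm (m * m₀) _))) (+-monoˡ-< (m * m₀) (proj₂ (proj₂ found)))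

    c₀≤h₀ : c₀ ≤ h₀
    c₀≤h₀ = half (*-cancelʳ-≤ (c₀ + c₀) m₀ (A * m) (begin
      (c₀ + c₀) * (A * m)                  ≡⟨ *-distribʳ-+ (A * m) c₀ c₀ ⟩
      c₀ * (A * m) + c₀ * (A * m)          ≤⟨ +-mono-≤ below′ below′ ⟩
      A * c * m₀ + A * c * m₀              ≡⟨ collect A c m₀ ⟩
      (c + c) * (A * m₀)                   ≤⟨ *-monoˡ-≤ (A * m₀) (≤-trans (+-mono-≤ c≤h c≤h) h+h≤m) ⟩
      m * (A * m₀)                         ≡⟨ swap m A m₀ ⟩
      m₀ * (A * m)                         ∎)) m₀≤n n≤h₀
      where
      open ≤-Reasoning
      below′ : c₀ * (A * m) ≤ A * c * m₀
      below′ = ≤-trans upper (m∸n≤m (A * c * m₀) (m * m₀))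
      collect : ∀ a c m → a * c * m + a * c * m ≡ (c + c) * (a * m)
      collect = solve-∀
      swap : ∀ a b c → a * (b * c) ≡ c * (b * a)
      swap = solve-∀
      half : ∀ {c m n h} → c + c ≤ m → m ≤ n → n ≤ suc (h + h) → c ≤ h
      half {c} {m} {n} {h} h0 h1 h2 =
        certₘ 1 0 (h0 ⊕ h1 ⊕ h2) (solve (c ∷ m ∷ n ∷ h ∷ []))

    -- Meant for `X` the label of a vertex and `u₀`, `u` the sizes of the upper segment starting
    -- there, in the old and the new set. The share below the vertex in the old set is smaller than
    -- in the new one by at most `1 / A`.
    c₀≤ : ∀ {X u₀ u} → m₀ ≤ u₀ + X → c + u ≤ m → A * u₀ * m ≤ A * u * m₀ + m * m₀ → c₀ ≤ X
    c₀≤ {X} {u₀} {u} m₀≤ c≤ close = *-cancelʳ-≤ c₀ X (A * m) (≤-trans upper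
      (m≤n+o⇒m∸n≤o (A * c * m₀) (m * m₀) (arith A c u m₀ m u₀ X (*-monoʳ-≤ (A * m₀) c≤) (*-monoʳ-≤ (A * m) m₀≤) close)))
      where
      arith : ∀ A c u m₀ m u₀ X → A * m₀ * (c + u) ≤ A * m₀ * m → A * m * m₀ ≤ A * m * (u₀ + X) → A * u₀ * m ≤ A * u * m₀ + m * m₀ → A * c * m₀ ≤ m * m₀ + X * (A * m)
      arith A c u m₀ m u₀ X h0 h1 h2 =
        cert 0 (h0 ⊕ h1 ⊕ h2) (solve (A ∷ c ∷ u ∷ m₀ ∷ m ∷ u₀ ∷ X ∷ []))

    -- In densities, `d / m ≥ d₀ / m₀ − 1 / A ≥ c / m − 2 / A + s₁ /
    -- m₀`. By `slack` the last term is at least `4 / A`, which leaves a gain of `2 /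
    -- A`, and `A*S≤` bounds `S / m` by this. The `suc` before `s₁` absorbs the rounding in `c₀`.
    conclude : ∀ {d₀ d} → c₀ + suc s₁ ≤ d₀ → A * d₀ * m ≤ A * d * m₀ + m * m₀ → c + S ≤ d
    conclude {d₀} {d} big close = *-cancelʳ-≤ (c + S) d (A * m₀) {{>-nonZero (*-mono-≤ 0<A 0<m₀)}}
      (arith A c m₀ m c₀ d₀ d S s₁ lower (*-monoʳ-≤ (A * m) big) close (*-monoʳ-≤ m slack) (*-monoʳ-≤ m₀ A*S≤))
      where
      arith : ∀ A c m₀ m c₀ d₀ d S s₁ → A * c * m₀ < suc c₀ * (A * m) + m * m₀ → A * m * (c₀ + suc s₁) ≤ A * m * d₀ → A * d₀ * m ≤ A * d * m₀ + m * m₀ → m * (4 * m₀) ≤ m * (A * s₁) → m₀ * (A * S) ≤ m₀ * (2 * m) → (c + S) * (A * m₀) ≤ d * (A * m₀)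
      arith A c m₀ m c₀ d₀ d S s₁ h0 h1 h2 h3 h4 =
        cert 1 (h0 ⊕ h1 ⊕ h2 ⊕ h3 ⊕ h4) (solve (A ∷ c ∷ m₀ ∷ m ∷ c₀ ∷ d₀ ∷ d ∷ S ∷ s₁ ∷ []))

-- Inequalities for densities rounded to levels.

module LevelArithmetic where
  open Prelude
  open Certificates

  floor-close : ∀ A Q s₀ s m₀ m V₀ V drop → m * (Q * s₀) < m * (suc V₀ * m₀) → m₀ * (V * m) ≤ m₀ * (Q * s) → m * m₀ * V₀ ≤ m * m₀ * (V + drop) → Q * s₀ * m ≤ Q * s * m₀ + suc drop * (m * m₀)
  floor-close A Q s₀ s m₀ m V₀ V drop h0 h1 h2 =
    cert 1 (h0 ⊕ h1 ⊕ h2) (solve (A ∷ Q ∷ s₀ ∷ s ∷ m₀ ∷ m ∷ V₀ ∷ V ∷ drop ∷ []))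

  close-scale : ∀ A Q s₀ s m₀ m drop → A * (Q * s₀ * m) ≤ A * (Q * s * m₀ + suc drop * (m * m₀)) → A * suc drop * (m * m₀) ≤ Q * (m * m₀) → Q * (A * s₀ * m) ≤ Q * (A * s * m₀ + m * m₀)
  close-scale A Q s₀ s m₀ m drop h0 h1 =
    cert 0 (h0 ⊕ h1) (solve (A ∷ Q ∷ s₀ ∷ s ∷ m₀ ∷ m ∷ drop ∷ []))

  -- With `m = D + m′`, the density `s / m` turns into `s′ / m′` where `s′ ≥ s − c`. Divided by
  -- `m m′`, the claim bounds the fall of the level by `Q (m c − D s) / (m m′)`, plus 1 for
  -- rounding.
  level-step : ∀ Q D m′ s s′ c V V′ → m′ * (V * (D + m′)) ≤ m′ * (Q * s) → (D + m′) * (Q * s′) ≤ (D + m′) * (suc V′ * m′) → Q * (D + m′) * s ≤ Q * (D + m′) * (s′ + c) → V * ((D + m′) * m′) + Q * D * s ≤ Q * (D + m′) * c + suc V′ * ((D + m′) * m′)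
  level-step Q D m′ s s′ c V V′ h0 h1 h2 =
    cert 0 (h0 ⊕ h1 ⊕ h2) (solve (Q ∷ D ∷ m′ ∷ s ∷ s′ ∷ c ∷ V ∷ V′ ∷ []))

  level-drop : ∀ Q D m′ m s s′ c V V′ Γ → V * m ≤ Q * s → Q * s ≤ Q * (s′ + c) → Q * c ≤ Q * D → Q * s′ < suc V′ * m′ → suc V′ * m′ ≤ suc V′ * m → suc Q * D ≤ Γ * m → V * m < suc (V′ + Γ) * m
  level-drop Q D m′ m s s′ c V V′ Γ h0 h1 h2 h3 h4 h5 =
    cert D (h0 ⊕ h1 ⊕ h2 ⊕ h3 ⊕ h4 ⊕ h5) (solve (Q ∷ D ∷ m′ ∷ m ∷ s ∷ s′ ∷ c ∷ V ∷ V′ ∷ Γ ∷ []))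

  level-rise : ∀ Q D m′ s s′ V V′ Γ → V′ * m′ ≤ Q * s′ → Q * s′ ≤ Q * s → Q * s < suc V * (D + m′) → suc V * D ≤ suc Q * D → suc Q * D ≤ Γ * m′ → V′ * m′ < suc (V + Γ) * m′
  level-rise Q D m′ s s′ V V′ Γ h0 h1 h2 h3 h4 =
    cert 0 (h0 ⊕ h1 ⊕ h2 ⊕ h3 ⊕ h4) (solve (Q ∷ D ∷ m′ ∷ s ∷ s′ ∷ V ∷ V′ ∷ Γ ∷ []))

  cost-bound : ∀ m M D σ Lc Ω n S P C₂ → m * P ≤ M * S + suc (σ + σ) * P → suc (σ + σ) * P ≤ suc (σ + σ) * (M * Ω) → m * C₂ ≤ m * (Lc * Ω) → m * (Lc * Ω) ≤ n * (Lc * Ω) → M * S ≤ D * S → m * (P + C₂) ≤ D * S + (suc (σ + σ) * M + n * Lc) * Ω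
  cost-bound m M D σ Lc Ω n S P C₂ h0 h1 h2 h3 h4 =
    cert 0 (h0 ⊕ h1 ⊕ h2 ⊕ h3 ⊕ h4) (solve (m ∷ M ∷ D ∷ σ ∷ Lc ∷ Ω ∷ n ∷ S ∷ P ∷ C₂ ∷ []))

  mean-bound : ∀ Q D mm m E μ Ω V V′ S C → V * mm + Q * D * S ≤ Q * m * C + (V′ + Ω) * mm → Q * (m * C) ≤ Q * (D * S + E * Ω) → Q * E * Ω ≤ μ * mm * Ω → V * mm ≤ (V′ + (Ω + μ * Ω)) * mm
  mean-bound Q D mm m E μ Ω V V′ S C h0 h1 h2 =
    cert 0 (h0 ⊕ h1 ⊕ h2) (solve (Q ∷ D ∷ mm ∷ m ∷ E ∷ μ ∷ Ω ∷ V ∷ V′ ∷ S ∷ C ∷ []))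

  mean-gain : ∀ Γ μ Ω V V′ g → g + V′ ≡ Γ * Ω + V → V ≤ V′ + (Ω + μ * Ω) → g ≤ (Γ + suc μ) * Ω
  mean-gain Γ μ Ω V V′ g h0 h1 =
    cert 0 ((≤-reflexive h0) ⊕ h1) (solve (Γ ∷ μ ∷ Ω ∷ V ∷ V′ ∷ g ∷ []))

-- Covering almost all vertices while the tracked densities persist.

module Covering {n : ℕ} (H : 3Graph n) where
  open Prelude
  open Certificates
  open Counting
  open MultiplicativeWeights using (module Multiplicative)
  open Ranks
  open Quantile using (halve)
  open LevelArithmetic
  open Paths H
  open Connecting H
  open LightPaths H
  open Gadget H
  open Chains H
  open import Data.Fin using (Fin; toℕ)
  import Data.Fin as Fin
  open import Data.List.Membership.Propositional.Properties using (∈-cartesianProduct⁺)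

  private variable
    a b c d e f x y z v : Fin n
    h s : ℕ
    l l′ : List (Fin n)
    gs : List Gadget

  Index : Set
  Index = Fin n × Fin n

  -- The sets whose density is controlled: the neighbourhoods of pairs and, on the diagonal, the upper segments.
  tracked : Index → Fin n → Bool
  tracked (x , y) z = if does (x Fin.≟ y) then not (below (toℕ x) z) else edge H x y z

  tracked-≢ : x ≢ y → ∀ z → tracked (x , y) z ≡ edge H x y z
  tracked-≢ {x} {y} x≢y z with x Fin.≟ y
  ... | yes e = contradiction e x≢y
  ... | no _  = refl

  tracked-diagonal : ∀ x z → tracked (x , x) z ≡ not (below (toℕ x) z)
  tracked-diagonal x z with x Fin.≟ x
  ... | yes _  = refl
  ... | no x≢x = contradiction refl x≢x

  indices : List Index
  indices = cartesianProduct V V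

  ∈-indices : ∀ i → i ∈ indices
  ∈-indices (x , y) = ∈-cartesianProduct⁺ (∈-V x) (∈-V y)

  length-indices : length indices ≡ n * n
  length-indices = trans (sym (trans (∑-const indices 1) (*-identityʳ _))) (trans (∑-cartesianProduct V V (λ _ → 1))
    (trans (∑-cong V λ _ → trans (∑-const V 1) (trans (*-identityʳ _) length-V)) (trans (∑-const V n) (cong (_* n) length-V))))

  mass : (Fin n → Bool) → Index → ℕ
  mass W i = # (W ∩ tracked i)

  mass≤ : ∀ W i → mass W i ≤ # W
  mass≤ W i = #-mono λ z e → proj₁ (∧-elim {W z} e)

  #≤n : ∀ (W : Fin n → Bool) → # W ≤ n
  #≤n W = ≤-trans (∑-mono V (λ x → bit≤1 (W x))) (≤-reflexive (trans (∑-const V 1) (trans (*-identityʳ _) length-V)))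

  Posa-≤ : ∀ {W ρ t} → t ≤ s → Posa h s W ρ → Posa h t W ρ
  Posa-≤ {s} {h} {W} {ρ} {t} le P = Posa-weaken (s ∸ t) (subst (λ s → Posa h s W ρ) (sym (m∸n+n≡m le)) P)

  module _ {W₀ : Fin n → Bool} (A S s₁ h₀ : ℕ) (0<A : 0 < A) (P₀ : Posa h₀ (suc s₁) W₀ toℕ) (n≤h₀ : n ≤ suc (h₀ + h₀))
           (0<m₀ : 0 < # W₀) (slack : 4 * # W₀ ≤ A * s₁) where

    -- The condition is one-sided: densities may rise freely. The segment below a vertex must not
    -- gain share, which means that the segment above it must not lose any; for this reason upper
    -- segments are tracked.
    Close : (Fin n → Bool) → Set
    Close W = ∀ i → A * mass W₀ i * # W ≤ A * mass W i * # W₀ + # W * # W₀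

    Posa-rank : ∀ {W} → 0 < # W → A * S ≤ 2 * # W → Close W → ∃ λ h → h ≤ n × Posa h S W (rank W)
    Posa-rank {W} 0<m A*S≤ close = build (halve (# W))
      where
      build : (∃ λ h → # W ≤ suc (h + h) × h + h ≤ # W) → ∃ λ h → h ≤ n × Posa h S W (rank W)
      build (h , hi , lo) = h , ≤-trans (≤-trans (m≤m+n h h) lo) (#≤n W) , record { low = rank-below W ; size = hi ; deg = degree }
        where
        degree : ∀ {x y} → x ≢ y → ∀ c → c ≤ rank W x → c ≤ rank W y → c ≤ h → c + S ≤ # (W ∩ N x y)
        degree {x} {y} x≢y c cx cy ch =
          subst (c + S ≤_) (same W)
            (conclude {d₀ = mass W₀ (x , y)} (subst (c₀ + suc s₁ ≤_) (sym (same W₀))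
                (P₀ .deg x≢y c₀ (position x cx) (position y cy) c₀≤h₀)) (close (x , y)))
          where
          open Rescale A S s₁ h₀ n (# W₀) (# W) 0<A 0<m 0<m₀ slack A*S≤ (#≤n W₀) n≤h₀ c h ch lo
          same : ∀ W → mass W (x , y) ≡ # (W ∩ N x y)
          same W = ∑-cong V λ z → cong (λ b → bit (W z ∧ b)) (tracked-≢ x≢y z)
          upper-mass : ∀ W z → mass W (z , z) ≡ # (W ∩ (not ∘ below (toℕ z)))
          upper-mass W z = ∑-cong V λ y → cong (λ b → bit (W y ∧ b)) (tracked-diagonal z y)
          partition : ∀ W (p : Fin n → Bool) → # (W ∩ p) + # (W ∩ (not ∘ p)) ≡ # W
          partition W p = trans (sym (∑-+ V _ _)) (∑-cong V λ z → cells (W z) (p z))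
            where
            cells : ∀ w p → bit (w ∧ p) + bit (w ∧ not p) ≡ bit w
            cells true  true  = refl
            cells true  false = refl
            cells false _     = refl
          position : ∀ z → c ≤ rank W z → c₀ ≤ toℕ z
          position z cz = c₀≤ {toℕ z} {mass W₀ (z , z)} {mass W (z , z)}
            (≤-trans (≤-reflexive (sym (trans (cong (_+ rank W₀ z) (upper-mass W₀ z)) (trans (+-comm _ (rank W₀ z)) (partition W₀ (below (toℕ z)))))))
              (+-monoʳ-≤ (mass W₀ (z , z)) (#-below W₀ (toℕ z))))
            (≤-trans (+-monoˡ-≤ (mass W (z , z)) cz) (≤-reflexive (trans (cong (rank W z +_) (upper-mass W z)) (partition W (below (toℕ z))))))
            (close (z , z))

  record Setup (W₀ : Fin n → Bool) : Set where
    field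
      A Q σ′ τ s₁ h₀ Lc Sc Γ μ′ q mₑ L : ℕ
    σ : ℕ
    σ = suc σ′
    M : ℕ
    M = suc τ * 3
    D : ℕ
    D = M + Lc
    S : ℕ
    S = M + Sc
    G : ℕ
    G = suc (Γ + Γ)
    μ : ℕ
    μ = Γ + suc μ′
    -- The bound `(μ + 1) q + G G L` of the weights method less the offset `Γ q`: the number of
    -- levels, each of width `1 / Q`, that a density can lose in `q` rounds.
    drop : ℕ
    drop = (2 + μ′) * q + G * G * L
    field
      0<Q      : 0 < Q
      0<A      : 0 < A
      P₀       : Posa h₀ (suc s₁) W₀ toℕ
      n≤h₀     : n ≤ suc (h₀ + h₀)
      slack    : 4 * # W₀ ≤ A * s₁
      A*S≤     : A * S ≤ 2 * mₑ
      m₀≡      : # W₀ ≡ D * q + mₑ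
      A*drop≤Q : A * suc drop ≤ Q
      Q*D≤     : suc Q * D ≤ Γ * mₑ
      Q*E≤     : Q * (suc (σ + σ) * M + n * Lc) ≤ μ′ * (mₑ * mₑ)
      count    : (τ * 3 + 1) * (n * (n * M)) < σ′ * (σ′ * σ′)
      room     : suc (suc (σ + σ)) ≤ mₑ
      σ+σ≤S    : σ + σ ≤ S
      log      : n * n < 2 ^ L
      conn     : ∀ {h ρ} → h ≤ n → Connectable h Sc Lc ρ

  module PathGame {W₀ : Fin n → Bool} (setup : Setup W₀) {e f : Fin n} (gs : List Gadget) where
    open Setup setup

    private
      instance
        nzQ : NonZero Q
        nzQ = >-nonZero 0<Q

    open Multiplicative {I = Index} indices G (G * G) μ L ≤-refl (subst (_< 2 ^ L) (sym length-indices) log)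

    -- A level is a tracked density in units of `1 / Q`, rounded down, so that the game has integer
    -- scores.
    record Levels (W : Fin n → Bool) (lv : Index → ℕ) : Set where
      constructor levels
      field
        lower : ∀ i → lv i * # W ≤ Q * mass W i
        upper : ∀ i → Q * mass W i < suc (lv i) * # W
    open Levels

    Levels-exist : ∀ W → 0 < # W → ∃ (Levels W)
    Levels-exist W pos = (λ i → proj₁ (found i)) , levels (λ i → proj₁ (proj₂ (found i))) (λ i → proj₂ (proj₂ (found i)))
      where
      found : ∀ i → ∃ λ v → v * # W ≤ Q * mass W i × Q * mass W i < suc v * # W
      found i = floor (Q * mass W i) (# W) pos

    module _ (0<m₀ : 0 < # W₀) (lv₀ : Index → ℕ) (levels₀ : Levels W₀ lv₀) where

      -- The chain grows at its front `u₁ u₂` while its end `e f` stays fixed; as the list of a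
      -- chain omits the final pair, `e` and `f` are added in `used`. By `balance`, the score is the
      -- fall of the level plus `Γ` per round.
      record State (t : ℕ) (Y : Index → ℕ) : Set where
        field
          {now}    : Fin n → Bool
          {u₁ u₂}  : Fin n
          {body}   : List (Fin n)
          {level}  : Index → ℕ
          chain    : Chain u₁ u₂ gs body e f
          u₁≢u₂    : u₁ ≢ u₂
          used     : Split everything (e ∷ f ∷ body) now
          left     : # now + D * t ≡ # W₀
          lvs      : Levels now level
          balance  : ∀ i → Y i + level i ≡ Γ * t + lv₀ i

      Bound : ℕ → (Index → ℕ) → Set
      Bound t Y = ∀ {i} → i ∈ indices → Y i < suc μ * t + G * G * L

      private
        0<mₑ : 0 < mₑ
        0<mₑ = ≤-trans (s≤s z≤n) room

        State⇒Close : ∀ {t Y} → t ≤ q → (st : State t Y) → Bound t Y → Close A S s₁ h₀ 0<A P₀ n≤h₀ 0<m₀ slack (State.now st)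
        State⇒Close {t} {Y} t≤q st bound i = *-cancelˡ-≤ Q (close-scale A Q (mass W₀ i) (mass now i) (# W₀) (# now) drop
          (*-monoʳ-≤ A (floor-close A Q (mass W₀ i) (mass now i) (# W₀) (# now) (lv₀ i) (level i) drop
            (*-monoʳ-< (# now) {{>-nonZero 0<m}} (levels₀ .upper i)) (*-monoʳ-≤ (# W₀) (lvs .lower i)) (*-monoʳ-≤ (# now * # W₀) close-levels)))
          (*-monoˡ-≤ (# now * # W₀) A*drop≤Q))
          where
          open State st
          few : ∀ y v v₀ Γ t m l q → y + v ≡ Γ * t + v₀ → y < suc (Γ + suc m) * t + l → (2 + m) * t ≤ (2 + m) * q → v₀ ≤ v + ((2 + m) * q + l)
          few y v v₀ Γ t m l q h0 h1 h2 =
            cert 1 ((≤-reflexive (sym h0)) ⊕ h1 ⊕ h2) (solve (y ∷ v ∷ v₀ ∷ Γ ∷ t ∷ m ∷ l ∷ q ∷ []))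
          remaining : ∀ {m d t q e m₀} → m + d * t ≡ m₀ → m₀ ≡ d * q + e → d * t ≤ d * q → e ≤ m
          remaining {m} {d} {t} {q} {e} {m₀} h0 h1 h2 =
            cert 0 ((≤-reflexive (sym h0)) ⊕ (≤-reflexive (sym h1)) ⊕ h2) (solve (m ∷ d ∷ t ∷ q ∷ e ∷ m₀ ∷ []))
          0<m : 0 < # now
          0<m = ≤-trans 0<mₑ (remaining {d = D} {t} {q} left m₀≡ (*-monoʳ-≤ D t≤q))
          close-levels : lv₀ i ≤ level i + drop
          close-levels = few (Y i) (level i) (lv₀ i) Γ t μ′ (G * G * L) q (balance i) (bound (∈-indices i)) (*-monoʳ-≤ (2 + μ′) t≤q)

      record Transition (ω : Index → ℕ) : Set where
        field
          {W W₁ W₂} : Fin n → Bool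
          {p l₂}    : List (Fin n)
          {lv lv′}  : Index → ℕ
          lvs       : Levels W lv
          lvs′      : Levels W₂ lv′
          sp        : Split W p W₁
          sp₂       : Split W₁ l₂ W₂
          len       : length p ≡ M
          len₂      : length l₂ ≡ Lc
          large     : mₑ + D ≤ # W
        w : Fin n → ℕ
        w z = ∑ indices (λ i → ω i * bit (tracked i z))
        field
          cheap : # W * ∑ p w ≤ M * ∑ V (λ z → bit (W z) * w z) + suc (σ + σ) * ∑ p w

      module Step {ω : Index → ℕ} (transition : Transition ω) where
        open Transition transition

        r : List (Fin n)
        r = p ++ l₂
        sp′ : Split W r W₂
        sp′ = Split-++ sp sp₂
        len-r : length r ≡ D
        len-r = trans (length-++ p) (cong₂ _+_ len len₂)
        m≡ : D + # W₂ ≡ # W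
        m≡ = trans (cong (_+ # W₂) (sym len-r)) (Split-# sp′)
        mₑ≤m′ : mₑ ≤ # W₂
        mₑ≤m′ = +-cancelˡ-≤ D _ _ (≤-trans (≤-reflexive (+-comm D mₑ)) (≤-trans large (≤-reflexive (sym m≡))))
        mₑ≤m : mₑ ≤ # W
        mₑ≤m = ≤-trans (m≤m+n mₑ D) large
        0<m′ : 0 < # W₂
        0<m′ = ≤-trans 0<mₑ mₑ≤m′
        loss : Index → ℕ
        loss i = ∑ r (bit ∘ tracked i)
        lost : ∀ i → mass W i ≤ mass W₂ i + loss i
        lost i = Split-loss sp′ (tracked i)
        loss≤ : ∀ i → loss i ≤ D
        loss≤ i = ≤-trans (∑-mono r (λ z → bit≤1 (tracked i z))) (≤-reflexive (trans (∑-const r 1) (trans (*-identityʳ _) len-r)))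
        instance
          nz : NonZero (# W₂)
          nz = >-nonZero 0<m′
          nz′ : NonZero (# W)
          nz′ = >-nonZero (≤-trans 0<mₑ mₑ≤m)

        lv≤ : ∀ i → lv i ≤ lv′ i + Γ
        lv≤ i = s≤s⁻¹ (*-cancelʳ-< (# W) (lv i) (suc (lv′ i + Γ)) (level-drop Q D (# W₂) (# W) (mass W i) (mass W₂ i) (loss i) (lv i) (lv′ i) Γ
          (lvs .lower i) (*-monoʳ-≤ Q (lost i)) (*-monoʳ-≤ Q (loss≤ i)) (lvs′ .upper i)
          (*-monoʳ-≤ (suc (lv′ i)) (≤-trans (m≤n+m (# W₂) D) (≤-reflexive m≡))) (≤-trans Q*D≤ (*-monoʳ-≤ Γ mₑ≤m))))

        lv′≤ : ∀ i → lv′ i ≤ lv i + Γ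
        lv′≤ i = s≤s⁻¹ (*-cancelʳ-< (# W₂) (lv′ i) (suc (lv i + Γ)) (level-rise Q D (# W₂) (mass W i) (mass W₂ i) (lv i) (lv′ i) Γ
          (lvs′ .lower i) (*-monoʳ-≤ Q (Split-#⊆ sp′ (tracked i)))
          (subst (λ m → Q * mass W i < suc (lv i) * m) (sym m≡) (lvs .upper i))
          (*-monoˡ-≤ D (s≤s (*-cancelʳ-≤ (lv i) Q (# W) (≤-trans (lvs .lower i) (*-monoʳ-≤ Q (mass≤ W i))))))
          (≤-trans Q*D≤ (*-monoʳ-≤ Γ mₑ≤m′))))

        Ω : ℕ
        Ω = ∑ indices ω
        w≤Ω : ∀ z → w z ≤ Ω
        w≤Ω z = ∑-mono indices λ i → ≤-trans (*-monoʳ-≤ (ω i) (bit≤1 _)) (≤-reflexive (*-identityʳ _))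
        list-weight : ∀ k → ∑ indices (λ i → ω i * ∑ k (bit ∘ tracked i)) ≡ ∑ k w
        list-weight k = trans (∑-cong indices λ i → sym (∑-* k (ω i) (bit ∘ tracked i))) (∑-swap indices k _)
        ∑w≤ : ∀ k → ∑ k w ≤ length k * Ω
        ∑w≤ k = ≤-trans (∑-mono k w≤Ω) (≤-reflexive (∑-const k Ω))
        set-weight : ∑ V (λ z → bit (W z) * w z) ≡ ∑ indices (λ i → ω i * mass W i)
        set-weight = begin
          ∑ V (λ z → bit (W z) * w z)                                          ≡⟨ ∑-cong V (λ z → ∑-* indices (bit (W z)) _) ⟨
          ∑ V (λ z → ∑ indices (λ i → bit (W z) * (ω i * bit (tracked i z))))  ≡⟨ ∑-swap V indices _ ⟩
          ∑ indices (λ i → ∑ V (λ z → bit (W z) * (ω i * bit (tracked i z))))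
            ≡⟨ ∑-cong indices (λ i → trans (∑-cong V λ z → move (W z) (tracked i z) (ω i)) (∑-* V (ω i) _)) ⟩
          ∑ indices (λ i → ω i * mass W i)                                     ∎
          where
          open ≡-Reasoning
          move : ∀ a b o → bit a * (o * bit b) ≡ o * bit (a ∧ b)
          move true  b o = +-identityʳ _
          move false b o = sym (*-zeroʳ o)

        ΣC ΣS ΣV ΣV′ : ℕ
        ΣC = ∑ indices (λ i → ω i * loss i)
        ΣS = ∑ indices (λ i → ω i * mass W i)
        ΣV = ∑ indices (λ i → ω i * lv i)
        ΣV′ = ∑ indices (λ i → ω i * lv′ i)

        ΣC≡ : ΣC ≡ ∑ p w + ∑ l₂ w
        ΣC≡ = trans (list-weight r) (∑-++ p l₂ w)

        E₀ : ℕ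
        E₀ = suc (σ + σ) * M + n * Lc

        -- The `M` vertices of the light path weigh on average hardly more than those of `W`. The
        -- `Lc` connecting vertices are only known to weigh at most `Ω` each; they account for the
        -- second summand of `E₀`.
        costs : # W * ΣC ≤ D * ΣS + E₀ * Ω
        costs = subst (λ c → # W * c ≤ D * ΣS + E₀ * Ω) (sym ΣC≡)
          (cost-bound (# W) M D σ Lc Ω n ΣS (∑ p w) (∑ l₂ w)
            (subst (λ s → # W * ∑ p w ≤ M * s + suc (σ + σ) * ∑ p w) set-weight cheap)
            (*-monoʳ-≤ (suc (σ + σ)) (≤-trans (∑w≤ p) (≤-reflexive (cong (_* Ω) len))))
            (*-monoʳ-≤ (# W) (≤-trans (∑w≤ l₂) (≤-reflexive (cong (_* Ω) len₂))))
            (*-monoˡ-≤ (Lc * Ω) (#≤n W)) (*-monoˡ-≤ ΣS (m≤m+n M Lc)))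

        mm : ℕ
        mm = (D + # W₂) * # W₂

        sum-step : ΣV * mm + Q * D * ΣS ≤ Q * # W * ΣC + (ΣV′ + Ω) * mm
        sum-step = begin
          ΣV * mm + Q * D * ΣS
            ≡⟨ cong₂ _+_ (trans (*-comm ΣV mm) (sym (∑-* indices mm _))) (sym (∑-* indices (Q * D) _)) ⟩
          ∑ indices (λ i → mm * (ω i * lv i)) + ∑ indices (λ i → Q * D * (ω i * mass W i))
            ≡⟨ ∑-+ indices _ _ ⟨
          ∑ indices (λ i → mm * (ω i * lv i) + Q * D * (ω i * mass W i))
            ≤⟨ ∑-mono indices pointwise ⟩
          ∑ indices (λ i → Q * # W * (ω i * loss i) + (mm * (ω i * lv′ i) + mm * ω i))
            ≡⟨ trans (∑-+ indices _ _) (cong₂ _+_ (∑-* indices (Q * # W) _) (trans (∑-+ indices _ _) (cong₂ _+_ (∑-* indices mm _) (∑-* indices mm ω)))) ⟩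
          Q * # W * ΣC + (mm * ΣV′ + mm * Ω)
            ≡⟨ cong (Q * # W * ΣC +_) (collect mm ΣV′ Ω) ⟩
          Q * # W * ΣC + (ΣV′ + Ω) * mm ∎
          where
          open ≤-Reasoning
          collect : ∀ m a b → m * a + m * b ≡ (a + b) * m
          collect = solve-∀
          into : ∀ m o v q s → m * (o * v) + q * (o * s) ≡ o * (v * m + q * s)
          into = solve-∀
          out : ∀ q o c v m → o * (q * c + suc v * m) ≡ q * (o * c) + (m * (o * v) + m * o)
          out = solve-∀
          pointwise : ∀ i → mm * (ω i * lv i) + Q * D * (ω i * mass W i) ≤ Q * # W * (ω i * loss i) + (mm * (ω i * lv′ i) + mm * ω i)
          pointwise i = begin
            mm * (ω i * lv i) + Q * D * (ω i * mass W i)  ≡⟨ into mm (ω i) (lv i) (Q * D) (mass W i) ⟩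
            ω i * (lv i * mm + Q * D * mass W i)
              ≤⟨ *-monoʳ-≤ (ω i) (level-step Q D (# W₂) (mass W i) (mass W₂ i) (loss i) (lv i) (lv′ i)
                   (*-monoʳ-≤ (# W₂) (subst (λ m → lv i * m ≤ Q * mass W i) (sym m≡) (lvs .lower i)))
                   (*-monoʳ-≤ (D + # W₂) (<⇒≤ (lvs′ .upper i))) (*-monoʳ-≤ (Q * (D + # W₂)) (lost i))) ⟩
            ω i * (Q * (D + # W₂) * loss i + suc (lv′ i) * mm)
              ≡⟨ cong (λ m → ω i * (Q * m * loss i + suc (lv′ i) * mm)) m≡ ⟩
            ω i * (Q * # W * loss i + suc (lv′ i) * mm)   ≡⟨ out (Q * # W) (ω i) (loss i) (lv′ i) mm ⟩
            Q * # W * (ω i * loss i) + (mm * (ω i * lv′ i) + mm * ω i) ∎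

        -- On average the removed vertices take no more than the fair share `D * ΣS` from the
        -- tracked sets, up to the error `E₀`. That error costs `μ′` levels, and rounding costs one
        -- more.
        means : ΣV ≤ ΣV′ + (Ω + μ′ * Ω)
        means = *-cancelʳ-≤ ΣV (ΣV′ + (Ω + μ′ * Ω)) mm {{m*n≢0 (D + # W₂) (# W₂) {{subst NonZero (sym m≡) nz′}}}}
          (mean-bound Q D mm (# W) E₀ μ′ Ω ΣV ΣV′ ΣS ΣC sum-step (*-monoʳ-≤ Q costs)
            (*-monoˡ-≤ Ω (≤-trans Q*E≤ (*-monoʳ-≤ μ′ (*-mono-≤ (≤-trans mₑ≤m (≤-reflexive (sym m≡))) mₑ≤m′)))))

        -- The fall of the level, shifted by `Γ` so that it is a natural number also when the
        -- density rises.
        g : Index → ℕ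
        g i = (Γ + lv i) ∸ lv′ i
        g+lv′ : ∀ i → g i + lv′ i ≡ Γ + lv i
        g+lv′ i = m∸n+n≡m (≤-trans (lv′≤ i) (≤-reflexive (+-comm (lv i) Γ)))
        g≤G : ∀ i → g i ≤ G
        g≤G i = m≤n⇒m≤1+n (m≤n+o⇒m∸n≤o (Γ + lv i) (lv′ i) (≤-trans (+-monoʳ-≤ Γ (lv≤ i)) (≤-reflexive (move Γ (lv′ i)))))
          where
          move : ∀ a b → a + (b + a) ≡ b + (a + a)
          move = solve-∀
        gains : ∑ indices (λ i → ω i * g i) ≤ μ * Ω
        gains = mean-gain Γ μ′ Ω ΣV ΣV′ _ total means
          where
          total : ∑ indices (λ i → ω i * g i) + ΣV′ ≡ Γ * Ω + ΣV
          total = trans (sym (∑-+ indices _ _)) (trans (∑-cong indices λ i →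
              trans (sym (*-distribˡ-+ (ω i) (g i) (lv′ i))) (trans (cong (ω i *_) (g+lv′ i)) (trans (*-distribˡ-+ (ω i) Γ (lv i)) (cong (_+ ω i * lv i) (*-comm (ω i) Γ)))))
            (trans (∑-+ indices _ _) (cong (_+ ΣV) (∑-* indices Γ ω))))

      chain-count : ∀ p L₂ l₂ l a b v → occ v L₂ ≡ occ v (a ∷ b ∷ l₂) →
                    occ v (e ∷ f ∷ (p ++ (L₂ ++ l))) ≡ occ v ((e ∷ f ∷ l) ++ ((a ∷ b ∷ p) ++ l₂))
      chain-count p L₂ l₂ l a b v o = begin
        δ v e + (δ v f + occ v (p ++ (L₂ ++ l)))
          ≡⟨ cong (λ t → δ v e + (δ v f + t)) (trans (∑-++ p (L₂ ++ l) (δ v)) (cong (occ v p +_) (trans (∑-++ L₂ l (δ v)) (cong (_+ occ v l) o)))) ⟩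
        δ v e + (δ v f + (occ v p + (δ v a + (δ v b + occ v l₂) + occ v l)))
          ≡⟨ shuffle (δ v e) (δ v f) (occ v p) (δ v a) (δ v b) (occ v l₂) (occ v l) ⟩
        δ v e + (δ v f + occ v l) + (δ v a + (δ v b + occ v p) + occ v l₂)
          ≡⟨ cong (occ v (e ∷ f ∷ l) +_) (∑-++ (a ∷ b ∷ p) l₂ (δ v)) ⟨
        occ v (e ∷ f ∷ l) + occ v ((a ∷ b ∷ p) ++ l₂)
          ≡⟨ ∑-++ (e ∷ f ∷ l) _ (δ v) ⟨
        occ v ((e ∷ f ∷ l) ++ ((a ∷ b ∷ p) ++ l₂)) ∎
        where
        open ≡-Reasoning
        shuffle : ∀ e f p a b m l → e + (f + (p + (a + (b + m) + l))) ≡ e + (f + l) + (a + (b + p) + m)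
        shuffle = solve-∀

      large-arith : ∀ {m d t q e m₀} → m + d * t ≡ m₀ → m₀ ≡ d * q + e → d * suc t ≤ d * q → e + d ≤ m
      large-arith {m} {d} {t} {q} {e} {m₀} h0 h1 h2 =
        cert 0 ((≤-reflexive (sym h0)) ⊕ (≤-reflexive (sym h1)) ⊕ h2) (solve (m ∷ d ∷ t ∷ q ∷ e ∷ m₀ ∷ []))
      left-arith : ∀ {m} d {t m₀ m′} → m + d * t ≡ m₀ → d + m′ ≡ m → m′ + d * suc t ≤ m₀
      left-arith {m} d {t} {m₀} {m′} h0 h1 =
        cert 0 ((≤-reflexive h0) ⊕ (≤-reflexive h1)) (solve (m ∷ d ∷ t ∷ m₀ ∷ m′ ∷ []))
      left-arith′ : ∀ {m} d {t m₀ m′} → m + d * t ≡ m₀ → d + m′ ≡ m → m₀ ≤ m′ + d * suc t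
      left-arith′ {m} d {t} {m₀} {m′} h0 h1 =
        cert 0 ((≤-reflexive (sym h0)) ⊕ (≤-reflexive (sym h1))) (solve (m ∷ d ∷ t ∷ m₀ ∷ m′ ∷ []))

      Next : ℕ → (Index → ℕ) → (Index → ℕ) → Set
      Next t Y ω = ∃ λ (g : Index → ℕ) → (∀ i → g i ≤ G) × ∑ indices (λ i → ω i * g i) ≤ μ * ∑ indices ω × State (suc t) (λ i → Y i + g i)

      -- Pósa's condition is not carried from round to round but derived afresh from the densities,
      -- relative to the current size. Thus the vertices removed so far do not use up the slack `S`.
      move : ∀ t Y → t < q → State t Y → Bound t Y → ∀ ω → Next t Y ω
      move t Y t<q st bound ω = with-posa
        (Posa-rank A S s₁ h₀ 0<A P₀ n≤h₀ 0<m₀ slack 0<m (≤-trans A*S≤ (*-monoʳ-≤ 2 mₑ≤m)) (State⇒Close (<⇒≤ t<q) st bound))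
        where
        open State st
        large : mₑ + D ≤ # now
        large = large-arith {d = D} {t} {q} left m₀≡ (*-monoʳ-≤ D t<q)
        mₑ≤m : mₑ ≤ # now
        mₑ≤m = ≤-trans (m≤m+n mₑ D) large
        0<m : 0 < # now
        0<m = ≤-trans 0<mₑ mₑ≤m
        w : Fin n → ℕ
        w z = ∑ indices (λ i → ω i * bit (tracked i z))
        with-posa : (∃ λ h → h ≤ n × Posa h S now (rank now)) → Next t Y ω
        with-posa (h , h≤n , P) = with-path (lightPath w σ′ τ (Posa-≤ σ+σ≤S P)
            (≤-<-trans (*-monoʳ-≤ (τ * 3 + 1) (*-mono-≤ (#≤n now) (*-monoˡ-≤ M (#≤n now)))) count) (≤-trans room mₑ≤m))
          where
          with-path : LightPath now w σ τ → Next t Y ω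
          with-path (u , v , p , a , b , W₁ , path , u≢v , a≢b , sp , len , light) =
            with-connection (conn h≤n (Posa-split sp M (≤-reflexive len-p) P) a≢b u₁≢u₂)
            where
            len-p : 2 + length p ≡ M
            len-p = cong (2 +_) (trans len (+-comm (τ * 3) 1))
            with-connection : Connection Lc W₁ a b u₁ u₂ → Next t Y ω
            with-connection (l₂ , L₂ , W₂ , path₂ , o , sp₂ , len₂) = with-levels (Levels-exist W₂ 0<m′)
              where
              0<m′ : 0 < # W₂
              0<m′ = ≤-trans 0<mₑ (+-cancelˡ-≤ D _ _ (≤-trans (≤-reflexive (+-comm D mₑ)) (≤-trans large (≤-reflexive (sym
                (trans (cong (_+ # W₂) (sym (trans (length-++ (a ∷ b ∷ p)) (cong₂ _+_ len-p len₂)))) (Split-# (Split-++ sp sp₂))))))))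
              with-levels : ∃ (Levels W₂) → Next t Y ω
              with-levels (lv′ , lvs′) = g , g≤G , gains , record
                { chain   = prepend path (prepend path₂ chain)
                ; u₁≢u₂   = u≢v
                ; used    = Split-resp (λ z → chain-count p L₂ l₂ body a b z (o z)) (Split-++ used sp′)
                ; left    = ≤-antisym (left-arith D {t = t} left m≡) (left-arith′ D {t = t} left m≡)
                ; lvs     = lvs′
                ; balance = λ i → trans (+-assoc (Y i) (g i) (lv′ i)) (trans (cong (Y i +_) (g+lv′ i))
                              (trans (shuffle (Y i) Γ (level i)) (trans (cong (Γ +_) (balance i)) (collect Γ t (lv₀ i)))))
                }
                where
                transition : Transition ω
                transition = record
                  { lvs = lvs ; lvs′ = lvs′ ; sp = sp ; sp₂ = sp₂ ; len = len-p ; len₂ = len₂ ; large = large ; cheap = light }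
                open Step transition
                shuffle : ∀ y g v → y + (g + v) ≡ g + (y + v)
                shuffle = solve-∀
                collect : ∀ g t v → g + (g * t + v) ≡ g * suc t + v
                collect = solve-∀

      Closed : Set
      Closed = ∃ λ x → ∃ λ y → ∃ λ l → ∃ λ W → Chain x y gs l x y × Split everything l W × # W ≤ mₑ

      -- The densities yield Pósa's condition once more, and a last connection leads from the fixed
      -- end `e f` to the front.
      close-up : e ≢ f → (∃ λ Y → State q Y × Bound q Y) → Closed
      close-up e≢f (Y , st , bound) = with-posa
        (Posa-rank A S s₁ h₀ 0<A P₀ n≤h₀ 0<m₀ slack 0<m (≤-trans A*S≤ (≤-reflexive (cong (2 *_) (sym m≡)))) (State⇒Close ≤-refl st bound))
        where
        open State st
        end₁ : ∀ {m d q e m₀} → m + d * q ≡ m₀ → m₀ ≡ d * q + e → m ≤ e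
        end₁ {m} {d} {q} {e} {m₀} h0 h1 =
          cert 0 ((≤-reflexive h0) ⊕ (≤-reflexive h1)) (solve (m ∷ d ∷ q ∷ e ∷ m₀ ∷ []))
        end₂ : ∀ {m d q e m₀} → m + d * q ≡ m₀ → m₀ ≡ d * q + e → e ≤ m
        end₂ {m} {d} {q} {e} {m₀} h0 h1 =
          cert 0 ((≤-reflexive (sym h0)) ⊕ (≤-reflexive (sym h1))) (solve (m ∷ d ∷ q ∷ e ∷ m₀ ∷ []))
        m≡ : # now ≡ mₑ
        m≡ = ≤-antisym (end₁ {d = D} {q} left m₀≡) (end₂ {d = D} {q} left m₀≡)
        0<m : 0 < # now
        0<m = subst (0 <_) (sym m≡) 0<mₑ
        with-posa : (∃ λ h → h ≤ n × Posa h S now (rank now)) → Closed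
        with-posa (h , h≤n , P) = with-connection (conn h≤n (Posa-weaken M P) e≢f u₁≢u₂)
          where
          with-connection : Connection Lc now e f u₁ u₂ → Closed
          with-connection (l₂ , L₂ , W₂ , path₂ , o , sp₂ , len₂) =
            u₁ , u₂ , body ++ L₂ , W₂ , append chain path₂ , Split-resp tally (Split-++ used sp₂) ,
            ≤-trans (m≤n+m (# W₂) (length l₂)) (≤-reflexive (trans (Split-# sp₂) m≡))
            where
            shuffle : ∀ b e f m → b + (e + (f + m)) ≡ e + (f + b) + m
            shuffle = solve-∀
            tally : ∀ v → occ v (body ++ L₂) ≡ occ v ((e ∷ f ∷ body) ++ l₂)
            tally v = trans (∑-++ body L₂ (δ v)) (trans (cong (occ v body +_) (o v))
              (trans (shuffle (occ v body) (δ v e) (δ v f) (occ v l₂)) (sym (∑-++ (e ∷ f ∷ body) l₂ (δ v)))))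

    closed-chain : ∀ {x y l} → Chain x y gs l e f → x ≢ y → e ≢ f → Split everything (e ∷ f ∷ l) W₀ → (0<m₀ : 0 < # W₀) →
                   ∃ λ x → ∃ λ y → ∃ λ l → ∃ λ W → Chain x y gs l x y × Split everything l W × # W ≤ mₑ
    closed-chain {x} {y} {l} ch x≢y e≢f sp 0<m₀ = start (Levels-exist W₀ 0<m₀)
      where
      start : ∃ (Levels W₀) → ∃ λ x → ∃ λ y → ∃ λ l → ∃ λ W → Chain x y gs l x y × Split everything l W × # W ≤ mₑ
      start (lv₀ , levels₀) = close-up 0<m₀ lv₀ levels₀ e≢f (outcome (State 0<m₀ lv₀ levels₀) q (move 0<m₀ lv₀ levels₀) (record
        { chain = ch ; u₁≢u₂ = x≢y ; used = sp ; left = trans (cong (# W₀ +_) (*-zeroʳ D)) (+-identityʳ _) ; lvs = levels₀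
        ; balance = λ i → cong (_+ lv₀ i) (sym (*-zeroʳ Γ)) }))

-- From closed tight walks to Hamiltonian cycles.

module Cycles where
  open Prelude
  open Counting
  open import Data.Nat.DivMod using (_%_; _mod_; m%n<n; m<n⇒m%n≡m; [m+n]%n≡m%n; n%n≡0)
  open import Data.Fin using (Fin; toℕ; fromℕ<)
  open import Data.Fin.Properties using (toℕ-fromℕ<; toℕ-injective; toℕ<n)
  import Data.Fin as Fin
  open import Data.Fin.Permutation using (permutation)

  nth : ∀ {A : Set} → A → List A → ℕ → A
  nth z []      i       = z
  nth z (x ∷ l) zero    = x
  nth z (x ∷ l) (suc i) = nth z l i

  nth-++ˡ : ∀ {A : Set} {z : A} l {r i} → i < length l → nth z (l ++ r) i ≡ nth z l i
  nth-++ˡ (x ∷ l) {i = zero}  _  = refl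
  nth-++ˡ (x ∷ l) {i = suc i} lt = nth-++ˡ l (s≤s⁻¹ lt)

  nth-++ʳ : ∀ {A : Set} {z : A} l {r} i → nth z (l ++ r) (i + length l) ≡ nth z r i
  nth-++ʳ {z = z} [] {r} i = cong (nth z r) (+-identityʳ i)
  nth-++ʳ {z = z} (x ∷ l) {r} i = trans (cong (nth z (x ∷ l ++ r)) (+-suc i (length l))) (nth-++ʳ l i)

  module _ {n : ℕ} where

    occ-nth : ∀ {z : Fin n} l {i} → i < length l → 0 < occ (nth z l i) l
    occ-nth (x ∷ l) {zero}  _  = subst (λ t → 0 < t + occ x l) (sym (δ-refl x)) (s≤s z≤n)
    occ-nth {z} (x ∷ l) {suc i} lt = ≤-trans (occ-nth l (s≤s⁻¹ lt)) (m≤n+m _ (δ (nth z l i) x))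

    nth-injective : ∀ {z : Fin n} l → (∀ v → occ v l ≤ 1) → ∀ {i j} → i < length l → j < length l → nth z l i ≡ nth z l j → i ≡ j
    nth-injective (x ∷ l) once {zero}  {zero}  _  _  e = refl
    nth-injective {z} (x ∷ l) once {zero}  {suc j} _  lt e = contradiction (once x)
      (<⇒≱ (subst (λ t → 1 < t + occ x l) (sym (δ-refl x)) (s≤s (subst (λ y → 0 < occ y l) (sym e) (occ-nth l (s≤s⁻¹ lt))))))
    nth-injective {z} (x ∷ l) once {suc i} {zero}  lt _  e = contradiction (once x)
      (<⇒≱ (subst (λ t → 1 < t + occ x l) (sym (δ-refl x)) (s≤s (subst (λ y → 0 < occ y l) e (occ-nth l (s≤s⁻¹ lt))))))
    nth-injective (x ∷ l) once {suc i} {suc j} li lj e =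
      cong suc (nth-injective l (λ v → ≤-trans (m≤n+m _ (δ v x)) (once v)) (s≤s⁻¹ li) (s≤s⁻¹ lj) e)

    position : ∀ (z : Fin n) l v → 0 < occ v l → ∃ λ i → i < length l × nth z l i ≡ v
    position z (x ∷ l) v pos with v Fin.≟ x
    ... | yes refl = 0 , s≤s z≤n , refl
    ... | no _     = let i , lt , e = position z l v pos in suc i , s≤s lt , e

  module _ {m : ℕ} (H : 3Graph (suc m)) (4≤n : 4 ≤ suc m) where
    open Paths H
    private n = suc m

    module _ {z : Fin n} where

      nth-start : ∀ {a b l c d} → Path a b l c d → nth z (l ++ c ∷ d ∷ []) 0 ≡ a × nth z (l ++ c ∷ d ∷ []) 1 ≡ b
      nth-start []      = refl , refl
      nth-start (e ∷ p) = refl , proj₁ (nth-start p)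

      nth-edge : ∀ {a b l c d} → Path a b l c d → ∀ {i} → i < length l →
                 E (nth z (l ++ c ∷ d ∷ []) i) (nth z (l ++ c ∷ d ∷ []) (suc i)) (nth z (l ++ c ∷ d ∷ []) (suc (suc i)))
      nth-edge (_∷_ {a = a} e p) {zero}  _  = let s₀ , s₁ = nth-start p in
        subst₂ (E a) (sym s₀) (sym s₁) e
      nth-edge (e ∷ p) {suc i} lt = nth-edge p (s≤s⁻¹ lt)

    closed-path⇒hamiltonian : ∀ {a b l} → Path a b l a b → (∀ v → occ v l ≡ 1) → TightHamCycle H
    closed-path⇒hamiltonian {a} {b} {l} path once = 4≤n , permutation f g f∘g g∘f , edges
      where
      len : length l ≡ n
      len = trans (sym (∑-occ l)) (trans (∑-cong V once) (trans (∑-const V 1) (trans (*-identityʳ _) length-V)))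
      entry : ℕ → Fin n
      entry = nth a l
      below-length : ∀ {i} → i < n → i < length l
      below-length lt = subst (_ <_) (sym len) lt
      f : Fin n → Fin n
      f k = entry (toℕ k)
      found : ∀ v → ∃ λ i → i < length l × entry i ≡ v
      found v = position a l v (subst (0 <_) (sym (once v)) (s≤s z≤n))
      i<n : ∀ v → proj₁ (found v) < n
      i<n v = subst (proj₁ (found v) <_) len (proj₁ (proj₂ (found v)))
      g : Fin n → Fin n
      g v = fromℕ< (i<n v)
      f∘g : ∀ v → f (g v) ≡ v
      f∘g v = trans (cong entry (toℕ-fromℕ< (i<n v))) (proj₂ (proj₂ (found v)))
      g∘f : ∀ k → g (f k) ≡ k
      g∘f k = toℕ-injective (nth-injective l (λ v → ≤-reflexive (once v)) (below-length (toℕ<n (g (f k)))) (below-length (toℕ<n k)) (f∘g (f k)))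
      extended : List (Fin n)
      extended = l ++ a ∷ b ∷ []
      start₀ : nth a extended 0 ≡ a
      start₀ = proj₁ (nth-start path)
      start₁ : nth a extended 1 ≡ b
      start₁ = proj₂ (nth-start path)
      1<n : 1 < n
      1<n = ≤-trans (s≤s (s≤s z≤n)) 4≤n
      -- The two entries after `l` repeat its first two, so reading modulo `n` agrees with reading
      -- `extended` up to index `n + 1`, the largest that an edge needs.
      wrap : ∀ j → j < suc (suc n) → f (j mod n) ≡ nth a extended j
      wrap j lt = trans (cong entry (toℕ-fromℕ< (m%n<n j n))) (cases (m≤n⇒m<n∨m≡n (s≤s⁻¹ lt)))
        where
        cases : j < suc n ⊎ j ≡ suc n → entry (j % n) ≡ nth a extended j
        cases (inj₂ refl) = trans (cong entry (trans ([m+n]%n≡m%n 1 n) (m<n⇒m%n≡m 1<n))) (trans (sym (nth-++ˡ l (below-length 1<n)))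
          (trans start₁ (sym (trans (cong (λ t → nth a extended (suc t)) (sym len)) (nth-++ʳ l 1)))))
        cases (inj₁ lt′) with m≤n⇒m<n∨m≡n (s≤s⁻¹ lt′)
        ... | inj₁ j<n  = trans (cong entry (m<n⇒m%n≡m j<n)) (sym (nth-++ˡ l (below-length j<n)))
        ... | inj₂ refl = trans (cong entry (n%n≡0 n)) (trans (sym (nth-++ˡ l (below-length (s≤s z≤n))))
          (trans start₀ (sym (trans (cong (nth a extended) (sym len)) (nth-++ʳ l 0)))))
      edges : ∀ k → E (f (toℕ k mod n)) (f (suc (toℕ k) mod n)) (f (suc (suc (toℕ k)) mod n))
      edges k = subst₂ (λ x y → E x y (f (suc (suc (toℕ k)) mod n))) (sym (wrap (toℕ k) (m<n⇒m<1+n (m<n⇒m<1+n lt)))) (sym (wrap (suc (toℕ k)) (s≤s (m<n⇒m<1+n lt))))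
        (subst (E _ _) (sym (wrap (suc (suc (toℕ k))) (s≤s (s≤s lt)))) (nth-edge path (below-length lt)))
        where
        lt : toℕ k < n
        lt = toℕ<n k

-- Absorption and covering combined, with all numerical requirements as hypotheses.

module Assembling where
  open Prelude
  open Certificates
  open Counting
  open Ranks
  open Cycles
  open import Data.Nat.DivMod using (_/_; _%_; m≡m%n+[m/n]*n; m%n<n; m/n≡1+[m∸n]/n; /-monoˡ-≤; m*n/n≡m)
  open import Data.Fin using (Fin; toℕ)
  open import Data.Fin.Properties using (toℕ<n)
  import Data.Fin as Fin
  open import Data.List using (filterᵇ)
  open import Data.List.Relation.Unary.All using (All)

  connectors : ℕ → ℕ
  connectors k = k + k + (k + k + 13)

  connection-slack : ℕ → ℕ → ℕ
  connection-slack k s = k + k + (k + k + (9 + s))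

  -- Here `u` is the rise achieved by a replacement, `θ` the number of gadgets, and `η` the reserve
  -- that the covering leaves over. Connections between gadgets use `k₁`, `K₁` and slack `u`; those
  -- of the covering, when as few as `η` vertices may be left, use `k₂`, `K₂` and `s₂`.
  record Scale (n a : ℕ) : Set where
    field
      X u θ κ C C₅ Δ L fuel k₁ K₁ s₁ : ℕ
      a*X≤n     : a * X ≤ n
      gadget-slack : θ * 5 + (2 + (u + u)) ≤ X
      tops      : 2 * (θ * 5 + suc (u + u)) ≤ n
      enough    : n * (n * (2 + κ)) + n * (n * (2 + κ)) + C ≤ (u + u) * ((u + u) * u)
      C₅≤₁      : C₅ ≤ (u + u) * ((u + u) * ((u + u) * ((u + u) * (u + u))))
      C₅≤₂      : C₅ ≤ C * (κ * κ)
      dense     : n * (n * (n * (n * n))) ≤ suc Δ * C₅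
      log       : n * n < 2 ^ L
      log₁      : n < 2 ^ L
      4≤n       : 4 ≤ n
      hits-many : (2 + 2 * Δ) * (2 + 2 * Δ) * L + (2 + 2 * Δ) * fuel ≤ θ
      0<u       : 0 < u
      reach₁    : n ≤ k₁ * u
      small₁    : n * n < K₁ * (u * u)
      large₁    : n * (n * (7 + K₁)) + n * (n * (7 + K₁)) < u * (u * u)
      chain-slack : 2 + (θ * 5 + (θ * connectors k₁ + connection-slack k₁ u)) ≤ X
      game-slack  : 2 + (θ * 5 + (θ * connectors k₁ + suc s₁)) ≤ X
      A Q σ′ τ Γ μ′ η k₂ K₂ s₂ : ℕ
      0<A       : 0 < A
      0<Q       : 0 < Q
      slack     : 4 * n ≤ A * s₁
      0<s₂      : 0 < s₂
      reach₂    : n ≤ k₂ * s₂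
      small₂    : n * n < K₂ * (s₂ * s₂)
      large₂    : n * (n * (7 + K₂)) + n * (n * (7 + K₂)) < s₂ * (s₂ * s₂)
      A*S≤      : A * (suc τ * 3 + connection-slack k₂ s₂) ≤ 2 * η
      drops     : ∀ q → (suc τ * 3 + connectors k₂) * q ≤ n →
                  A * suc ((2 + μ′) * q + suc (Γ + Γ) * suc (Γ + Γ) * L) ≤ Q
      Q*D≤      : suc Q * (suc τ * 3 + connectors k₂) ≤ Γ * η
      Q*E≤      : Q * (suc (suc σ′ + suc σ′) * (suc τ * 3) + n * connectors k₂) ≤ μ′ * (η * η)
      count     : (τ * 3 + 1) * (n * (n * (suc τ * 3))) < σ′ * (σ′ * σ′)
      room      : suc (suc (suc σ′ + suc σ′)) ≤ η
      σ+σ≤S     : suc σ′ + suc σ′ ≤ suc τ * 3 + connection-slack k₂ s₂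
      remains   : 2 + (θ * 5 + θ * connectors k₁) + η ≤ n
      fuel-enough : (η + (suc τ * 3 + connectors k₂)) * suc k₁ ≤ fuel

  module _ {n : ℕ} where

    δ-sym : ∀ (x y : Fin n) → δ x y ≡ δ y x
    δ-sym x y with x Fin.≟ y
    ... | yes refl = sym (δ-refl x)
    ... | no x≢y   = sym (δ-0 (≢-sym x≢y))

    ∑-filter : ∀ (W : Fin n → Bool) xs f → ∑ (filterᵇ W xs) f ≡ ∑ xs (λ x → bit (W x) * f x)
    ∑-filter W []       f = refl
    ∑-filter W (x ∷ xs) f with W x
    ... | true  = cong₂ _+_ (sym (+-identityʳ (f x))) (∑-filter W xs f)
    ... | false = ∑-filter W xs f

    members : (Fin n → Bool) → List (Fin n)
    members W = filterᵇ W V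

    occ-members : ∀ W v → occ v (members W) ≡ bit (W v)
    occ-members W v = begin
      ∑ (members W) (δ v)               ≡⟨ ∑-filter W V (δ v) ⟩
      ∑ V (λ x → bit (W x) * δ v x)     ≡⟨ ∑-cong V (λ x → *-comm (bit (W x)) (δ v x)) ⟩
      ∑ V (λ x → δ v x * bit (W x))     ≡⟨ ∑-δ-* V v (bit ∘ W) ⟩
      occ v V * bit (W v)               ≡⟨ cong (_* bit (W v)) (trans (∑-cong V (δ-sym v)) (∑-δ v)) ⟩
      1 * bit (W v)                     ≡⟨ *-identityˡ _ ⟩
      bit (W v)                         ∎
      where open ≡-Reasoning

    length-members : ∀ W → length (members W) ≡ # W
    length-members W = trans (trans (sym (*-identityʳ _)) (sym (∑-const (members W) 1)))
      (trans (∑-filter W V (λ _ → 1)) (∑-cong V λ x → *-identityʳ _))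

  module _ {m : ℕ} (a : ℕ) .{{_ : NonZero a}} (sc : Scale (suc m) a) (H : 3Graph (suc m)) where
    open Scale sc
    open Paths H
    open Connecting H
    open Gadget H
    open Chains H
    open Covering H
    private n = suc m

    Degrees : Set
    Degrees = ∀ {x y} → x ≢ y → ∀ c → c ≤ toℕ x → c ≤ toℕ y → c + c ≤ n → a * c + n ≤ a * # (N x y)

    private
      instance
        nzu : NonZero u
        nzu = >-nonZero 0<u
        nzQ : NonZero Q
        nzQ = >-nonZero 0<Q

      D Lc₁ Lc₂ : ℕ
      Lc₁ = connectors k₁
      Lc₂ = connectors k₂
      D = suc τ * 3 + Lc₂

      #everything : # everything ≡ n
      #everything = trans (∑-const V 1) (trans (*-identityʳ _) length-V)

      connectable₁ : ∀ {h ρ} → h ≤ n → Connectable h (connection-slack k₁ u) Lc₁ ρ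
      connectable₁ h≤n P a≢b c≢d = connect K₁ 0<u small₁ large₁ k₁ P (#≤n _) (≤-trans h≤n reach₁) a≢b c≢d

      connectable₂ : ∀ {h ρ} → h ≤ n → Connectable h (connection-slack k₂ s₂) Lc₂ ρ
      connectable₂ h≤n P a≢b c≢d = connect K₂ 0<s₂ small₂ large₂ k₂ P (#≤n _) (≤-trans h≤n reach₂) a≢b c≢d

      -- An upper bound for the number of absorptions that a leftover vertex can still cause: each
      -- replacement rises by at least `u`, and labels stay below `n`.
      cost : Fin n → ℕ
      cost v = suc ((n ∸ toℕ v) / u)

      cost≤ : ∀ v → cost v ≤ suc k₁
      cost≤ v = s≤s (≤-trans (/-monoˡ-≤ u (≤-trans (m∸n≤m n (toℕ v)) reach₁)) (≤-reflexive (m*n/n≡m k₁ u)))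

      cost-drops : ∀ {v w} → toℕ v + u ≤ toℕ w → cost w < cost v
      cost-drops {v} {w} le = s≤s (begin-strict
        (n ∸ toℕ w) / u                ≡⟨ cong (_/ u) (m+n∸n≡m (n ∸ toℕ w) u) ⟨
        (n ∸ toℕ w + u ∸ u) / u        <⟨ n<1+n _ ⟩
        suc ((n ∸ toℕ w + u ∸ u) / u)  ≡⟨ m/n≡1+[m∸n]/n (m≤n+m u (n ∸ toℕ w)) ⟨
        (n ∸ toℕ w + u) / u            ≤⟨ /-monoˡ-≤ u (gap (m∸n+n≡m (<⇒≤ (toℕ<n w))) (m∸n+n≡m (<⇒≤ (toℕ<n v))) le) ⟩
        (n ∸ toℕ v) / u                ∎)
        where
        open ≤-Reasoning
        gap : ∀ {p q v w u m} → p + w ≡ m → q + v ≡ m → v + u ≤ w → p + u ≤ q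
        gap {p} {q} {v} {w} {u} {m} h0 h1 h2 =
          cert 0 ((≤-reflexive h0) ⊕ (≤-reflexive (sym h1)) ⊕ h2) (solve (p ∷ q ∷ v ∷ w ∷ u ∷ m ∷ []))

    module _ (degrees : Degrees) {h₀ : ℕ} (n≤h₀ : n ≤ suc (h₀ + h₀)) (h₀≤n : h₀ + h₀ ≤ n) where

      private
        full : Posa h₀ X everything toℕ
        full .low c = #-below everything c
        full .size = ≤-trans (≤-reflexive #everything) n≤h₀
        full .deg {x} {y} x≢y c cx cy ch = *-cancelˡ-≤ a (≤-trans (≤-reflexive (*-distribˡ-+ a c X))
          (≤-trans (+-monoʳ-≤ (a * c) a*X≤n) (degrees x≢y c cx cy (≤-trans (+-mono-≤ ch ch) h₀≤n))))

        h₀≤ : h₀ ≤ n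
        h₀≤ = ≤-trans (m≤m+n h₀ h₀) h₀≤n

        tops-arith : ∀ {t g s h n} → 2 * (t + s) ≤ n → n ≤ g + h → h + h ≤ n → t + s ≤ g
        tops-arith {t} {g} {s} {h} {n} h0 h1 h2 =
          certₘ 1 1 (h0 ⊕ 2 ⊗ h1 ⊕ h2) (solve (t ∷ g ∷ s ∷ h ∷ n ∷ []))
        tops′ : θ * 5 + suc (u + u) ≤ # (everything ∩ atLeast toℕ h₀)
        tops′ = tops-arith {θ * 5} {s = suc (u + u)} {h₀} {n} tops
          (≤-trans (≤-reflexive (sym #everything)) (≤-trans (#-mono λ x e → ∧-intro e refl)
            (≤-trans (#-split everything (λ _ → true) (λ x → toℕ x <ᵇ h₀)) (+-monoʳ-≤ _ (#-below everything h₀))))) h₀≤n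

        -- The slack `u + u` is halved: one `u` is the rise of the replaced vertex over the new one,
        -- the other counts the choices for it.
        open Selection {ρ = toℕ} {h = h₀} (u + u) u u κ C C₅ Δ θ L (Posa-≤ gadget-slack full) tops′ (m≤n+m (u + u) 2)
          enough C₅≤₁ C₅≤₂ dense (s≤s z≤n) log₁

        finish : ∀ {gs x y l W} → (∀ v → fuel ≤ hitsOf toℕ u v gs) → Chain x y gs l x y → Split everything l W → # W ≤ η + D → TightHamCycle H
        finish {W = W} enough-hits ch sp left = conclude (absorb toℕ u cost (λ _ → s≤s z≤n) cost-drops fuel (members W) total enough-hits ch)
          where
          total : ∑ (members W) cost ≤ fuel
          total = begin
            ∑ (members W) cost              ≤⟨ ∑-mono (members W) cost≤ ⟩
            ∑ (members W) (λ _ → suc k₁)    ≡⟨ trans (∑-const (members W) (suc k₁)) (cong (_* suc k₁) (length-members W)) ⟩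
            # W * suc k₁                    ≤⟨ *-monoˡ-≤ (suc k₁) left ⟩
            (η + D) * suc k₁                ≤⟨ fuel-enough ⟩
            fuel                            ∎
            where open ≤-Reasoning
          conclude : _ → TightHamCycle H
          conclude (l′ , p , o) = closed-path⇒hamiltonian H 4≤n p λ v →
            trans (o v) (trans (cong (_+ _) (occ-members W v)) (trans (+-comm (bit (W v)) _) (sp .at v)))

        game : ∀ {gs x y l e f W} → (∀ v → fuel ≤ hitsOf toℕ u v gs) → Chain x y gs l e f → x ≢ y → e ≢ f →
               Split everything (e ∷ f ∷ l) W → Posa h₀ (suc s₁) W toℕ → η ≤ # W → TightHamCycle H
        game {gs} {x} {y} {l} {e} {f} {W} enough-hits ch x≢y e≢f sp P₀ η≤ = run (closed-chain ch x≢y e≢f sp 0<m₀)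
          where
          q r mₑ : ℕ
          q = (# W ∸ η) / D
          r = (# W ∸ η) % D
          -- The remainder of the division joins the reserve, so that rounds of exactly `D` vertices
          -- use up the rest.
          mₑ = η + r
          0<m₀ : 0 < # W
          0<m₀ = ≤-trans (s≤s z≤n) (≤-trans room η≤)
          m₀≡ : # W ≡ D * q + mₑ
          m₀≡ = trans (sym (m∸n+n≡m η≤)) (trans (cong (_+ η) (m≡m%n+[m/n]*n (# W ∸ η) D)) (shuffle r q D η))
            where
            shuffle : ∀ r q d e → r + q * d + e ≡ d * q + (e + r)
            shuffle = solve-∀
          η≤mₑ : η ≤ mₑ
          η≤mₑ = m≤m+n η r
          setup : Setup W
          setup = record
            { A = A ; Q = Q ; σ′ = σ′ ; τ = τ ; s₁ = s₁ ; h₀ = h₀ ; Lc = Lc₂ ; Sc = connection-slack k₂ s₂ ; Γ = Γ ; μ′ = μ′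
            ; q = q ; mₑ = mₑ ; L = L ; 0<Q = 0<Q ; 0<A = 0<A ; P₀ = P₀ ; n≤h₀ = n≤h₀
            ; slack = ≤-trans (*-monoʳ-≤ 4 (#≤n W)) slack
            ; A*S≤ = ≤-trans A*S≤ (*-monoʳ-≤ 2 η≤mₑ)
            ; m₀≡ = m₀≡
            ; A*drop≤Q = drops q (≤-trans (m≤m+n (D * q) mₑ) (≤-trans (≤-reflexive (sym m₀≡)) (#≤n W)))
            ; Q*D≤ = ≤-trans Q*D≤ (*-monoʳ-≤ Γ η≤mₑ)
            ; Q*E≤ = ≤-trans Q*E≤ (*-monoʳ-≤ μ′ (*-mono-≤ η≤mₑ η≤mₑ))
            ; count = count ; room = ≤-trans room η≤mₑ ; σ+σ≤S = σ+σ≤S ; log = log ; conn = connectable₂ }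
          open PathGame setup {e} {f} gs
          run : _ → TightHamCycle H
          run (x , y , l , W′ , ch , sp , left) = finish enough-hits ch sp (≤-trans left (+-monoʳ-≤ η (<⇒≤ (m%n<n (# W ∸ η) D))))

        two : ∀ (W : Fin n → Bool) → 2 ≤ # W → ∃ λ e → ∃ λ f → W e ≡ true × (W ─ e) f ≡ true × e ≢ f
        two W 2≤ = first (#-∃ (≤-trans (s≤s z≤n) 2≤))
          where
          first : (∃ λ e → W e ≡ true) → ∃ λ e → ∃ λ f → W e ≡ true × (W ─ e) f ≡ true × e ≢ f
          first (e , We) = let f , Wf = #-∃ (s≤s⁻¹ (≤-trans 2≤ (#-─ W e))) in
            e , f , We , Wf , ≢-sym (proj₂ (─-elim {W = W} Wf))

        two-arith : ∀ {l w} n {t c e} → l + w ≡ n → 2 + (t + c) + e ≤ n → l ≤ t → 2 ≤ w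
        two-arith {l} {w} n {t} {c} {e} h0 h1 h2 =
          cert (c + e) ((≤-reflexive (sym h0)) ⊕ h1 ⊕ h2) (solve (l ∷ w ∷ n ∷ t ∷ c ∷ e ∷ []))
        left-arith : ∀ {l w n} r {e} → l + w ≡ n → 2 + r + e ≤ n → l ≤ 2 + r → e ≤ w
        left-arith {l} {w} {n} r {e} h0 h1 h2 =
          cert 0 ((≤-reflexive (sym h0)) ⊕ h1 ⊕ h2) (solve (l ∷ w ∷ n ∷ r ∷ e ∷ []))

        assemble : (∃ λ gs → ∃ λ W → length gs ≡ θ × All TightGadget gs × Split everything (flat gs) W ×
                    (∀ v → θ < U * U * L + U * hits v gs)) → TightHamCycle H
        assemble (gs , W , len , tight , sp , many) = with-ends (two W (two-arith n (trans (Split-# sp) #everything) remains len-flat))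
          where
          len-flat : length (flat gs) ≤ θ * 5
          len-flat = ≤-reflexive (trans (length-flat gs) (cong (_* 5) len))
          hits-arith : ∀ {t} l U f h → l + U * f ≤ t → t < l + U * h → U * f < U * h
          hits-arith {t} l U f h h0 h1 =
            cert 0 (h0 ⊕ h1) (solve (t ∷ l ∷ U ∷ f ∷ h ∷ []))
          enough-hits : ∀ v → fuel ≤ hitsOf toℕ u v gs
          enough-hits v = <⇒≤ (*-cancelˡ-< U fuel (hits v gs) (hits-arith (U * U * L) U fuel (hits v gs) hits-many (many v)))
          with-ends : (∃ λ e → ∃ λ f → W e ≡ true × (W ─ e) f ≡ true × e ≢ f) → TightHamCycle H
          with-ends (e , f , We , Wf , e≢f) = with-chain (chain-up (connectable₁ h₀≤) e≢f gs tight
              (subst (λ t → Posa h₀ (t * Lc₁ + connection-slack k₁ u) (W ─ e ─ f) toℕ) (sym len)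
                (Posa-split sp₂ (2 + θ * 5) len₂ (Posa-≤ (≤-trans (≤-reflexive (+-assoc 2 (θ * 5) _)) chain-slack) full))))
            where
            sp₂ : Split everything (e ∷ f ∷ flat gs) (W ─ e ─ f)
            sp₂ = Split-++ʳ {l = flat gs} {l′ = e ∷ f ∷ []} sp (Split-++ {l = e ∷ []} (remove We) (remove {W = W ─ e} Wf))
            len₂ : length (e ∷ f ∷ flat gs) ≤ 2 + θ * 5
            len₂ = s≤s (s≤s len-flat)
            with-chain : (∃ λ x → ∃ λ y → ∃ λ l → ∃ λ new → ∃ λ W′ → Chain x y gs l e f × x ≢ y × Split (W ─ e ─ f) new W′ ×
                          length new ≡ length gs * Lc₁ × (∀ v → occ v l ≡ occ v (flat gs) + occ v new)) → TightHamCycle H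
            with-chain (x , y , l , new , W′ , ch , x≢y , sp₃ , len₃ , o) =
              game enough-hits ch x≢y e≢f (Split-resp tally sp₄)
                (Posa-split sp₄ (2 + (θ * 5 + θ * Lc₁)) len₄ (Posa-≤ (≤-trans (≤-reflexive (cong (2 +_) (+-assoc (θ * 5) (θ * Lc₁) _))) game-slack) full))
                (left-arith (θ * 5 + θ * Lc₁) (trans (Split-# sp₄) #everything) remains len₄)
              where
              sp₄ : Split everything ((e ∷ f ∷ flat gs) ++ new) W′
              sp₄ = Split-++ sp₂ sp₃
              len₄ : length ((e ∷ f ∷ flat gs) ++ new) ≤ 2 + (θ * 5 + θ * Lc₁)
              len₄ = ≤-trans (≤-reflexive (length-++ (e ∷ f ∷ flat gs))) (+-mono-≤ len₂ (≤-reflexive (trans len₃ (cong (_* Lc₁) len))))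
              tally : ∀ v → occ v (e ∷ f ∷ l) ≡ occ v ((e ∷ f ∷ flat gs) ++ new)
              tally v = trans (cong (λ t → δ v e + (δ v f + t)) (o v)) (trans (shuffle (δ v e) (δ v f) (occ v (flat gs)) (occ v new))
                (sym (∑-++ (e ∷ f ∷ flat gs) new (δ v))))
                where
                shuffle : ∀ a b c d → a + (b + (c + d)) ≡ a + (b + c) + d
                shuffle = solve-∀

      hamiltonian : TightHamCycle H
      hamiltonian = assemble selection

-- Choice of the constants.

module Scales where
  open Prelude
  open Certificates
  open Counting using (∑; ∑-∈)
  open import Data.List.Relation.Unary.Any using (here; there)
  open Assembling using (Scale; connectors; connection-slack)
  open import Data.Nat.DivMod using (_/_; m≡m%n+[m/n]*n; m%n<n; m/n*n≤m; /-monoˡ-≤; m*n/n≡m)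

  m<suc[m/n]*n : ∀ m n .{{_ : NonZero n}} → m < suc (m / n) * n
  m<suc[m/n]*n m n = subst (_< suc (m / n) * n) (sym (m≡m%n+[m/n]*n m n)) (+-monoˡ-< (m / n * n) (m%n<n m n))

  suc≤2^ : ∀ f → suc f ≤ 2 ^ f
  suc≤2^ zero    = ≤-refl
  suc≤2^ (suc f) = ≤-trans (+-mono-≤ (>-nonZero⁻¹ (2 ^ f) {{m^n≢0 2 f}}) (suc≤2^ f)) (≤-reflexive (cong (2 ^ f +_) (sym (+-identityʳ (2 ^ f)))))

  -- 2 ^ L grows like the cube of L / 3, hence faster than any multiple of the square of L.
  square<2^ : ∀ c L → 27 * (c * c) ≤ L → (c * suc L) * (c * suc L) < 2 ^ L
  square<2^ c L h = begin-strict
    (c * suc L) * (c * suc L)        ≤⟨ *-mono-≤ (*-monoʳ-≤ c L≤) (*-monoʳ-≤ c L≤) ⟩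
    (c * (suc f * 3)) * (c * (suc f * 3)) ≡⟨ regroup c (suc f) ⟩
    9 * (c * c) * (suc f * suc f)    <⟨ *-monoˡ-< (suc f * suc f) (s≤s big) ⟩
    suc f * (suc f * suc f)          ≤⟨ *-mono-≤ (suc≤2^ f) (*-mono-≤ (suc≤2^ f) (suc≤2^ f)) ⟩
    2 ^ f * (2 ^ f * 2 ^ f)          ≡⟨ cong (2 ^ f *_) (^-distribˡ-+-* 2 f f) ⟨
    2 ^ f * 2 ^ (f + f)              ≡⟨ ^-distribˡ-+-* 2 f (f + f) ⟨
    2 ^ (f + (f + f))                ≤⟨ ^-monoʳ-≤ 2 (≤-trans (≤-reflexive (triple f)) (m/n*n≤m L 3)) ⟩
    2 ^ L                            ∎
    where
    open ≤-Reasoning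
    f : ℕ
    f = L / 3
    L≤ : suc L ≤ suc f * 3
    L≤ = m<suc[m/n]*n L 3
    big : 9 * (c * c) ≤ f
    big = ≤-trans (≤-reflexive (sym (m*n/n≡m (9 * (c * c)) 3))) (/-monoˡ-≤ 3 (≤-trans (≤-reflexive (cubes (c * c))) h))
      where
      cubes : ∀ x → 9 * x * 3 ≡ 27 * x
      cubes = solve-∀
    regroup : ∀ c f → (c * (f * 3)) * (c * (f * 3)) ≡ 9 * (c * c) * (f * f)
    regroup = solve-∀
    triple : ∀ f → f + (f + f) ≡ f * 3
    triple = solve-∀

  module _ {n k s : ℕ} (n≤ks : n ≤ k * s) (0<s : 0 < s) where

    private
      instance
        nz : NonZero (s * s)
        nz = >-nonZero (*-mono-≤ 0<s 0<s)

      squares : n * n ≤ k * k * (s * s)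
      squares = ≤-trans (*-mono-≤ n≤ks n≤ks) (≤-reflexive ([m*n]*[o*p]≡[m*o]*[n*p] k s k s))

    connection-small : n * n < suc (k * k) * (s * s)
    connection-small = ≤-<-trans squares (*-monoˡ-< (s * s) (n<1+n (k * k)))

    connection-large : 2 * (k * k * (7 + suc (k * k))) < s →
      n * (n * (7 + suc (k * k))) + n * (n * (7 + suc (k * k))) < s * (s * s)
    connection-large h = begin-strict
      n * (n * c) + n * (n * c)       ≡⟨ regroup n c ⟩
      n * n * (2 * c)                 ≤⟨ *-monoˡ-≤ (2 * c) squares ⟩
      k * k * (s * s) * (2 * c)       ≡⟨ regroup′ (k * k) (s * s) c ⟩
      2 * (k * k * c) * (s * s)       <⟨ *-monoˡ-< (s * s) h ⟩
      s * (s * s)                     ∎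
      where
      open ≤-Reasoning
      c = 7 + suc (k * k)
      regroup : ∀ n c → n * (n * c) + n * (n * c) ≡ n * n * (2 * c)
      regroup = solve-∀
      regroup′ : ∀ k s c → k * s * (2 * c) ≡ 2 * (k * c) * s
      regroup′ = solve-∀

  gadget-slack-arith : ∀ {θ u} → θ ≤ u → 1 ≤ u → θ * 5 + (2 + (u + u)) ≤ 32 * u
  gadget-slack-arith {θ} {u} h0 h1 =
    cert (23 * u) (5 ⊗ h0 ⊕ 2 ⊗ h1) (solve (θ ∷ u ∷ []))
  tops-arith : ∀ {θ u n} → θ ≤ u → 1 ≤ u → 32 * u ≤ n → 2 * (θ * 5 + suc (u + u)) ≤ n
  tops-arith {θ} {u} {n} h0 h1 h2 =
    certₘ 1 (1 + n) (20 ⊗ h0 ⊕ 4 ⊗ h1 ⊕ h2) (solve (θ ∷ u ∷ n ∷ []))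
  enough-arith : ∀ {w t u} → w ≤ u * (u * u) → t ≡ w + w → t + (u * (u * u) + u * (u * u)) ≤ (u + u) * ((u + u) * u)
  enough-arith {w} {t} {u} h0 h1 =
    cert 0 (2 ⊗ h0 ⊕ (≤-reflexive h1)) (solve (w ∷ t ∷ u ∷ []))
  chain-slack-arith : ∀ {θ u c p q} → θ ≤ u → 1 ≤ u → c ≤ u → p ≤ u → 2 + (θ * 5 + (c + (p + u))) ≤ 32 * u
  chain-slack-arith {θ} {u} {c} {p} {q} h0 h1 h2 h3 =
    cert (22 * u) (5 ⊗ h0 ⊕ 2 ⊗ h1 ⊕ h2 ⊕ h3) (solve (θ ∷ u ∷ c ∷ p ∷ q ∷ []))
  game-slack-arith : ∀ {θ u c} → θ ≤ u → 1 ≤ u → c ≤ u → 2 + (θ * 5 + (c + suc (16 * u))) ≤ 32 * u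
  game-slack-arith {θ} {u} {c} h0 h1 h2 =
    cert (7 * u) (5 ⊗ h0 ⊕ 3 ⊗ h1 ⊕ h2) (solve (θ ∷ u ∷ c ∷ []))
  remains-arith : ∀ {θ u c n η} → θ ≤ u → 1 ≤ u → c ≤ u → η ≤ u → 32 * u ≤ n → 2 + (θ * 5 + c) + η ≤ n
  remains-arith {θ} {u} {c} {n} {η} h0 h1 h2 h3 h4 =
    certₘ 31 (31 + 23 * n) (160 ⊗ h0 ⊕ 64 ⊗ h1 ⊕ 32 ⊗ h2 ⊕ 32 ⊗ h3 ⊕ 9 ⊗ h4) (solve (θ ∷ u ∷ c ∷ n ∷ η ∷ []))
  connectors≤ : ∀ {B} → 13 ≤ B → 5 * B ≤ B * B → B + B + (B + B + 13) ≤ B * B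
  connectors≤ {B} h0 h1 =
    cert 0 (h0 ⊕ h1) (solve (B ∷ []))
  A*S-arith : ∀ {A M p ζ H} → A * (M + p) ≤ A * ζ → 3 * A * ζ ≤ 2 * H * ζ → A * (M + (p + (ζ + ζ))) ≤ 2 * (H * ζ)
  A*S-arith {A} {M} {p} {ζ} {H} h0 h1 =
    cert 0 (h0 ⊕ h1) (solve (A ∷ M ∷ p ∷ ζ ∷ H ∷ []))
  Q-step : ∀ H η D → D ≤ D * η → suc (H * η) * D ≤ suc H * D * η
  Q-step H η D h0 =
    cert 0 h0 (solve (H ∷ η ∷ D ∷ []))
  μ-arith : ∀ H ζ M n Lc B₂ → n * Lc ≤ B₂ * ζ * Lc → M ≤ ζ * M → suc (ζ + ζ) * M + n * Lc ≤ (3 * M + B₂ * Lc) * ζ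
  μ-arith H ζ M n Lc B₂ h0 h1 =
    cert 0 (h0 ⊕ h1) (solve (H ∷ ζ ∷ M ∷ n ∷ Lc ∷ B₂ ∷ []))
  fuel-arith : ∀ η D k → D * suc k ≤ η * suc k → (η + D) * suc k ≤ 2 * suc k * η
  fuel-arith η D k h0 =
    cert 0 h0 (solve (η ∷ D ∷ k ∷ []))
  drops-arith : ∀ A H η M q ν K g → A * (M * q) ≤ A * (ν * η) → A * q ≤ A * (ν * η) → 4 * A * (K * q) ≤ H * η → A + A * g ≤ η → 20 * (A * ν * η) + 4 * η ≤ 3 * (H * η) → A * suc ((2 + (3 * M + K)) * q + g) ≤ H * η
  drops-arith A H η M q ν K g h0 h1 h2 h3 h4 =
    certₘ 3 3 (12 ⊗ h0 ⊕ 8 ⊗ h1 ⊕ h2 ⊕ 4 ⊗ h3 ⊕ h4) (solve (A ∷ H ∷ η ∷ M ∷ q ∷ ν ∷ K ∷ g ∷ []))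

  -- The equations keep the constants abstract. Their origins: `n ≤ B * u`; `n ≤ β * κ`, so gadgets
  -- have density at least `1 / β⁵`; `Θ` makes the gadgets numerous enough for all absorptions;
  -- `n ≤ ν * η`; `Q` will be `H * η`; `n ≤ B₂ * ζ`, which fixes the length `Lc` of connections.
  -- Only then is `τ` chosen, so that `M` dwarfs `Lc`.
  record Constants (a : ℕ) : Set where
    field
      B A β Δ Θ ν H B₂ τ Γ C : ℕ
      B≡  : B ≡ 64 * a
      A≡  : A ≡ 16 * a
      β≡  : β ≡ 2 * (B * B * B)
      Δ≡  : suc Δ ≡ β * (β * (β * (β * β)))
      Θ≡  : Θ ≡ suc ((2 + 2 * Δ) * (2 * suc B))
      ν≡  : ν ≡ B * (B * B * Θ)
      H≡  : H ≡ 24 * (A * ν)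
      B₂≡ : B₂ ≡ ν * H
    Lc : ℕ
    Lc = connectors B₂
    M : ℕ
    M = suc τ * 3
    D : ℕ
    D = M + Lc
    G : ℕ
    G = suc (Γ + Γ)
    field
      τ≡ : τ ≡ 4 * (A * (ν * ν) * Lc)
      Γ≡ : Γ ≡ suc H * D
      C≡ : C ≡ (2 + 2 * Δ) * (2 + 2 * Δ) + (A + A * (G * G))

  module _ {a : ℕ} .{{_ : NonZero a}} (constants : Constants a) where
    open Constants constants

    private
      1≤a : 1 ≤ a
      1≤a = >-nonZero⁻¹ a
      64≤B : 64 ≤ B
      64≤B = subst (64 ≤_) (sym B≡) (*-monoʳ-≤ 64 1≤a)
      1≤B : 1 ≤ B
      1≤B = ≤-trans (s≤s z≤n) 64≤B
      1≤A : 1 ≤ A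
      1≤A = subst (1 ≤_) (sym A≡) (≤-trans (s≤s z≤n) (*-monoʳ-≤ 16 1≤a))
      1≤Θ : 1 ≤ Θ
      1≤Θ = subst (1 ≤_) (sym Θ≡) (s≤s z≤n)
      1≤ν : 1 ≤ ν
      1≤ν = subst (1 ≤_) (sym ν≡) (*-mono-≤ 1≤B (*-mono-≤ (*-mono-≤ 1≤B 1≤B) 1≤Θ))
      24≤H : 24 ≤ H
      24≤H = subst (24 ≤_) (sym H≡) (*-monoʳ-≤ 24 (*-mono-≤ 1≤A 1≤ν))
      1≤H : 1 ≤ H
      1≤H = ≤-trans (s≤s z≤n) 24≤H

      times : ∀ {c} x → 1 ≤ c → x ≤ c * x
      times x h = ≤-trans (≤-reflexive (sym (*-identityˡ x))) (*-monoˡ-≤ x h)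

    -- The scales `ζ`, `η`, `θ`, `u` are all linear in `n` and grow by constant factors: surplus in
    -- the light paths, reserve, number of gadgets, rise of a replacement. The `t`-conditions say
    -- that `n` is large.
    record Bounds (n : ℕ) : Set where
      field
        ζ L σ′ κ : ℕ
      η : ℕ
      η = H * ζ
      θ : ℕ
      θ = Θ * η
      u : ℕ
      u = B * B * θ
      field
        ζ≡   : ζ ≡ suc σ′
        κ≡   : 2 + κ ≡ θ
        n≥   : 32 * (a * u) ≤ n
        n≤   : n ≤ 64 * (a * u)
        t₁   : 2 * (B * B * (7 + suc (B * B))) < ζ
        t₂   : B + B + (B + B + 9) ≤ ζ
        t₃   : 2 * (B₂ * B₂ * (7 + suc (B₂ * B₂))) < ζ
        t₄   : M + (B₂ + B₂ + (B₂ + B₂ + 9)) ≤ ζ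
        t₅   : D ≤ ζ
        t₆   : 4 * (M * M * (B₂ * B₂)) < σ′
        t₇   : 4 ≤ ζ
        CL≤ζ : C * L ≤ ζ
        1≤L  : 1 ≤ L
        log  : n * n < 2 ^ L

    module _ {n : ℕ} (bounds : Bounds n) where
      open Bounds bounds

      private
        1≤ζ : 1 ≤ ζ
        1≤ζ = ≤-trans (s≤s z≤n) t₇
        ζ≤η : ζ ≤ η
        ζ≤η = times ζ 1≤H
        η≤θ : η ≤ θ
        η≤θ = times η 1≤Θ
        θ≤u : θ ≤ u
        θ≤u = times θ (*-mono-≤ 1≤B 1≤B)
        ζ≤u : ζ ≤ u
        ζ≤u = ≤-trans ζ≤η (≤-trans η≤θ θ≤u)
        1≤u : 1 ≤ u
        1≤u = ≤-trans 1≤ζ ζ≤u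
        32u≤n : 32 * u ≤ n
        32u≤n = ≤-trans (*-monoʳ-≤ 32 (times u 1≤a)) n≥
        n≤Bu : n ≤ B * u
        n≤Bu = ≤-trans n≤ (≤-reflexive (trans (sym (*-assoc 64 a u)) (cong (_* u) (sym B≡))))
        n≤νη : n ≤ ν * η
        n≤νη = ≤-trans n≤Bu (≤-reflexive (trans (regroup B Θ η) (cong (_* η) (sym ν≡))))
          where
          regroup : ∀ B T e → B * (B * B * (T * e)) ≡ B * (B * B * T) * e
          regroup = solve-∀
        n≤B₂ζ : n ≤ B₂ * ζ
        n≤B₂ζ = ≤-trans n≤νη (≤-reflexive (trans (sym (*-assoc ν H ζ)) (cong (_* ζ) (sym B₂≡))))

        κ≤u : κ ≤ u
        κ≤u = ≤-trans (m≤n+m κ 2) (≤-trans (≤-reflexive κ≡) θ≤u)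
        2≤κ : 2 ≤ κ
        2≤κ = +-cancelˡ-≤ 2 2 κ (≤-trans t₇ (≤-trans ζ≤η (≤-trans η≤θ (≤-reflexive (sym κ≡)))))

        nnθ : n * (n * (2 + κ)) ≤ u * (u * u)
        nnθ = ≤-trans (*-mono-≤ n≤Bu (*-mono-≤ n≤Bu (≤-reflexive κ≡))) (≤-reflexive (regroup B u θ))
          where
          regroup : ∀ B u t → B * u * (B * u * t) ≡ u * (u * (B * B * t))
          regroup = solve-∀

        n≤βκ : n ≤ β * κ
        n≤βκ = begin
          n                                ≤⟨ n≤Bu ⟩
          B * (B * B * θ)                  ≡⟨ regroup B θ ⟩
          B * B * B * θ                    ≤⟨ *-monoʳ-≤ (B * B * B) (≤-trans (≤-reflexive (sym κ≡)) (+-monoˡ-≤ κ 2≤κ)) ⟩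
          B * B * B * (κ + κ)              ≡⟨ regroup′ (B * B * B) κ ⟩
          2 * (B * B * B) * κ              ≡⟨ cong (_* κ) β≡ ⟨
          β * κ                            ∎
          where
          open ≤-Reasoning
          regroup : ∀ B t → B * (B * B * t) ≡ B * B * B * t
          regroup = solve-∀
          regroup′ : ∀ b k → b * (k + k) ≡ 2 * b * k
          regroup′ = solve-∀

        C₅ : ℕ
        C₅ = κ * (κ * (κ * (κ * κ)))

        dense′ : n * (n * (n * (n * n))) ≤ suc Δ * C₅
        dense′ = ≤-trans (*-mono-≤ n≤βκ (*-mono-≤ n≤βκ (*-mono-≤ n≤βκ (*-mono-≤ n≤βκ n≤βκ))))
          (≤-reflexive (trans (regroup β κ) (cong (_* C₅) (sym Δ≡))))
          where
          regroup : ∀ b k → b * k * (b * k * (b * k * (b * k * (b * k)))) ≡ b * (b * (b * (b * b))) * (k * (k * (k * (k * k))))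
          regroup = solve-∀

        C₅≤C : C₅ ≤ (u * (u * u) + u * (u * u)) * (κ * κ)
        C₅≤C = ≤-trans (≤-reflexive (regroup κ)) (*-monoˡ-≤ (κ * κ) (≤-trans (*-mono-≤ κ≤u (*-mono-≤ κ≤u κ≤u)) (m≤m+n _ _)))
          where
          regroup : ∀ k → k * (k * (k * (k * k))) ≡ k * (k * k) * (k * k)
          regroup = solve-∀

        C₅≤5 : C₅ ≤ (u + u) * ((u + u) * ((u + u) * ((u + u) * (u + u))))
        C₅≤5 = *-mono-≤ κ≤2u (*-mono-≤ κ≤2u (*-mono-≤ κ≤2u (*-mono-≤ κ≤2u κ≤2u)))
          where
          κ≤2u : κ ≤ u + u
          κ≤2u = ≤-trans κ≤u (m≤m+n u u)

        U fuel : ℕ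
        U = 2 + 2 * Δ
        fuel = 2 * suc B * η

        CL≤η : C * L ≤ η
        CL≤η = ≤-trans CL≤ζ ζ≤η
        hits : U * U * L + U * fuel ≤ θ
        hits = begin
          U * U * L + U * fuel                 ≤⟨ +-monoˡ-≤ (U * fuel) (≤-trans (*-monoˡ-≤ L (≤-trans (m≤m+n (U * U) _) (≤-reflexive (sym C≡)))) CL≤η) ⟩
          η + U * (2 * suc B * η)              ≡⟨ cong (η +_) (*-assoc U (2 * suc B) η) ⟨
          η + U * (2 * suc B) * η              ≡⟨ cong (_* η) Θ≡ ⟨
          θ                                    ∎
          where open ≤-Reasoning

        θLc≤u : θ * connectors B ≤ u
        θLc≤u = ≤-trans (*-monoʳ-≤ θ (connectors≤ (≤-trans (m≤m+n 13 51) 64≤B) (*-monoˡ-≤ B (≤-trans (m≤m+n 5 59) 64≤B)))) (≤-reflexive (*-comm θ (B * B)))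

        slack : 4 * n ≤ A * (16 * u)
        slack = ≤-trans (*-monoʳ-≤ 4 n≤) (≤-reflexive (trans (regroup a u) (cong (_* (16 * u)) (sym A≡))))
          where
          regroup : ∀ a u → 4 * (64 * (a * u)) ≡ 16 * a * (16 * u)
          regroup = solve-∀

        A*S : A * (M + connection-slack B₂ (ζ + ζ)) ≤ 2 * η
        A*S = ≤-trans (≤-reflexive (cong (λ t → A * (M + t)) (assoc B₂ (ζ + ζ))))
          (A*S-arith {A} {M} {B₂ + B₂ + (B₂ + B₂ + 9)} {ζ} {H} (*-monoʳ-≤ A t₄) (*-monoˡ-≤ ζ 3A≤2H))
          where
          assoc : ∀ b z → b + b + (b + b + (9 + z)) ≡ b + b + (b + b + 9) + z
          assoc = solve-∀
          arith : ∀ {A h} → A ≤ h → 3 * A ≤ 2 * (24 * h)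
          arith {A} {h} h0 =
            cert (45 * h) (3 ⊗ h0) (solve (A ∷ h ∷ []))
          3A≤2H : 3 * A ≤ 2 * H
          3A≤2H = subst (λ h → 3 * A ≤ 2 * h) (sym H≡) (arith (≤-trans (≤-reflexive (sym (*-identityʳ A))) (*-monoʳ-≤ A 1≤ν)))

        E : ℕ
        E = suc (ζ + ζ) * M + n * Lc
        μ′ : ℕ
        μ′ = 3 * M + B₂ * Lc

        Q*E : η * H * E ≤ μ′ * (η * η)
        Q*E = ≤-trans (*-monoʳ-≤ (η * H) (μ-arith H ζ M n Lc B₂ (*-monoˡ-≤ Lc n≤B₂ζ) (times M 1≤ζ))) (≤-reflexive (regroup η H μ′ ζ))
          where
          regroup : ∀ e H m z → e * H * (m * z) ≡ m * (e * (H * z))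
          regroup = solve-∀

        1≤M : 1 ≤ M
        1≤M = s≤s z≤n

        -- A round may cost about `μ′ = 3 M + B₂ Lc` levels, and there are at most `n / D` rounds.
        -- The first part adds up to a multiple of `n`, which the factor 24 in `H` covers. The
        -- second is small because `τ`, and with it `M`, is a large multiple of `Lc`.
        drops : ∀ q → D * q ≤ n → A * suc ((2 + μ′) * q + G * G * L) ≤ H * η
        drops q Dq≤n = drops-arith A H η M q ν (B₂ * Lc) (G * G * L)
          (*-monoʳ-≤ A Mq≤νη) (*-monoʳ-≤ A (≤-trans (times q 1≤M) Mq≤νη)) heavy tail leading
          where
          Mq≤νη : M * q ≤ ν * η
          Mq≤νη = ≤-trans (*-monoˡ-≤ q (m≤m+n M Lc)) (≤-trans Dq≤n n≤νη)
          light : 4 * (A * ν * Lc * q) ≤ η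
          light = *-cancelˡ-≤ ν {{>-nonZero 1≤ν}} (begin
            ν * (4 * (A * ν * Lc * q))     ≡⟨ regroup ν A Lc q ⟩
            4 * (A * (ν * ν) * Lc) * q     ≡⟨ cong (_* q) τ≡ ⟨
            τ * q                          ≤⟨ *-monoˡ-≤ q (≤-trans (n≤1+n τ) (m≤m*n (suc τ) 3)) ⟩
            M * q                          ≤⟨ Mq≤νη ⟩
            ν * η                          ∎)
            where
            open ≤-Reasoning
            regroup : ∀ v A l q → v * (4 * (A * v * l * q)) ≡ 4 * (A * (v * v) * l) * q
            regroup = solve-∀
          heavy : 4 * A * (B₂ * Lc * q) ≤ H * η
          heavy = begin
            4 * A * (B₂ * Lc * q)          ≡⟨ cong (λ b → 4 * A * (b * Lc * q)) B₂≡ ⟩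
            4 * A * (ν * H * Lc * q)       ≡⟨ regroup A ν H Lc q ⟩
            H * (4 * (A * ν * Lc * q))     ≤⟨ *-monoʳ-≤ H light ⟩
            H * η                          ∎
            where
            open ≤-Reasoning
            regroup : ∀ A v H l q → 4 * A * (v * H * l * q) ≡ H * (4 * (A * v * l * q))
            regroup = solve-∀
          tail : A + A * (G * G * L) ≤ η
          tail = begin
            A + A * (G * G * L)            ≤⟨ +-monoˡ-≤ _ (≤-trans (≤-reflexive (sym (*-identityʳ A))) (*-monoʳ-≤ A 1≤L)) ⟩
            A * L + A * (G * G * L)        ≡⟨ regroup A (G * G) L ⟩
            (A + A * (G * G)) * L          ≤⟨ *-monoˡ-≤ L (≤-trans (m≤n+m (A + A * (G * G)) (U * U)) (≤-reflexive (sym C≡))) ⟩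
            C * L                          ≤⟨ CL≤η ⟩
            η                              ∎
            where
            open ≤-Reasoning
            regroup : ∀ A g L → A * L + A * (g * L) ≡ (A + A * g) * L
            regroup = solve-∀
          leading : 20 * (A * ν * η) + 4 * η ≤ 3 * (H * η)
          leading = begin
            20 * (A * ν * η) + 4 * η                ≤⟨ +-monoʳ-≤ (20 * (A * ν * η)) (*-monoʳ-≤ 4 (times η (*-mono-≤ 1≤A 1≤ν))) ⟩
            20 * (A * ν * η) + 4 * (A * ν * η)      ≡⟨ *-distribʳ-+ (A * ν * η) 20 4 ⟨
            24 * (A * ν * η)                        ≡⟨ trans (sym (*-assoc 24 (A * ν) η)) (cong (_* η) (sym H≡)) ⟩
            H * η                                   ≤⟨ m≤n*m (H * η) 3 ⟩
            3 * (H * η)                             ∎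
            where open ≤-Reasoning

        count : (τ * 3 + 1) * (n * (n * M)) < σ′ * (σ′ * σ′)
        count = begin-strict
          (τ * 3 + 1) * (n * (n * M))                    ≤⟨ *-mono-≤ (≤-trans (≤-reflexive (+-comm (τ * 3) 1)) (m≤n+m (1 + τ * 3) 2)) (*-mono-≤ n≤2 (*-monoˡ-≤ M n≤2)) ⟩
          M * (B₂ * (σ′ + σ′) * (B₂ * (σ′ + σ′) * M))    ≡⟨ regroup M B₂ σ′ ⟩
          4 * (M * M * (B₂ * B₂)) * (σ′ * σ′)            <⟨ *-monoˡ-< (σ′ * σ′) {{>-nonZero (*-mono-≤ 1≤σ′ 1≤σ′)}} t₆ ⟩
          σ′ * (σ′ * σ′)                                 ∎
          where
          open ≤-Reasoning
          1≤σ′ : 1 ≤ σ′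
          1≤σ′ = ≤-trans (s≤s z≤n) t₆
          n≤2 : n ≤ B₂ * (σ′ + σ′)
          n≤2 = ≤-trans n≤B₂ζ (*-monoʳ-≤ B₂ (≤-trans (≤-reflexive ζ≡) (+-monoˡ-≤ σ′ 1≤σ′)))
          regroup : ∀ m b s → m * (b * (s + s) * (b * (s + s) * m)) ≡ 4 * (m * m * (b * b)) * (s * s)
          regroup = solve-∀

        room : suc (suc (ζ + ζ)) ≤ η
        room = ≤-trans (arith ζ 1≤ζ) (*-monoˡ-≤ ζ 24≤H)
          where
          arith : ∀ ζ → 1 ≤ ζ → suc (suc (ζ + ζ)) ≤ 24 * ζ
          arith ζ h0 =
            cert (20 * ζ) (2 ⊗ h0) (solve (ζ ∷ []))

      scale : Scale n a
      scale = record
        { X = 32 * u ; u = u ; θ = θ ; κ = κ ; C = u * (u * u) + u * (u * u) ; C₅ = C₅ ; Δ = Δ ; L = L ; fuel = fuel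
        ; k₁ = B ; K₁ = suc (B * B) ; s₁ = 16 * u
        ; a*X≤n = ≤-trans (≤-reflexive (swap a u)) n≥
        ; gadget-slack = gadget-slack-arith θ≤u 1≤u
        ; tops = tops-arith θ≤u 1≤u 32u≤n
        ; enough = enough-arith {u = u} nnθ refl
        ; C₅≤₁ = C₅≤5
        ; C₅≤₂ = C₅≤C
        ; dense = dense′
        ; log = log
        ; log₁ = ≤-<-trans (times n 1≤n) log
        ; 4≤n = ≤-trans t₇ (≤-trans ζ≤u (≤-trans (m≤n*m u 32) 32u≤n))
        ; hits-many = hits
        ; 0<u = 1≤u
        ; reach₁ = n≤Bu
        ; small₁ = connection-small {k = B} n≤Bu 1≤u
        ; large₁ = connection-large {k = B} n≤Bu 1≤u (<-≤-trans t₁ ζ≤u)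
        ; chain-slack = subst (λ t → 2 + (θ * 5 + (θ * connectors B + t)) ≤ 32 * u) (sym (assoc B u))
            (chain-slack-arith {c = θ * connectors B} {B + B + (B + B + 9)} {0} θ≤u 1≤u θLc≤u (≤-trans t₂ ζ≤u))
        ; game-slack = game-slack-arith θ≤u 1≤u θLc≤u
        ; A = A ; Q = H * η ; σ′ = σ′ ; τ = τ ; Γ = Γ ; μ′ = μ′ ; η = η ; k₂ = B₂ ; K₂ = suc (B₂ * B₂) ; s₂ = ζ + ζ
        ; 0<A = 1≤A
        ; 0<Q = *-mono-≤ 1≤H (≤-trans 1≤ζ ζ≤η)
        ; slack = slack
        ; 0<s₂ = ≤-trans 1≤ζ (m≤m+n ζ ζ)
        ; reach₂ = n≤k₂s₂
        ; small₂ = connection-small {k = B₂} n≤k₂s₂ (≤-trans 1≤ζ (m≤m+n ζ ζ))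
        ; large₂ = connection-large {k = B₂} n≤k₂s₂ (≤-trans 1≤ζ (m≤m+n ζ ζ)) (<-≤-trans t₃ (m≤m+n ζ ζ))
        ; A*S≤ = A*S
        ; drops = drops
        ; Q*D≤ = subst (λ g → suc (H * η) * D ≤ g * η) (sym Γ≡) (Q-step H η D (m≤m*n D η {{>-nonZero (≤-trans 1≤ζ ζ≤η)}}))
        ; Q*E≤ = subst (λ z → H * η * (suc (z + z) * M + n * Lc) ≤ μ′ * (η * η)) ζ≡ (subst (λ q → q * E ≤ μ′ * (η * η)) (*-comm η H) Q*E)
        ; count = count
        ; room = subst (λ z → suc (suc (z + z)) ≤ η) ζ≡ room
        ; σ+σ≤S = subst (λ z → z + z ≤ M + connection-slack B₂ (ζ + ζ)) ζ≡ S≥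
        ; remains = remains-arith θ≤u 1≤u θLc≤u (≤-trans η≤θ θ≤u) 32u≤n
        ; fuel-enough = fuel-arith η D B (*-monoˡ-≤ (suc B) (≤-trans t₅ ζ≤η))
        }
        where
        swap : ∀ a u → a * (32 * u) ≡ 32 * (a * u)
        swap = solve-∀
        assoc : ∀ b z → b + b + (b + b + (9 + z)) ≡ b + b + (b + b + 9) + z
        assoc = solve-∀
        1≤n : 1 ≤ n
        1≤n = ≤-trans 1≤u (≤-trans (m≤n*m u 32) 32u≤n)
        n≤k₂s₂ : n ≤ B₂ * (ζ + ζ)
        n≤k₂s₂ = ≤-trans n≤B₂ζ (*-monoʳ-≤ B₂ (m≤m+n ζ ζ))
        S≥ : ζ + ζ ≤ M + connection-slack B₂ (ζ + ζ)
        S≥ = ≤-trans (m≤n+m (ζ + ζ) (M + (B₂ + B₂ + (B₂ + B₂ + 9)))) (≤-reflexive (assoc′ M B₂ (ζ + ζ)))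
          where
          assoc′ : ∀ m b z → m + (b + b + (b + b + 9)) + z ≡ m + (b + b + (b + b + (9 + z)))
          assoc′ = solve-∀

    private
      N : ℕ
      N = 32 * (a * (B * B * (Θ * H)))
      c : ℕ
      c = B₂ * C
      1≤C : 1 ≤ C
      1≤C = subst (1 ≤_) (sym C≡) (s≤s z≤n)
      instance
        nzN : NonZero N
        nzN = >-nonZero (*-mono-≤ (s≤s (z≤n {31})) (*-mono-≤ 1≤a (*-mono-≤ (*-mono-≤ 1≤B 1≤B) (*-mono-≤ 1≤Θ 1≤H))))
        nzC : NonZero C
        nzC = >-nonZero 1≤C
      thresholds : List ℕ
      thresholds = suc (2 * (B * B * (7 + suc (B * B)))) ∷ B + B + (B + B + 9) ∷ suc (2 * (B₂ * B₂ * (7 + suc (B₂ * B₂)))) ∷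
               M + (B₂ + B₂ + (B₂ + B₂ + 9)) ∷ D ∷ suc (suc (4 * (M * M * (B₂ * B₂)))) ∷ 4 ∷ suc (27 * (c * c)) * C ∷ []

    -- The sum of the thresholds stands in for their maximum.
    n₀ : ℕ
    n₀ = ∑ thresholds (λ t → t) * N

    scale-exists : ∀ n → n ≥ n₀ → Scale n a
    scale-exists n n≥n₀ = scale record
      { ζ = ζ ; L = L ; σ′ = pred ζ ; κ = θ ∸ 2
      ; ζ≡ = ζ≡ ; κ≡ = m+[n∸m]≡n 2≤θ ; n≥ = lower ; n≤ = upper
      ; t₁ = large (here refl)
      ; t₂ = large (there (here refl))
      ; t₃ = large (there (there (here refl)))
      ; t₄ = large (there (there (there (here refl))))
      ; t₅ = large (there (there (there (there (here refl)))))
      ; t₆ = s≤s⁻¹ (≤-trans (large (there (there (there (there (there (here refl))))))) (≤-reflexive ζ≡))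
      ; t₇ = 4≤ζ
      ; CL≤ζ = ≤-trans (≤-reflexive (*-comm C L)) (m/n*n≤m ζ C)
      ; 1≤L = ≤-trans (s≤s z≤n) 27<L
      ; log = ≤-<-trans (*-mono-≤ n≤cL n≤cL) (square<2^ c L (<⇒≤ 27<L))
      }
      where
      ζ L θ : ℕ
      ζ = n / N
      -- Linear in `n` rather than logarithmic: both `C * L ≤ ζ` and `n * n < 2 ^ L` then hold for
      -- large `n`.
      L = ζ / C
      θ = Θ * (H * ζ)
      large : ∀ {t} → t ∈ thresholds → t ≤ ζ
      large {t} t∈ = ≤-trans (∑-∈ (λ t → t) t∈) (≤-trans (≤-reflexive (sym (m*n/n≡m (∑ thresholds (λ t → t)) N))) (/-monoˡ-≤ N n≥n₀))
      4≤ζ : 4 ≤ ζ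
      4≤ζ = large (there (there (there (there (there (there (here refl)))))))
      ζ≡ : ζ ≡ suc (pred ζ)
      ζ≡ = sym (suc-pred ζ {{>-nonZero (≤-trans (s≤s z≤n) 4≤ζ)}})
      2≤θ : 2 ≤ θ
      2≤θ = ≤-trans (s≤s (s≤s z≤n)) (≤-trans 4≤ζ (≤-trans (times ζ 1≤H) (times (H * ζ) 1≤Θ)))
      regroup : ∀ k a b t h z → k * (a * (b * (t * (h * z)))) ≡ z * (k * (a * (b * (t * h))))
      regroup = solve-∀
      lower : 32 * (a * (B * B * θ)) ≤ n
      lower = ≤-trans (≤-reflexive (regroup 32 a (B * B) Θ H ζ)) (m/n*n≤m n N)
      upper : n ≤ 64 * (a * (B * B * θ))
      upper = begin
        n                              ≤⟨ <⇒≤ (m<suc[m/n]*n n N) ⟩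
        suc ζ * N                      ≤⟨ *-monoˡ-≤ N (+-monoˡ-≤ ζ (≤-trans (s≤s z≤n) 4≤ζ)) ⟩
        (ζ + ζ) * N                    ≡⟨ *-distribʳ-+ N ζ ζ ⟩
        ζ * N + ζ * N                  ≡⟨ cong₂ _+_ (regroup 32 a (B * B) Θ H ζ) (regroup 32 a (B * B) Θ H ζ) ⟨
        32 * (a * (B * B * θ)) + 32 * (a * (B * B * θ)) ≡⟨ *-distribʳ-+ (a * (B * B * θ)) 32 32 ⟨
        64 * (a * (B * B * θ))         ∎
        where open ≤-Reasoning
      27<L : 27 * (c * c) < L
      27<L = ≤-trans (≤-reflexive (sym (m*n/n≡m (suc (27 * (c * c))) C)))
        (/-monoˡ-≤ C (large (there (there (there (there (there (there (there (here refl))))))))))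
      n≤cL : n ≤ c * suc L
      n≤cL = begin
        n                              ≤⟨ upper ⟩
        64 * (a * (B * B * θ))         ≡⟨ regroup′ 64 a B Θ H ζ ⟩
        64 * a * (B * B * Θ) * H * ζ   ≡⟨ cong (λ b → b * (B * B * Θ) * H * ζ) B≡ ⟨
        B * (B * B * Θ) * H * ζ        ≡⟨ cong (_* ζ) (trans (cong (_* H) (sym ν≡)) (sym B₂≡)) ⟩
        B₂ * ζ                         ≤⟨ *-monoʳ-≤ B₂ (<⇒≤ (m<suc[m/n]*n ζ C)) ⟩
        B₂ * (suc L * C)               ≡⟨ regroup″ B₂ (suc L) C ⟩
        c * suc L                      ∎
        where
        open ≤-Reasoning
        regroup′ : ∀ k a b t h z → k * (a * (b * b * (t * (h * z)))) ≡ k * a * (b * b * t) * h * z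
        regroup′ = solve-∀
        regroup″ : ∀ b l c → b * (l * c) ≡ b * c * l
        regroup″ = solve-∀

  constants : ∀ a .{{_ : NonZero a}} → Constants a
  constants a = record
    { B = B ; A = 16 * a ; β = β ; Δ = pred β⁵ ; Θ = Θ ; ν = ν ; H = H ; B₂ = ν * H ; τ = τ ; Γ = Γ
    ; C = (2 + 2 * pred β⁵) * (2 + 2 * pred β⁵) + (16 * a + 16 * a * (suc (Γ + Γ) * suc (Γ + Γ)))
    ; B≡ = refl ; A≡ = refl ; β≡ = refl ; Δ≡ = suc-pred β⁵ {{>-nonZero (*-mono-≤ 1≤β (*-mono-≤ 1≤β (*-mono-≤ 1≤β (*-mono-≤ 1≤β 1≤β))))}}
    ; Θ≡ = refl ; ν≡ = refl ; H≡ = refl ; B₂≡ = refl ; τ≡ = refl ; Γ≡ = refl ; C≡ = refl }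
    where
    B β β⁵ Θ ν H τ Γ : ℕ
    B = 64 * a
    β = 2 * (B * B * B)
    β⁵ = β * (β * (β * (β * β)))
    Θ = suc ((2 + 2 * pred β⁵) * (2 * suc B))
    ν = B * (B * B * Θ)
    H = 24 * (16 * a * ν)
    τ = 4 * (16 * a * (ν * ν) * connectors (ν * H))
    Γ = suc H * (suc τ * 3 + connectors (ν * H))
    1≤B : 1 ≤ B
    1≤B = *-mono-≤ (s≤s (z≤n {63})) (>-nonZero⁻¹ a)
    1≤β : 1 ≤ β
    1≤β = *-mono-≤ (s≤s (z≤n {1})) (*-mono-≤ (*-mono-≤ 1≤B 1≤B) 1≤B)

  scales : ∀ a → ∃ λ n₀ → ∀ n → n ≥ n₀ → Scale n (suc a)
  scales a = n₀ (constants (suc a)) , scale-exists (constants (suc a))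

-- Passing from rational to integral degree conditions.

module Rationals where
  open Prelude
  open import Data.Integer as ℤ using (+_; -[1+_]; +≤+; +<+)
  import Data.Integer.Properties as ℤₚ
  open import Data.Rational as ℚ using (ℚ; mkℚ; 0ℚ; toℚᵘ; fromℚᵘ; *<*)
  import Data.Rational.Properties as ℚₚ
  open import Data.Rational.Unnormalised as ℚᵘ using (ℚᵘ; mkℚᵘ; *≤*)
  import Data.Rational.Unnormalised.Properties as ℚᵘₚ

  fromℚᵘ-mono-≤ : ∀ {p q} → p ℚᵘ.≤ q → fromℚᵘ p ℚ.≤ fromℚᵘ q
  fromℚᵘ-mono-≤ {p} {q} p≤q = ℚₚ.toℚᵘ-cancel-≤
    (ℚᵘₚ.≤-respˡ-≃ (ℚᵘₚ.≃-sym (ℚₚ.toℚᵘ-fromℚᵘ p)) (ℚᵘₚ.≤-respʳ-≃ (ℚᵘₚ.≃-sym (ℚₚ.toℚᵘ-fromℚᵘ q)) p≤q))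

  ℕ→ℚ-mono-≤ : ∀ {m n} → m ≤ n → ℕ→ℚ m ℚ.≤ ℕ→ℚ n
  ℕ→ℚ-mono-≤ {m} {n} m≤n = fromℚᵘ-mono-≤ {mkℚᵘ (+ m) 0} {mkℚᵘ (+ n) 0} (*≤* (ℤₚ.*-monoʳ-≤-nonNeg (+ 1) (+≤+ m≤n)))

  ℕ→ℚ-half : ∀ {c n} → c + c ≤ n → ℕ→ℚ c ℚ.≤ + n ℚ./ 2
  ℕ→ℚ-half {c} {n} h = fromℚᵘ-mono-≤ {mkℚᵘ (+ c) 0} {mkℚᵘ (+ n) 1} (*≤* (subst₂ ℤ._≤_ (ℤₚ.pos-* c 2) (ℤₚ.pos-* n 1)
    (+≤+ (subst₂ _≤_ (double c) (sym (*-identityʳ n)) h))))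
    where
    double : ∀ c → c + c ≡ c * 2
    double c = solve (c ∷ [])

  -- A positive rational is at least 1 / a, where a is its denominator.
  clear-denominator : ∀ α → 0ℚ ℚ.< α → ∃ λ k → ∀ c n d {m} → ℕ→ℚ c ℚ.≤ m → m ℚ.+ α ℚ.* ℕ→ℚ n ℚ.≤ ℕ→ℚ d →
                      suc k * c + n ≤ suc k * d
  clear-denominator (mkℚ (+ zero) k _) (*<* (+<+ ()))
  clear-denominator (mkℚ -[1+ p ] k _) (*<* ())
  clear-denominator α@(mkℚ (+ suc p) k _) _ = k , bound
    where
    bound : ∀ c n d {m} → ℕ→ℚ c ℚ.≤ m → m ℚ.+ α ℚ.* ℕ→ℚ n ℚ.≤ ℕ→ℚ d → suc k * c + n ≤ suc k * d
    bound c n d {m} c≤m h = integral (begin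
      mkℚᵘ (+ c) 0 ℚᵘ.+ mkℚᵘ (+ 1) k ℚᵘ.* mkℚᵘ (+ n) 0
        ≤⟨ ℚᵘₚ.+-mono-≤ (ℚᵘₚ.≤-respˡ-≃ (ℚₚ.toℚᵘ-fromℚᵘ (mkℚᵘ (+ c) 0)) (ℚₚ.toℚᵘ-mono-≤ c≤m))
             (ℚᵘₚ.*-monoˡ-≤-nonNeg (mkℚᵘ (+ n) 0) {mkℚᵘ (+ 1) k} {toℚᵘ α} (*≤* (ℤₚ.*-monoʳ-≤-nonNeg (+ suc k) (+≤+ (s≤s (z≤n {p})))))) ⟩
      toℚᵘ m ℚᵘ.+ toℚᵘ α ℚᵘ.* mkℚᵘ (+ n) 0
        ≃⟨ ℚᵘₚ.+-congʳ (toℚᵘ m) (ℚᵘₚ.*-congˡ {toℚᵘ α} (ℚᵘₚ.≃-sym (ℚₚ.toℚᵘ-fromℚᵘ (mkℚᵘ (+ n) 0)))) ⟩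
      toℚᵘ m ℚᵘ.+ toℚᵘ α ℚᵘ.* toℚᵘ (ℕ→ℚ n)
        ≃⟨ ℚᵘₚ.+-congʳ (toℚᵘ m) (ℚᵘₚ.≃-sym (ℚₚ.toℚᵘ-homo-* α (ℕ→ℚ n))) ⟩
      toℚᵘ m ℚᵘ.+ toℚᵘ (α ℚ.* ℕ→ℚ n)
        ≃⟨ ℚᵘₚ.≃-sym (ℚₚ.toℚᵘ-homo-+ m (α ℚ.* ℕ→ℚ n)) ⟩
      toℚᵘ (m ℚ.+ α ℚ.* ℕ→ℚ n)
        ≤⟨ ℚₚ.toℚᵘ-mono-≤ h ⟩
      toℚᵘ (ℕ→ℚ d)
        ≃⟨ ℚₚ.toℚᵘ-fromℚᵘ (mkℚᵘ (+ d) 0) ⟩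
      mkℚᵘ (+ d) 0 ∎)
      where
      open ℚᵘₚ.≤-Reasoning
      integral : mkℚᵘ (+ c) 0 ℚᵘ.+ mkℚᵘ (+ 1) k ℚᵘ.* mkℚᵘ (+ n) 0 ℚᵘ.≤ mkℚᵘ (+ d) 0 → suc k * c + n ≤ suc k * d
      integral (*≤* le) = ℤₚ.drop‿+≤+ (subst₂ ℤ._≤_ left right le)
        where
        left : (+ c ℤ.* + (suc k * 1) ℤ.+ (+ 1 ℤ.* + n) ℤ.* + 1) ℤ.* + 1 ≡ + (suc k * c + n)
        left = trans (cong (ℤ._* + 1) (cong₂ ℤ._+_ (sym (ℤₚ.pos-* c _)) (trans (cong (ℤ._* + 1) (sym (ℤₚ.pos-* 1 n))) (sym (ℤₚ.pos-* (1 * n) 1)))))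
          (trans (sym (ℤₚ.pos-* (c * (suc k * 1) + 1 * n * 1) 1)) (cong +_ (simplify c k n)))
          where
          simplify : ∀ c k n → (c * (suc k * 1) + 1 * n * 1) * 1 ≡ suc k * c + n
          simplify = solve-∀
        right : + d ℤ.* + (1 * (suc k * 1)) ≡ + (suc k * d)
        right = trans (sym (ℤₚ.pos-* d _)) (cong +_ (simplify d k))
          where
          simplify : ∀ d k → d * (1 * (suc k * 1)) ≡ suc k * d
          simplify = solve-∀

-- Putting the pieces together.

module Conclusion where
  open Prelude
  open Counting
  open Paths using (N)
  open Rationals
  open Assembling
  open Scales using (scales)
  open import Data.Fin using (Fin; toℕ)
  open import Data.List using (filterᵇ; allFin)
  open import Data.Integer using (+_)
  import Data.Rational as ℚ
  import Data.Rational.Properties as ℚₚ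

  opaque
    unfolding V

    pairDeg≡# : ∀ {n} (H : 3Graph n) x y → pairDeg H x y ≡ # (N H x y)
    pairDeg≡# {n} H x y = trans (sym (trans (∑-const (filterᵇ (N H x y) (allFin n)) 1) (*-identityʳ _)))
      (trans (∑-filter (N H x y) (allFin n) (λ _ → 1)) (∑-cong (allFin n) λ z → *-identityʳ _))

  integral-degrees : ∀ α → ℚ.0ℚ ℚ.< α → ∃ λ k → ∀ {n} (H : 3Graph n) →
    (∀ (i j : Fin n) → i ≢ j → (val i ℚ.⊓ val j ℚ.⊓ (+ n ℚ./ 2)) ℚ.+ α ℚ.* ℕ→ℚ n ℚ.≤ ℕ→ℚ (pairDeg H i j)) →
    ∀ {x y} → x ≢ y → ∀ c → c ≤ toℕ x → c ≤ toℕ y → c + c ≤ n → suc k * c + n ≤ suc k * # (N H x y)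
  integral-degrees α 0<α =
    let k , clear = clear-denominator α 0<α in
    k , λ {n} H degrees {x} {y} x≢y c cx cy ch → clear c n (# (N H x y))
      -- Positions count from 0 and vertices from 1, so one unit of the degree is given away here.
      (ℚₚ.⊓-glb (ℚₚ.⊓-glb (ℕ→ℚ-mono-≤ {c} {suc (toℕ x)} (m≤n⇒m≤1+n cx)) (ℕ→ℚ-mono-≤ {c} {suc (toℕ y)} (m≤n⇒m≤1+n cy)))
        (ℕ→ℚ-half {c} ch))
      (subst (λ d → (val x ℚ.⊓ val y ℚ.⊓ (+ n ℚ./ 2)) ℚ.+ α ℚ.* ℕ→ℚ n ℚ.≤ ℕ→ℚ d) (pairDeg≡# H x y) (degrees x y x≢y))

  -- The successor excludes `n = 0`, where no cycle exists.
  threshold : ℕ → ℕ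
  threshold k = suc (proj₁ (scales k))

  hamiltonian-above : ∀ k n → n ≥ threshold k → (H : 3Graph n) →
    (∀ {x y} → x ≢ y → ∀ c → c ≤ toℕ x → c ≤ toℕ y → c + c ≤ n → suc k * c + n ≤ suc k * # (N H x y)) →
    TightHamCycle H
  hamiltonian-above k (suc m) n≥ H degrees =
    let h₀ , n≤h₀ , h₀≤n = Quantile.halve (suc m) in
    hamiltonian (suc k) (proj₂ (scales k) (suc m) (≤-trans (n≤1+n _) n≥)) H degrees {h₀} n≤h₀ h₀≤n

open import Data.Nat using (ℕ; _≥_)
open import Data.Fin using (Fin)
open import Data.Integer using (+_)
open import Data.Rational using (ℚ; 0ℚ; _<_; _≤_; _/_; _⊓_; _+_; _*_)
open import Data.Product using (∃; _,_)
open import Relation.Binary.PropositionalEquality using (_≢_)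

theorem1p4 : (α : ℚ) → 0ℚ < α →
    ∃ λ (n₀ : ℕ) → ∀ (n : ℕ) → n ≥ n₀ → (H : 3Graph n) →
    (∀ (i j : Fin n) → i ≢ j →
    (val i ⊓ val j ⊓ (+ n / 2)) + α * ℕ→ℚ n ≤ ℕ→ℚ (pairDeg H i j)) →
    TightHamCycle H
theorem1p4 α 0<α =
  let k , integral = Conclusion.integral-degrees α 0<α in
  Conclusion.threshold k , λ n n≥n₀ H degrees → Conclusion.hamiltonian-above k n n≥n₀ H (integral H degrees)
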